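{- Let $n\geq 4$ and $k\geq 4$ be integers with $k\neq\frac{2n+1}{3}$. Then $\mathcal{D}_k(\vec{C}_{2n+1}\langle n\rangle)$ is connected and has diameter at most $4n+2+\lfloor\frac n2\rfloor$.
   Context: For $n\ge2$, $\vec{C}_{2n+1}\langle n\rangle$ is the tournament with vertex set $\mathbb{Z}_{2n+1}$ and arcs $(a,a+j)$ for all $a\in\mathbb{Z}_{2n+1}$, $j\in\{1,\dots,n-1\}$, together with arcs $(a,a-n)$ for all $a\in\mathbb{Z}_{2n+1}$. A $k$-coloring of a digraph $D$ is a function $\alpha\colon V(D)\to\{1,\dots,k\}$ such that every color class $\{x:\alpha(x)=i\}$ (possibly empty) induces an acyclic subdigraph. The $k$-dicoloring graph $\mathcal{D}_k(D)$ has the $k$-colorings of $D$ as vertices, two being adjacent iff they differ on exactly one vertex. -}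

module Defs where

open import Data.Nat using (ℕ; zero; suc; _+_; _*_; _∸_; _≤_; _<_)
open import Data.Nat.DivMod using (_%_)
open import Data.Fin using (Fin; toℕ; fromℕ; inject₁) renaming (zero to fzero; suc to fsuc)
open import Data.Product using (Σ; ∃; _×_; _,_)
open import Data.Sum using (_⊎_)
open import Relation.Binary.PropositionalEquality using (_≡_; _≢_)
open import Relation.Nullary using (¬_)
open import Function.Definitions using (Injective)

record Digraph : Set₁ where
  field
    size : ℕ
    Arc  : Fin size → Fin size → Set
open Digraph public

next : ∀ {l} → Fin (suc l) → Fin (suc l)
next {zero}  _        = fzero
next {suc l} fzero    = fsuc fzero
next {suc l} (fsuc i) with next {l} i
... | fzero  = fzero
... | fsuc j = fsuc (fsuc j)

CycleIn : (D : Digraph) → (Fin (size D) → Set) → Set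
CycleIn D S =
  Σ ℕ λ l → Σ (Fin (suc (suc l)) → Fin (size D)) λ c →
    Injective _≡_ _≡_ c × (∀ i → S (c i)) × (∀ i → Arc D (c i) (c (next i)))

Colouring : Digraph → ℕ → Set
Colouring D k = Fin (size D) → Fin k

IsDicolouring : (D : Digraph) (k : ℕ) → Colouring D k → Set
IsDicolouring D k α = ∀ (i : Fin k) → ¬ CycleIn D (λ x → α x ≡ i)

Adjacent : (D : Digraph) (k : ℕ) → Colouring D k → Colouring D k → Set
Adjacent D k α β = Σ (Fin (size D)) λ v → (α v ≢ β v) × (∀ w → w ≢ v → α w ≡ β w)

WalkOfLength : (D : Digraph) (k : ℕ) → ℕ → Colouring D k → Colouring D k → Set
WalkOfLength D k t α β =
  Σ (Fin (suc t) → Colouring D k) λ γ →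
    (∀ i → IsDicolouring D k (γ i)) ×
    (∀ (i : Fin t) → Adjacent D k (γ (inject₁ i)) (γ (fsuc i))) ×
    (∀ x → γ fzero x ≡ α x) × (∀ x → γ (fromℕ t) x ≡ β x)

DicolConnected : Digraph → ℕ → Set
DicolConnected D k = ∀ α β → IsDicolouring D k α → IsDicolouring D k β →
  Σ ℕ λ t → WalkOfLength D k t α β

DicolDiamAtMost : Digraph → ℕ → ℕ → Set
DicolDiamAtMost D k d = ∀ α β → IsDicolouring D k α → IsDicolouring D k β →
  Σ ℕ λ t → t ≤ d × WalkOfLength D k t α β

-- The tournament C⃗_{2n+1}⟨n⟩ on ℤ_{2n+1} ≅ Fin (2n+1):
-- arc (a,b) iff b - a mod (2n+1) ∈ {1,…,n-1} ∪ {n+1}  (a - n ≡ a + (n+1)).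
circDiff : (n : ℕ) → Fin (suc (2 * n)) → Fin (suc (2 * n)) → ℕ
circDiff n a b = (toℕ b + (suc (2 * n) ∸ toℕ a)) % suc (2 * n)

C⟨_⟩ : ℕ → Digraph
C⟨ n ⟩ = record
  { size = suc (2 * n)
  ; Arc  = λ a b → (1 ≤ circDiff n a b × circDiff n a b ≤ n ∸ 1) ⊎ circDiff n a b ≡ suc n
  }

{-# OPTIONS --safe #-}
module Submission where

-- A set of vertices is acyclic iff it contains no directed triangle; in
-- particular every interval of n consecutive vertices is acyclic.  As soon as a
-- colour p fills such an interval, the n + 1 remaining vertices can be recoloured
-- almost freely, so two colourings in which p fills the same interval are at
-- distance at most n + 2.  Of the two intervals that partition the vertices other
-- than some v uncoloured by p, one contains at least half of the p-coloured
-- vertices of α and β together; hence filling it in both costs at most 2n in total,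
-- apart from what it takes to free the vertices outside it from p.  To free them,
-- a colour q whose class lies in an interval absorbs a third colour r there, after
-- which q and r can take over from p; r can be chosen so that this costs only
-- about n / 2 extra steps.  If no class lies in an interval, every class contains
-- two vertices at distance n.  These classes cannot all have the form
-- {c, c+1, c+n+1}, since 3k ≠ 2n+1, and then one recolouring yields such a colour q.

open import Defs
open import Algebra.Properties.CommutativeSemigroup using (interchange)
open import Data.Bool using (Bool; true; false; _∧_; _∨_; if_then_else_; T)
open import Data.Bool.Properties using (T-∧)
open import Data.Empty using (⊥; ⊥-elim)
open import Data.Fin using (Fin; toℕ; fromℕ<; fromℕ; inject₁) renaming (zero to fzero; suc to fsuc; _≟_ to _≟ᶠ_)
import Data.Fin.Properties as Finₚ
open import Data.List using (List; []; _∷_; map; length; allFin)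
open import Data.List.Membership.Propositional using (_∈_)
open import Data.List.Membership.Propositional.Properties using (∈-allFin)
open import Data.List.Properties using (length-tabulate)
open import Data.List.Relation.Unary.All using (All; []; _∷_)
open import Data.List.Relation.Unary.AllPairs using ([]; _∷_)
open import Data.List.Relation.Unary.Any using (here; there)
open import Data.List.Relation.Unary.Unique.Propositional using (Unique)
open import Data.List.Relation.Unary.Unique.Propositional.Properties using (allFin⁺)
open import Data.Nat
open import Data.Nat.DivMod using (m%n<n; m<n⇒m%n≡m; [m+n]%n≡m%n; /-monoˡ-≤)
open import Data.Nat.Properties
open import Data.Product using (Σ; ∃; _×_; _,_; proj₁; proj₂)
open import Data.Sum using (_⊎_; inj₁; inj₂; [_,_]′)
open import Data.Unit using (⊤; tt)
open import Function.Bundles using (Equivalence)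
open import Relation.Binary.Definitions using (tri<; tri≈; tri>)
open import Relation.Binary.PropositionalEquality
open import Relation.Nullary using (¬_; Dec; yes; no)
open import Relation.Nullary.Decidable using (_×-dec_; _⊎-dec_; ¬?; toSum)

-- The walk constructed has length at most 4n + 4, and n / 2 ≥ 2 then gives the stated bound. Two
-- obstacles shape the argument. One is that k may be 4. The colour p has to differ from the
-- absorbing colour q of either colouring. If a preparatory recolouring has put a vertex into a
-- colour q*, then p = q* forces that vertex to be recoloured once more. Four colours allow p to
-- avoid only three, so q* is avoided for one of the colourings and tolerated for the other. The
-- extra costs h and h′ then satisfy 2h ≤ n + 2 and 2h′ ≤ n + 3, and rounding hides the loss: h + h′
-- ≤ n + 2. The other is that the absorbing interval leaves n + 1 positions, one more than an
-- interval that is always triangle-free. Only its two ends, which lie at distance n, can cause a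
-- conflict. One further step resolves it, except when a class contains vertices c, c+1, c+n+1,
-- which block both ends at once. This shape is the source of every special case, and n = 4, where
-- the budget has no slack, needs separate arguments.

module LinearArithmetic where

  -- Linear arithmetic over ℕ by Fourier–Motzkin elimination.  A linear form is
  -- its list of coefficients, the constant term first.

  Lin : Set
  Lin = List ℕ

  value : Lin → List ℕ → ℕ
  value []       _        = 0
  value (c ∷ _)  []       = 0
  value (c ∷ cs) (x ∷ xs) = c * x + value cs xs

  infixl 6 _⊞_
  _⊞_ : Lin → Lin → Lin
  []       ⊞ ds       = ds
  (c ∷ cs) ⊞ []       = c ∷ cs
  (c ∷ cs) ⊞ (d ∷ ds) = c + d ∷ cs ⊞ ds

  value-⊞ : ∀ cs ds ρ → value (cs ⊞ ds) ρ ≡ value cs ρ + value ds ρ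
  value-⊞ []       ds       ρ       = refl
  value-⊞ (c ∷ cs) []       ρ       = sym (+-identityʳ _)
  value-⊞ (c ∷ cs) (d ∷ ds) []      = refl
  value-⊞ (c ∷ cs) (d ∷ ds) (x ∷ ρ) = begin
    (c + d) * x + value (cs ⊞ ds) ρ              ≡⟨ cong₂ _+_ (*-distribʳ-+ x c d) (value-⊞ cs ds ρ) ⟩
    c * x + d * x + (value cs ρ + value ds ρ)    ≡⟨ interchange +-commutativeSemigroup (c * x) (d * x) _ _ ⟩
    c * x + value cs ρ + (d * x + value ds ρ)    ∎
    where open ≡-Reasoning

  scale : ℕ → Lin → Lin
  scale k = map (k *_)

  value-scale : ∀ k cs ρ → value (scale k cs) ρ ≡ k * value cs ρ
  value-scale k []       ρ       = sym (*-zeroʳ k)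
  value-scale k (c ∷ cs) []      = sym (*-zeroʳ k)
  value-scale k (c ∷ cs) (x ∷ ρ) = begin
    k * c * x + value (scale k cs) ρ  ≡⟨ cong₂ _+_ (*-assoc k c x) (value-scale k cs ρ) ⟩
    k * (c * x) + k * value cs ρ      ≡⟨ *-distribˡ-+ k (c * x) _ ⟨
    k * (c * x + value cs ρ)          ∎
    where open ≡-Reasoning

  unit : ℕ → Lin
  unit zero    = 1 ∷ []
  unit (suc i) = 0 ∷ unit i

  Ineq : Set
  Ineq = Lin × Lin

  Holds : List ℕ → Ineq → Set
  Holds ρ (l , r) = value l ρ ≤ value r ρ

  infixl 6 _⊟_
  _⊟_ : Lin → Lin → Lin
  []       ⊟ ds       = []
  (c ∷ cs) ⊟ []       = c ∷ cs
  (c ∷ cs) ⊟ (d ∷ ds) = c ∸ d ∷ cs ⊟ ds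

  -- In every coordinate both sides have the maximum of the two coefficients. So replacing (l, r) by
  -- (l ⊟ r, r ⊟ l) keeps the difference of the two sides without negative numbers.
  value-⊟ : ∀ cs ds ρ → value cs ρ + value (ds ⊟ cs) ρ ≡ value ds ρ + value (cs ⊟ ds) ρ
  value-⊟ []       []       ρ       = refl
  value-⊟ []       (d ∷ ds) ρ       = sym (+-identityʳ _)
  value-⊟ (c ∷ cs) []       ρ       = +-identityʳ _
  value-⊟ (c ∷ cs) (d ∷ ds) []      = refl
  value-⊟ (c ∷ cs) (d ∷ ds) (x ∷ ρ) = begin
    c * x + value cs ρ + ((d ∸ c) * x + value (ds ⊟ cs) ρ)
      ≡⟨ interchange +-commutativeSemigroup (c * x) (value cs ρ) _ _ ⟩
    c * x + (d ∸ c) * x + (value cs ρ + value (ds ⊟ cs) ρ)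
      ≡⟨ cong₂ _+_ (*-distribʳ-+ x c (d ∸ c)) (sym (value-⊟ cs ds ρ)) ⟨
    (c + (d ∸ c)) * x + (value ds ρ + value (cs ⊟ ds) ρ)
      ≡⟨ cong (λ m → m * x + (value ds ρ + value (cs ⊟ ds) ρ))
              (trans (sym (m⊔n≡m+n∸m c d)) (trans (⊔-comm c d) (m⊔n≡m+n∸m d c))) ⟩
    (d + (c ∸ d)) * x + (value ds ρ + value (cs ⊟ ds) ρ)
      ≡⟨ cong (_+ (value ds ρ + value (cs ⊟ ds) ρ)) (*-distribʳ-+ x d (c ∸ d)) ⟩
    d * x + (c ∸ d) * x + (value ds ρ + value (cs ⊟ ds) ρ)
      ≡⟨ interchange +-commutativeSemigroup (d * x) ((c ∸ d) * x) _ _ ⟩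
    d * x + value ds ρ + ((c ∸ d) * x + value (cs ⊟ ds) ρ) ∎
    where
    open ≡-Reasoning
    m⊔n≡m+n∸m : ∀ m n → m ⊔ n ≡ m + (n ∸ m)
    m⊔n≡m+n∸m zero    n       = refl
    m⊔n≡m+n∸m (suc m) zero    = cong suc (sym (+-identityʳ m))
    m⊔n≡m+n∸m (suc m) (suc n) = cong suc (m⊔n≡m+n∸m m n)

  cancel : Ineq → Ineq
  cancel (l , r) = l ⊟ r , r ⊟ l

  cancel-sound : ∀ ρ q → Holds ρ q → Holds ρ (cancel q)
  cancel-sound ρ (l , r) l≤r = +-cancelˡ-≤ (value r ρ) _ _ (begin
    value r ρ + value (l ⊟ r) ρ ≡⟨ value-⊟ l r ρ ⟨
    value l ρ + value (r ⊟ l) ρ ≤⟨ +-monoˡ-≤ _ l≤r ⟩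
    value r ρ + value (r ⊟ l) ρ ∎)
    where open ≤-Reasoning

  combine : ℕ → Ineq → ℕ → Ineq → Ineq
  combine a (l , r) b (l′ , r′) = cancel (scale a l ⊞ scale b l′ , scale a r ⊞ scale b r′)

  combine-sound : ∀ ρ a q b q′ → Holds ρ q → Holds ρ q′ → Holds ρ (combine a q b q′)
  combine-sound ρ a (l , r) b (l′ , r′) h h′ = cancel-sound ρ (scale a l ⊞ scale b l′ , scale a r ⊞ scale b r′) (begin
    value (scale a l ⊞ scale b l′) ρ           ≡⟨ expand l l′ ⟩
    a * value l ρ + b * value l′ ρ             ≤⟨ +-mono-≤ (*-monoʳ-≤ a h) (*-monoʳ-≤ b h′) ⟩
    a * value r ρ + b * value r′ ρ             ≡⟨ expand r r′ ⟨
    value (scale a r ⊞ scale b r′) ρ           ∎)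
    where
    open ≤-Reasoning
    expand : ∀ c d → value (scale a c ⊞ scale b d) ρ ≡ a * value c ρ + b * value d ρ
    expand c d = trans (value-⊞ (scale a c) _ ρ) (cong₂ _+_ (value-scale a c ρ) (value-scale b d ρ))

  coeff : ℕ → Lin → ℕ
  coeff _       []       = 0
  coeff zero    (c ∷ _)  = c
  coeff (suc i) (_ ∷ cs) = coeff i cs

  allZero : Lin → Bool
  allZero []       = true
  allZero (c ∷ cs) = (c ≡ᵇ 0) ∧ allZero cs

  allZero-sound : ∀ cs ρ → T (allZero cs) → value cs ρ ≡ 0
  allZero-sound []          ρ       _ = refl
  allZero-sound (zero ∷ cs) []      _ = refl
  allZero-sound (zero ∷ cs) (x ∷ ρ) t = allZero-sound cs ρ t

  absurdᵇ : Ineq → Bool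
  absurdᵇ (l , r) = (1 ≤ᵇ coeff 0 l) ∧ allZero r

  absurd-sound : ∀ ρ q → T (absurdᵇ q) → ¬ Holds (1 ∷ ρ) q
  absurd-sound ρ (suc c ∷ cs , r) t h =
    1+n≰n (≤-trans (≤-trans (s≤s z≤n) h) (≤-reflexive (allZero-sound r (1 ∷ ρ) t)))

  data AllHold (ρ : List ℕ) : List Ineq → Set where
    []  : AllHold ρ []
    _∷_ : ∀ {q qs} → Holds ρ q → AllHold ρ qs → AllHold ρ (q ∷ qs)

  data Sides : Set where
    sides : (upper lower rest : List Ineq) → Sides

  -- After `cancel` a variable occurs on at most one side, so a nonzero coefficient on the left
  -- makes an upper bound of xᵢ and one on the right a lower bound.
  classify : ℕ → List Ineq → Sides
  classify i [] = sides [] [] []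
  classify i (q ∷ qs) with classify i qs | coeff i (proj₁ q) | coeff i (proj₂ q)
  ... | sides us ls rs | suc _ | _     = sides (q ∷ us) ls rs
  ... | sides us ls rs | zero  | suc _ = sides us (q ∷ ls) rs
  ... | sides us ls rs | zero  | zero  = sides us ls (q ∷ rs)

  data SidesHold (ρ : List ℕ) : Sides → Set where
    sides : ∀ {us ls rs} → AllHold ρ us → AllHold ρ ls → AllHold ρ rs → SidesHold ρ (sides us ls rs)

  classify-sound : ∀ ρ i qs → AllHold ρ qs → SidesHold ρ (classify i qs)
  classify-sound ρ i [] [] = sides [] [] []
  classify-sound ρ i (q ∷ qs) (h ∷ hs)
    with classify i qs | coeff i (proj₁ q) | coeff i (proj₂ q) | classify-sound ρ i qs hs
  ... | sides us ls rs | suc _ | _     | sides hu hl hr = sides (h ∷ hu) hl hr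
  ... | sides us ls rs | zero  | suc _ | sides hu hl hr = sides hu (h ∷ hl) hr
  ... | sides us ls rs | zero  | zero  | sides hu hl hr = sides hu hl (h ∷ hr)

  keep : Ineq → List Ineq → List Ineq
  keep q qs = if allZero (proj₁ q) then qs else q ∷ qs

  keep-sound : ∀ ρ q qs → Holds ρ q → AllHold ρ qs → AllHold ρ (keep q qs)
  keep-sound ρ q qs h hs with allZero (proj₁ q)
  ... | true  = hs
  ... | false = h ∷ hs

  -- Each bound is scaled by the coefficient of xᵢ in the other one, so xᵢ has the same coefficient
  -- on both sides and disappears in the `cancel` inside `combine`.
  pairUp : ℕ → Ineq → List Ineq → List Ineq → List Ineq
  pairUp i u []       acc = acc
  pairUp i u (l ∷ ls) acc =
    keep (combine (coeff i (proj₂ l)) u (coeff i (proj₁ u)) l) (pairUp i u ls acc)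

  pairUp-sound : ∀ ρ i u ls acc → Holds ρ u → AllHold ρ ls → AllHold ρ acc → AllHold ρ (pairUp i u ls acc)
  pairUp-sound ρ i u []       acc hu []       ha = ha
  pairUp-sound ρ i u (l ∷ ls) acc hu (h ∷ hs) ha =
    keep-sound ρ _ _ (combine-sound ρ (coeff i (proj₂ l)) u (coeff i (proj₁ u)) l hu h)
               (pairUp-sound ρ i u ls acc hu hs ha)

  pairAll : ℕ → List Ineq → List Ineq → List Ineq → List Ineq
  pairAll i []       ls acc = acc
  pairAll i (u ∷ us) ls acc = pairUp i u ls (pairAll i us ls acc)

  pairAll-sound : ∀ ρ i us ls acc → AllHold ρ us → AllHold ρ ls → AllHold ρ acc →
                  AllHold ρ (pairAll i us ls acc)
  pairAll-sound ρ i []       ls acc []       hl ha = ha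
  pairAll-sound ρ i (u ∷ us) ls acc (h ∷ hs) hl ha =
    pairUp-sound ρ i u ls _ h hl (pairAll-sound ρ i us ls acc hs hl ha)

  -- The bound 0 ≤ xᵢ takes part in the elimination of xᵢ.
  eliminate : ℕ → Sides → List Ineq
  eliminate i (sides us ls rs) = pairAll i us (([] , unit i) ∷ ls) rs

  eliminate-sound : ∀ ρ i s → SidesHold ρ s → AllHold ρ (eliminate i s)
  eliminate-sound ρ i (sides us ls rs) (sides hu hl hr) =
    pairAll-sound ρ i us _ rs hu (z≤n ∷ hl) hr

  anyAbsurd : List Ineq → Bool
  anyAbsurd []       = false
  anyAbsurd (q ∷ qs) = absurdᵇ q ∨ anyAbsurd qs

  anyAbsurd-sound : ∀ ρ qs → T (anyAbsurd qs) → ¬ AllHold (1 ∷ ρ) qs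
  anyAbsurd-sound ρ (q ∷ qs) t (h ∷ hs) with absurdᵇ q in eq
  ... | true  = absurd-sound ρ q (subst T (sym eq) tt) h
  ... | false = anyAbsurd-sound ρ qs t hs

  -- Bounds the number of inequalities that eliminating xᵢ creates; the successor stands for 0 ≤ xᵢ.
  -- Taking the cheapest variable first keeps the elimination feasible during type checking.
  weight : ℕ → List Ineq → ℕ
  weight i qs with classify i qs
  ... | sides us ls _ = length us * suc (length ls)

  remove : ℕ → List ℕ → List ℕ
  remove i []       = []
  remove i (j ∷ js) = if i ≡ᵇ j then js else j ∷ remove i js

  select : List ℕ → List Ineq → ℕ × ℕ
  select []       qs = 1 , weight 1 qs
  select (i ∷ []) qs = i , weight i qs
  select (i ∷ is) qs with select is qs | weight i qs
  ... | j , w | w′ = if w′ <ᵇ w then (i , w′) else (j , w)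

  refute : ℕ → List ℕ → List Ineq → Bool
  refute zero    vs qs = anyAbsurd qs
  refute (suc m) vs qs =
    anyAbsurd qs ∨ (let i = proj₁ (select vs qs) in refute m (remove i vs) (eliminate i (classify i qs)))

  refute-sound : ∀ ρ m vs qs → T (refute m vs qs) → ¬ AllHold (1 ∷ ρ) qs
  refute-sound ρ zero    vs qs t hs = anyAbsurd-sound ρ qs t hs
  refute-sound ρ (suc m) vs qs t hs with anyAbsurd qs in eq
  ... | true  = anyAbsurd-sound ρ qs (subst T (sym eq) tt) hs
  ... | false = let i = proj₁ (select vs qs) in
    refute-sound ρ m (remove i vs) _ t (eliminate-sound _ i _ (classify-sound _ i qs hs))

  infixl 6 _:+_
  infixl 7 _:*_
  infix  4 _:≤_ _:<_ _:≡_ _:≢_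
  infixr 3 _:×_
  infixr 2 _:⊎_
  infixr 1 _⇒_ ∴_

  data Exp : Set where
    var  : ℕ → Exp
    con  : ℕ → Exp
    _:+_ : Exp → Exp → Exp
    _:*_ : ℕ → Exp → Exp
    :suc : Exp → Exp

  lookup : List ℕ → ℕ → ℕ
  lookup []      _       = 0
  lookup (x ∷ _) zero    = x
  lookup (_ ∷ ρ) (suc i) = lookup ρ i

  ⟦_⟧ₑ : Exp → List ℕ → ℕ
  ⟦ var i ⟧ₑ   ρ = lookup ρ i
  ⟦ con k ⟧ₑ   ρ = k
  ⟦ a :+ b ⟧ₑ  ρ = ⟦ a ⟧ₑ ρ + ⟦ b ⟧ₑ ρ
  ⟦ k :* a ⟧ₑ  ρ = k * ⟦ a ⟧ₑ ρ
  ⟦ :suc a ⟧ₑ  ρ = suc (⟦ a ⟧ₑ ρ)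

  linear : Exp → Lin
  linear (var i)  = 0 ∷ unit i
  linear (con k)  = k ∷ []
  linear (a :+ b) = linear a ⊞ linear b
  linear (k :* a) = scale k (linear a)
  linear (:suc a) = (1 ∷ []) ⊞ linear a

  value-unit : ∀ i ρ → value (unit i) ρ ≡ lookup ρ i
  value-unit zero    []      = refl
  value-unit zero    (x ∷ ρ) = trans (+-identityʳ _) (+-identityʳ x)
  value-unit (suc i) []      = refl
  value-unit (suc i) (x ∷ ρ) = value-unit i ρ

  linear-sound : ∀ a ρ → value (linear a) (1 ∷ ρ) ≡ ⟦ a ⟧ₑ ρ
  linear-sound (var i)  ρ = value-unit i ρ
  linear-sound (con k)  ρ = trans (+-identityʳ _) (*-identityʳ k)
  linear-sound (a :+ b) ρ = trans (value-⊞ (linear a) _ _) (cong₂ _+_ (linear-sound a ρ) (linear-sound b ρ))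
  linear-sound (k :* a) ρ = trans (value-scale k (linear a) _) (cong (k *_) (linear-sound a ρ))
  linear-sound (:suc a) ρ = trans (value-⊞ (1 ∷ []) (linear a) _) (cong suc (linear-sound a ρ))

  data Form : Set where
    _:≤_ _:<_ _:≡_ _:≢_ : Exp → Exp → Form
    _:×_ _:⊎_           : Form → Form → Form
    :⊥                  : Form

  ⟦_⟧ : Form → List ℕ → Set
  ⟦ a :≤ b ⟧ ρ = ⟦ a ⟧ₑ ρ ≤ ⟦ b ⟧ₑ ρ
  ⟦ a :< b ⟧ ρ = ⟦ a ⟧ₑ ρ < ⟦ b ⟧ₑ ρ
  ⟦ a :≡ b ⟧ ρ = ⟦ a ⟧ₑ ρ ≡ ⟦ b ⟧ₑ ρ
  ⟦ a :≢ b ⟧ ρ = ⟦ a ⟧ₑ ρ ≢ ⟦ b ⟧ₑ ρ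
  ⟦ f :× g ⟧ ρ = ⟦ f ⟧ ρ × ⟦ g ⟧ ρ
  ⟦ f :⊎ g ⟧ ρ = ⟦ f ⟧ ρ ⊎ ⟦ g ⟧ ρ
  ⟦ :⊥ ⟧     ρ = ⊥

  negate : Form → Form
  negate (a :≤ b) = b :< a
  negate (a :< b) = b :≤ a
  negate (a :≡ b) = a :≢ b
  negate (a :≢ b) = a :≡ b
  negate (f :× g) = negate f :⊎ negate g
  negate (f :⊎ g) = negate f :× negate g
  negate :⊥       = con 0 :≤ con 0

  holds-or-negated : ∀ f ρ → ⟦ f ⟧ ρ ⊎ ⟦ negate f ⟧ ρ
  holds-or-negated (a :≤ b) ρ with ⟦ a ⟧ₑ ρ ≤? ⟦ b ⟧ₑ ρ
  ... | yes p = inj₁ p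
  ... | no ¬p = inj₂ (≰⇒> ¬p)
  holds-or-negated (a :< b) ρ with ⟦ a ⟧ₑ ρ <? ⟦ b ⟧ₑ ρ
  ... | yes p = inj₁ p
  ... | no ¬p = inj₂ (≮⇒≥ ¬p)
  holds-or-negated (a :≡ b) ρ with ⟦ a ⟧ₑ ρ ≟ ⟦ b ⟧ₑ ρ
  ... | yes p = inj₁ p
  ... | no ¬p = inj₂ ¬p
  holds-or-negated (a :≢ b) ρ with ⟦ a ⟧ₑ ρ ≟ ⟦ b ⟧ₑ ρ
  ... | yes p = inj₂ p
  ... | no ¬p = inj₁ ¬p
  holds-or-negated (f :× g) ρ with holds-or-negated f ρ | holds-or-negated g ρ
  ... | inj₁ p | inj₁ q = inj₁ (p , q)
  ... | inj₂ p | _      = inj₂ (inj₁ p)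
  ... | _      | inj₂ q = inj₂ (inj₂ q)
  holds-or-negated (f :⊎ g) ρ with holds-or-negated f ρ | holds-or-negated g ρ
  ... | inj₁ p | _      = inj₁ (inj₁ p)
  ... | _      | inj₁ q = inj₁ (inj₂ q)
  ... | inj₂ p | inj₂ q = inj₂ (p , q)
  holds-or-negated :⊥ ρ = inj₂ z≤n

  ineq : Exp → Exp → Ineq
  ineq a b = cancel (linear a , linear b)

  ineq-sound : ∀ ρ a b → ⟦ a ⟧ₑ ρ ≤ ⟦ b ⟧ₑ ρ → Holds (1 ∷ ρ) (ineq a b)
  ineq-sound ρ a b h = cancel-sound (1 ∷ ρ) (linear a , linear b)
    (subst₂ _≤_ (sym (linear-sound a ρ)) (sym (linear-sound b ρ)) h)

  -- In continuation-passing style `k` receives one system for each way to satisfy the form. Strict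
  -- inequalities become successors; this is where integrality enters, since elimination as such is
  -- rational reasoning.
  branch : Form → (List Ineq → Bool) → List Ineq → Bool
  branch (a :≤ b) k qs = k (ineq a b ∷ qs)
  branch (a :< b) k qs = k (ineq (:suc a) b ∷ qs)
  branch (a :≡ b) k qs = k (ineq a b ∷ ineq b a ∷ qs)
  branch (a :≢ b) k qs = k (ineq (:suc a) b ∷ qs) ∧ k (ineq (:suc b) a ∷ qs)
  branch (f :× g) k qs = branch f (branch g k) qs
  branch (f :⊎ g) k qs = branch f k qs ∧ branch g k qs
  branch :⊥       k qs = true

  branch-sound : ∀ ρ f k qs → (∀ rs → T (k rs) → ¬ AllHold (1 ∷ ρ) rs) →
                 T (branch f k qs) → ⟦ f ⟧ ρ → ¬ AllHold (1 ∷ ρ) qs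
  branch-sound ρ (a :≤ b) k qs s t h hs = s _ t (ineq-sound ρ a b h ∷ hs)
  branch-sound ρ (a :< b) k qs s t h hs = s _ t (ineq-sound ρ (:suc a) b h ∷ hs)
  branch-sound ρ (a :≡ b) k qs s t h hs =
    s _ t (ineq-sound ρ a b (≤-reflexive h) ∷ ineq-sound ρ b a (≤-reflexive (sym h)) ∷ hs)
  branch-sound ρ (a :≢ b) k qs s t h hs
    with Equivalence.to (T-∧ {k (ineq (:suc a) b ∷ qs)}) t | <-cmp (⟦ a ⟧ₑ ρ) (⟦ b ⟧ₑ ρ)
  ... | t₁ , t₂ | tri< lt _ _ = s _ t₁ (ineq-sound ρ (:suc a) b lt ∷ hs)
  ... | t₁ , t₂ | tri≈ _ eq _ = h eq
  ... | t₁ , t₂ | tri> _ _ gt = s _ t₂ (ineq-sound ρ (:suc b) a gt ∷ hs)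
  branch-sound ρ (f :× g) k qs s t (h , h′) hs =
    branch-sound ρ f (branch g k) qs (λ rs t′ → branch-sound ρ g k rs s t′ h′) t h hs
  branch-sound ρ (f :⊎ g) k qs s t h hs with Equivalence.to (T-∧ {branch f k qs}) t | h
  ... | t₁ , t₂ | inj₁ h₁ = branch-sound ρ f k qs s t₁ h₁ hs
  ... | t₁ , t₂ | inj₂ h₂ = branch-sound ρ g k qs s t₂ h₂ hs

  contradictory : ∀ f ρ → ⟦ f ⟧ ρ → ⟦ negate f ⟧ ρ → ⊥
  contradictory (a :≤ b) ρ p        q        = <⇒≱ q p
  contradictory (a :< b) ρ p        q        = <⇒≱ p q
  contradictory (a :≡ b) ρ p        q        = q p
  contradictory (a :≢ b) ρ p        q        = p q
  contradictory (f :× g) ρ (p , _)  (inj₁ q) = contradictory f ρ p q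
  contradictory (f :× g) ρ (_ , p)  (inj₂ q) = contradictory g ρ p q
  contradictory (f :⊎ g) ρ (inj₁ p) (q , _)  = contradictory f ρ p q
  contradictory (f :⊎ g) ρ (inj₂ p) (_ , q)  = contradictory g ρ p q

  data Sequent : Set where
    ∴_  : Form → Sequent
    _⇒_ : Form → Sequent → Sequent

  Implication : Sequent → List ℕ → Set
  Implication (∴ g)   ρ = ⟦ g ⟧ ρ
  Implication (f ⇒ s) ρ = ⟦ f ⟧ ρ → Implication s ρ

  valid : Sequent → (List Ineq → Bool) → List Ineq → Bool
  valid (∴ g)   k = branch (negate g) k
  valid (f ⇒ s) k = branch f (valid s k)

  -- A refutation proves only a double negation. Forms are decidable by `holds-or-negated`, hence
  -- implications between them are stable, and the hypotheses may be split before the goal is known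
  -- to hold.
  valid-sound : ∀ ρ s k qs → (∀ rs → T (k rs) → ¬ AllHold (1 ∷ ρ) rs) →
                T (valid s k qs) → AllHold (1 ∷ ρ) qs → Implication s ρ
  valid-sound ρ (∴ g) k qs snd t hs with holds-or-negated g ρ
  ... | inj₁ p = p
  ... | inj₂ q = ⊥-elim (branch-sound ρ (negate g) k qs snd t q hs)
  valid-sound ρ (f ⇒ s) k qs snd t hs h = stable s λ ¬s →
    branch-sound ρ f (valid s k) qs (λ rs t′ hs′ → ¬s (valid-sound ρ s k rs snd t′ hs′)) t h hs
    where
    stable : ∀ s → ((Implication s ρ → ⊥) → ⊥) → Implication s ρ
    stable (∴ g) ¬¬p with holds-or-negated g ρ
    ... | inj₁ p = p
    ... | inj₂ q = ⊥-elim (¬¬p (λ p → contradictory g ρ p q))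
    stable (f ⇒ s) ¬¬p h = stable s (λ ¬s → ¬¬p (λ p → ¬s (p h)))

  downFrom′ : ℕ → List ℕ
  downFrom′ zero    = []
  downFrom′ (suc m) = suc m ∷ downFrom′ m

  Template : ℕ → Set
  Template zero    = Sequent
  Template (suc m) = Exp → Template m

  close : ∀ m → ℕ → Template m → Sequent
  close zero    i s = s
  close (suc m) i s = close m (suc i) (s (var i))

  Curried : ℕ → (List ℕ → Set) → Set
  Curried zero    A = A []
  Curried (suc m) A = (x : ℕ) → Curried m (λ ρ → A (x ∷ ρ))

  curryⁿ : ∀ m {A : List ℕ → Set} → (∀ ρ → A ρ) → Curried m A
  curryⁿ zero    f = f []
  curryⁿ (suc m) f = λ x → curryⁿ m (λ ρ → f (x ∷ ρ))

  opaque

    -- arith m (λ x₁ … xₘ → h₁ ⇒ … ⇒ ∴ g) x₁ … xₘ has the type h₁ → … → g; the implicit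
    -- argument is solved by running the elimination during type checking.
    arith : ∀ m (t : Template m) → {T (valid (close m 0 t) (refute m (downFrom′ m)) [])} →
            Curried m (Implication (close m 0 t))
    arith m t {p} = curryⁿ m λ ρ →
      valid-sound ρ (close m 0 t) _ [] (refute-sound ρ m (downFrom′ m)) p []

open LinearArithmetic using
  (Exp; var; con; _:+_; _:*_; :suc; Form; _:≤_; _:<_; _:≡_; _:≢_; _:×_; _:⊎_; :⊥; ∴_; _⇒_; arith)

-- Finite counting by sums of indicators.

module Counting where

  private variable
    A B P Q R : Set
    m k : ℕ

  𝟙 : Dec P → ℕ
  𝟙 (yes _) = 1
  𝟙 (no _)  = 0

  𝟙-mono : (p : Dec P) (q : Dec Q) → (P → Q) → 𝟙 p ≤ 𝟙 q
  𝟙-mono (no _)  _       _ = z≤n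
  𝟙-mono (yes _) (yes _) _ = ≤-refl
  𝟙-mono (yes x) (no ¬y) f = ⊥-elim (¬y (f x))

  𝟙-cover : (r : Dec R) (p : Dec P) (q : Dec Q) → (R → P ⊎ Q) → 𝟙 r ≤ 𝟙 p + 𝟙 q
  𝟙-cover (no _)  _       _       _ = z≤n
  𝟙-cover (yes _) (yes _) _       _ = s≤s z≤n
  𝟙-cover (yes _) (no _)  (yes _) _ = ≤-refl
  𝟙-cover (yes x) (no ¬p) (no ¬q) f = ⊥-elim ([ ¬p , ¬q ]′ (f x))

  𝟙-disjoint : (p : Dec P) (q : Dec Q) (r : Dec R) → (P → R) → (Q → R) → (P → Q → ⊥) → 𝟙 p + 𝟙 q ≤ 𝟙 r
  𝟙-disjoint (yes x) (yes y) _ _ _ d = ⊥-elim (d x y)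
  𝟙-disjoint (yes x) (no _)  r f _ _ = 𝟙-mono (yes x) r f
  𝟙-disjoint (no _)  q       r _ g _ = 𝟙-mono q r g

  ∑ : List A → (A → ℕ) → ℕ
  ∑ []       f = 0
  ∑ (x ∷ xs) f = f x + ∑ xs f

  ∑-mono : (xs : List A) {f g : A → ℕ} → (∀ x → f x ≤ g x) → ∑ xs f ≤ ∑ xs g
  ∑-mono []       h = z≤n
  ∑-mono (x ∷ xs) h = +-mono-≤ (h x) (∑-mono xs h)

  ∑-+ : (xs : List A) (f g : A → ℕ) → ∑ xs (λ x → f x + g x) ≡ ∑ xs f + ∑ xs g
  ∑-+ []       f g = refl
  ∑-+ (x ∷ xs) f g = arith 5 (λ a b c s t → c :≡ s :+ t ⇒ ∴ (a :+ b) :+ c :≡ (a :+ s) :+ (b :+ t))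
    (f x) (g x) (∑ xs (λ x → f x + g x)) (∑ xs f) (∑ xs g) (∑-+ xs f g)

  ∑-const : (xs : List A) (c : ℕ) → ∑ xs (λ _ → c) ≡ length xs * c
  ∑-const []       c = refl
  ∑-const (_ ∷ xs) c = cong (c +_) (∑-const xs c)

  ∑-swap : (xs : List A) (ys : List B) (f : A → B → ℕ) →
           ∑ xs (λ x → ∑ ys (f x)) ≡ ∑ ys (λ y → ∑ xs (λ x → f x y))
  ∑-swap []       ys f = sym (trans (∑-const ys 0) (*-zeroʳ (length ys)))
  ∑-swap (x ∷ xs) ys f = trans (cong (∑ ys (f x) +_) (∑-swap xs ys f))
                               (sym (∑-+ ys (f x) (λ y → ∑ xs (λ x → f x y))))

  ∑-cong : (xs : List A) {f g : A → ℕ} → (∀ x → f x ≡ g x) → ∑ xs f ≡ ∑ xs g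
  ∑-cong xs h = ≤-antisym (∑-mono xs (λ x → ≤-reflexive (h x))) (∑-mono xs (λ x → ≤-reflexive (sym (h x))))

  ∑-none : (xs : List A) {P : A → Set} (P? : ∀ x → Dec (P x)) → All (λ x → ¬ P x) xs → ∑ xs (λ x → 𝟙 (P? x)) ≡ 0
  ∑-none []       P? []         = refl
  ∑-none (x ∷ xs) P? (¬p ∷ ¬ps) with P? x
  ... | yes p = ⊥-elim (¬p p)
  ... | no _  = ∑-none xs P? ¬ps

  ∑-unique : (xs : List A) {P : A → Set} (P? : ∀ x → Dec (P x)) → Unique xs →
             (∀ x y → P x → P y → x ≡ y) → ∑ xs (λ x → 𝟙 (P? x)) ≤ 1
  ∑-unique []       P? u        h = z≤n
  ∑-unique {A} (x ∷ xs) {P} P? (u ∷ us) h with P? x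
  ... | yes p = s≤s (≤-reflexive (∑-none xs P? (none xs u)))
    where
    none : ∀ ys → All (λ y → x ≢ y) ys → All (λ y → ¬ P y) ys
    none []       []       = []
    none (y ∷ ys) (n ∷ ns) = (λ q → n (h x y p q)) ∷ none ys ns
  ... | no _ = ∑-unique xs P? us h

  ∑-exists : (xs : List A) {P : A → Set} (P? : ∀ x → Dec (P x)) → ∀ {x} → x ∈ xs → P x → 1 ≤ ∑ xs (λ x → 𝟙 (P? x))
  ∑-exists (x ∷ xs) P? (here refl) p with P? x
  ... | yes _ = s≤s z≤n
  ... | no ¬p = ⊥-elim (¬p p)
  ∑-exists (x ∷ xs) P? (there x∈) p = ≤-trans (∑-exists xs P? x∈ p) (m≤n+m _ (𝟙 (P? x)))

  # : {P : Fin m → Set} → (∀ x → Dec (P x)) → ℕ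
  # {m} P? = ∑ (allFin m) (λ x → 𝟙 (P? x))

  module _ {P Q : Fin m → Set} (P? : ∀ x → Dec (P x)) (Q? : ∀ x → Dec (Q x)) where

    #-mono : (∀ x → P x → Q x) → # P? ≤ # Q?
    #-mono h = ∑-mono (allFin m) (λ x → 𝟙-mono (P? x) (Q? x) (h x))

    module _ {R : Fin m → Set} (R? : ∀ x → Dec (R x)) where

      #-cover : (∀ x → R x → P x ⊎ Q x) → # R? ≤ # P? + # Q?
      #-cover h = ≤-trans (∑-mono (allFin m) (λ x → 𝟙-cover (R? x) (P? x) (Q? x) (h x)))
                          (≤-reflexive (∑-+ (allFin m) _ _))

      #-disjoint : (∀ x → P x → R x) → (∀ x → Q x → R x) → (∀ x → P x → Q x → ⊥) → # P? + # Q? ≤ # R?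
      #-disjoint f g d = ≤-trans (≤-reflexive (sym (∑-+ (allFin m) _ _)))
        (∑-mono (allFin m) (λ x → 𝟙-disjoint (P? x) (Q? x) (R? x) (f x) (g x) (d x)))

  module _ {P : Fin m → Set} (P? : ∀ x → Dec (P x)) where

    #-unique : (∀ x y → P x → P y → x ≡ y) → # P? ≤ 1
    #-unique = ∑-unique (allFin m) P? (allFin⁺ m)

    #-exists : ∀ x → P x → 1 ≤ # P?
    #-exists x = ∑-exists (allFin m) P? (∈-allFin x)

    #-none : (∀ x → ¬ P x) → # P? ≡ 0
    #-none h = n≤0⇒n≡0 (≤-trans (∑-mono (allFin m) {g = λ _ → 0} zero≤) (≤-reflexive (trans (∑-const (allFin m) 0)
          (*-zeroʳ (length (allFin m))))))
      where
      zero≤ : ∀ x → 𝟙 (P? x) ≤ 0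
      zero≤ x with P? x
      ... | yes p = ⊥-elim (h x p)
      ... | no _  = z≤n

  #-all : # {m} {λ _ → ⊤} (λ _ → yes tt) ≡ m
  #-all {m} = trans (∑-const (allFin m) 1) (trans (*-identityʳ _) (length-tabulate (λ x → x)))

  #-exhaust : {P Q : Fin m → Set} (P? : ∀ x → Dec (P x)) (Q? : ∀ x → Dec (Q x)) →
              (∀ x → P x ⊎ Q x) → m ≤ # P? + # Q?
  #-exhaust {m} P? Q? h = ≤-trans (≤-reflexive (sym #-all)) (#-cover P? Q? {λ _ → ⊤} (λ _ → yes tt) (λ x _ → h x))

  ∑-classes : (α : Fin m → Fin k) → ∑ (allFin k) (λ c → # (λ x → α x ≟ᶠ c)) ≡ m
  ∑-classes {m} {k} α = begin
    ∑ (allFin k) (λ c → # (λ x → α x ≟ᶠ c))          ≡⟨ ∑-swap (allFin k) (allFin m) (λ c x → 𝟙 (α x ≟ᶠ c)) ⟩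
    ∑ (allFin m) (λ x → # (λ c → α x ≟ᶠ c))          ≡⟨ ∑-cong (allFin m) one ⟩
    ∑ (allFin m) (λ _ → 1)                           ≡⟨ ∑-const (allFin m) 1 ⟩
    length (allFin m) * 1                            ≡⟨ *-identityʳ _ ⟩
    length (allFin m)                                ≡⟨ length-tabulate (λ x → x) ⟩
    m                                                ∎
    where
    open ≡-Reasoning
    one : ∀ x → # (λ c → α x ≟ᶠ c) ≡ 1
    one x = ≤-antisym (#-unique (λ c → α x ≟ᶠ c) (λ _ _ p q → trans (sym p) q)) (#-exists (λ c → α x ≟ᶠ c) (α x) refl)

  module _ (f : Fin m → ℕ) (inj : ∀ x y → f x ≡ f y → x ≡ y) where

    interval? : ∀ s l x → Dec (s ≤ f x × f x < s + l)
    interval? s l x = (s ≤? f x) ×-dec (f x <? s + l)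

    #-interval : ∀ s l → # (interval? s l) ≤ l
    #-interval s zero = ≤-reflexive (#-none (interval? s 0)
      λ x (p , q) → arith 2 (λ s u → s :≤ u ⇒ u :< s :+ con 0 ⇒ ∴ :⊥) s (f x) p q)
    #-interval s (suc l) = begin
      # (interval? s (suc l))                               ≤⟨ #-cover (interval? s l) (λ x →
            f x ≟ s + l) (interval? s (suc l)) last ⟩
      # (interval? s l) + # (λ x → f x ≟ s + l)             ≤⟨ +-mono-≤ (#-interval s l) (#-unique (λ x →
            f x ≟ s + l) (λ x y p q → inj x y (trans p (sym q)))) ⟩
      l + 1                                                 ≡⟨ +-comm l 1 ⟩
      suc l                                                 ∎
      where
      open ≤-Reasoning
      last : ∀ x → s ≤ f x × f x < s + suc l → (s ≤ f x × f x < s + l) ⊎ f x ≡ s + l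
      last x (p , q) = arith 3 (λ s l u → s :≤ u ⇒ u :< s :+ :suc l ⇒
            ∴ ((s :≤ u :× u :< s :+ l) :⊎ u :≡ s :+ l)) s l (f x) p q

  -- If every colour occurred in `cs`, removing the entries of `cs` one at a time would bound k by
  -- its length.
  fresh : (cs : List (Fin k)) → length cs < k → ∃ λ d → All (λ c → d ≢ c) cs
  fresh {k} cs short with Finₚ.any? (λ d → avoids? d cs)
    where
    avoids? : ∀ d cs → Dec (All (λ c → d ≢ c) cs)
    avoids? d []       = yes []
    avoids? d (c ∷ cs) with d ≟ᶠ c | avoids? d cs
    ... | yes e | _     = no λ { (n ∷ _) → n e }
    ... | no n  | yes a = yes (n ∷ a)
    ... | no _  | no ¬a = no λ { (_ ∷ a) → ¬a a }
  ... | yes found = found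
  ... | no none = ⊥-elim (<⇒≱ short (≤-trans (≤-reflexive (sym #-all)) (bound cs {λ _ → ⊤} (λ d _ → member d))))
    where
    bound : ∀ cs {P : Fin k → Set} {P? : ∀ x → Dec (P x)} → (∀ d → P d → ¬ All (λ c → d ≢ c) cs) → # P? ≤ length cs
    bound []       {P? = P?} h = ≤-reflexive (#-none P? (λ d p → h d p []))
    bound (c ∷ cs) {P} {P?} h = ≤-trans (#-cover (λ d → d ≟ᶠ c) (λ d → P? d ×-dec ¬? (d ≟ᶠ c)) P? split)
      (+-mono-≤ (#-unique (λ d → d ≟ᶠ c) (λ _ _ p q → trans p (sym q)))
                (bound cs (λ d (p , n) a → h d p (n ∷ a))))
      where
      split : ∀ d → P d → d ≡ c ⊎ P d × d ≢ c
      split d p with d ≟ᶠ c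
      ... | yes e = inj₁ e
      ... | no n  = inj₂ (p , n)
    member : ∀ d → ¬ All (λ c → d ≢ c) cs
    member d a = none (d , a)

open Counting

-- Single recolourings and walks between colourings.

infixl 8 _[_↦_]
_[_↦_] : ∀ {m k} → (Fin m → Fin k) → Fin m → Fin k → Fin m → Fin k
(γ [ v ↦ c ]) x with x ≟ᶠ v
... | yes _ = c
... | no _  = γ x

module _ {m k : ℕ} (γ : Fin m → Fin k) (v : Fin m) (c : Fin k) where

  update-at : (γ [ v ↦ c ]) v ≡ c
  update-at with v ≟ᶠ v
  ... | yes _ = refl
  ... | no ¬e = ⊥-elim (¬e refl)

  update-other : ∀ {x} → x ≢ v → (γ [ v ↦ c ]) x ≡ γ x
  update-other {x} n with x ≟ᶠ v
  ... | yes e = ⊥-elim (n e)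
  ... | no _  = refl

  update-case : ∀ x → (x ≡ v × (γ [ v ↦ c ]) x ≡ c) ⊎ (x ≢ v × (γ [ v ↦ c ]) x ≡ γ x)
  update-case x with x ≟ᶠ v
  ... | yes e = inj₁ (e , refl)
  ... | no n  = inj₂ (n , refl)

module Walks (D : Digraph) (k : ℕ) where

  private
    V = IsDicolouring D k

  -- An inductive form of `WalkOfLength` that can be appended and reversed. Colourings are
  -- functions, so the end is matched only pointwise.
  data Path : ℕ → Colouring D k → Colouring D k → Set where
    stop : ∀ {α β} → V α → α ≗ β → Path 0 α β
    step : ∀ {t α β γ} → V α → Adjacent D k α γ → Path t γ β → Path (suc t) α β

  V-resp : ∀ {α β} → α ≗ β → V α → V β
  V-resp e v i (l , c , inj , mono , arcs) = v i (l , c , inj , (λ j → trans (e (c j)) (mono j)) , arcs)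

  start-valid : ∀ {t α β} → Path t α β → V α
  start-valid (stop v _)   = v
  start-valid (step v _ _) = v

  restart : ∀ {t α β γ} → V α → α ≗ β → Path t β γ → Path t α γ
  restart v e (stop _ e′) = stop v (λ x → trans (e x) (e′ x))
  restart v e (step _ (w , d , s) p) =
    step v (w , (λ q → d (trans (sym (e w)) q)) , (λ x n → trans (e x) (s x n))) p

  append : ∀ {s t α β γ} → Path s α β → Path t β γ → Path (s + t) α γ
  append (stop v e)   q = restart v e q
  append (step v a p) q = step v a (append p q)

  reverse : ∀ {t α β} → Path t α β → Path t β α
  reverse (stop v e) = stop (V-resp e v) (λ x → sym (e x))
  reverse {suc t} {α} {β} (step v (w , d , s) p) = subst (λ s → Path s β α) (+-comm t 1)
    (append {t = 1} {γ = α} (reverse p) (step (start-valid p) (w , (λ q → d (sym q)) , (λ x n →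
          sym (s x n))) (stop v (λ _ → refl))))

  Reach : ℕ → Colouring D k → Colouring D k → Set
  Reach d α β = ∃ λ t → t ≤ d × Path t α β

  reach-trans : ∀ {c d α β γ} → Reach c α β → Reach d β γ → Reach (c + d) α γ
  reach-trans (s , s≤ , p) (t , t≤ , q) = s + t , +-mono-≤ s≤ t≤ , append p q

  reach-sym : ∀ {d α β} → Reach d α β → Reach d β α
  reach-sym (t , t≤ , p) = t , t≤ , reverse p

  reach-weaken : ∀ {c d α β} → c ≤ d → Reach c α β → Reach d α β
  reach-weaken c≤d (t , t≤ , p) = t , ≤-trans t≤ c≤d , p

  states : ∀ {t α β} → Path t α β → Fin (suc t) → Colouring D k
  states {α = α} p            fzero    = α
  states         (step _ _ p) (fsuc i) = states p i

  toWalk : ∀ {t α β} → Path t α β → WalkOfLength D k t α β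
  toWalk p = states p , valid-at p , adjacent-at p , (λ _ → refl) , end p
    where
    valid-at : ∀ {t α β} (p : Path t α β) i → V (states p i)
    valid-at p            fzero    = start-valid p
    valid-at (step _ _ p) (fsuc i) = valid-at p i
    adjacent-at : ∀ {t α β} (p : Path t α β) i → Adjacent D k (states p (inject₁ i)) (states p (fsuc i))
    adjacent-at (step _ a p) fzero    = a
    adjacent-at (step _ _ p) (fsuc i) = adjacent-at p i
    end : ∀ {t α β} (p : Path t α β) → states p (fromℕ t) ≗ β
    end (stop _ e)   = e
    end (step _ _ p) = end p

  Mixable : Colouring D k → Colouring D k → Set
  Mixable γ δ = ∀ ζ → (∀ x → ζ x ≡ γ x ⊎ ζ x ≡ δ x) → V ζ

  differ? : ∀ (γ δ : Colouring D k) x → Dec (γ x ≢ δ x)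
  differ? γ δ x = ¬? (γ x ≟ᶠ δ x)

  -- Recolouring the differing vertices one at a time passes only through mixtures of γ and δ, so
  -- the order is irrelevant and each of these vertices costs one step.
  direct : ∀ γ δ → Mixable γ δ → Reach (# (differ? γ δ)) γ δ
  direct γ δ = go (allFin _) γ (λ y _ → ∈-allFin y)
    where
    -- The list `xs` contains every vertex that may still differ; once it is empty, δ has been
    -- reached.
    go : ∀ xs γ → (∀ y → γ y ≢ δ y → y ∈ xs) → Mixable γ δ → Reach (∑ xs (λ x → 𝟙 (differ? γ δ x))) γ δ
    go [] γ inv mix = 0 , z≤n , stop (mix γ (λ _ → inj₁ refl)) same
      where
      same : γ ≗ δ
      same y with γ y ≟ᶠ δ y
      ... | yes e = e
      ... | no n with inv y n
      ... | ()
    go (x ∷ xs) γ inv mix with γ x ≟ᶠ δ x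
    ... | yes e = go xs γ inv′ mix
      where
      inv′ : ∀ y → γ y ≢ δ y → y ∈ xs
      inv′ y n with inv y n
      ... | here refl = ⊥-elim (n e)
      ... | there y∈  = y∈
    ... | no n = reach-weaken (s≤s (∑-mono xs fewer)) (move (go xs γ′ inv′ mix′))
      where
      γ′ = γ [ x ↦ δ x ]
      mix′ : Mixable γ′ δ
      mix′ ζ h = mix ζ h′
        where
        h′ : ∀ y → ζ y ≡ γ y ⊎ ζ y ≡ δ y
        h′ y with h y | update-case γ x (δ x) y
        ... | inj₂ e | _                 = inj₂ e
        ... | inj₁ e | inj₁ (refl , e′) = inj₂ (trans e e′)
        ... | inj₁ e | inj₂ (_ , e′)    = inj₁ (trans e e′)
      inv′ : ∀ y → γ′ y ≢ δ y → y ∈ xs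
      inv′ y d with update-case γ x (δ x) y
      ... | inj₁ (refl , e) = ⊥-elim (d e)
      ... | inj₂ (y≢x , e) with inv y (λ q → d (trans e q))
      ... | here y≡x = ⊥-elim (y≢x y≡x)
      ... | there y∈ = y∈
      fewer : ∀ y → 𝟙 (differ? γ′ δ y) ≤ 𝟙 (differ? γ δ y)
      fewer y = 𝟙-mono (differ? γ′ δ y) (differ? γ δ y) λ d q → case d q (update-case γ x (δ x) y)
        where
        case : γ′ y ≢ δ y → γ y ≡ δ y → (y ≡ x × γ′ y ≡ δ x) ⊎ (y ≢ x × γ′ y ≡ γ y) → ⊥
        case d q (inj₁ (refl , e)) = d e
        case d q (inj₂ (_ , e))    = d (trans e q)
      move : ∀ {d} → Reach d γ′ δ → Reach (suc d) γ δ
      move (t , t≤ , p) = suc t , s≤s t≤ ,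
        step (mix γ (λ _ → inj₁ refl))
             (x , (λ q → n (trans q (update-at γ x (δ x)))) , (λ w w≢x → sym (update-other γ x (δ x) w≢x))) p

  recolour : ∀ γ v c → V γ → V (γ [ v ↦ c ]) → Reach 1 γ (γ [ v ↦ c ])
  recolour γ v c ok ok′ with γ v ≟ᶠ c
  ... | yes refl = 0 , z≤n , stop ok same
    where
    same : γ ≗ γ [ v ↦ γ v ]
    same x with update-case γ v (γ v) x
    ... | inj₁ (refl , e) = sym e
    ... | inj₂ (_ , e)    = sym e
  ... | no n = 1 , ≤-refl , step ok (v , (λ q → n (trans q (update-at γ v c))) ,
                                     (λ w w≢v → sym (update-other γ v c w≢v))) (stop ok′ (λ _ → refl))

-- Positions of a triple that spans a directed triangle, listed in increasing
-- order from some base vertex: the three cyclic gaps all lie in {1,…,n-1,n+1}.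
-- (If one gap is n+1 then the other two automatically lie in {1,…,n-1}.)
Bad : ℕ → ℕ → ℕ → ℕ → Set
Bad n u v w = u < v × v < w ×
  ((v < u + n × w < v + n × suc (u + n) < w) ⊎ v ≡ suc (u + n) ⊎ w ≡ suc (v + n) ⊎ w ≡ u + n)

:Bad : Exp → Exp → Exp → Exp → Form
:Bad n u v w = u :< v :× v :< w :×
  ((v :< u :+ n :× w :< v :+ n :× :suc (u :+ n) :< w) :⊎ v :≡ :suc (u :+ n) :⊎ w :≡ :suc (v :+ n) :⊎ w :≡ u :+ n)

-- Going from position x by d steps leads to position y (modulo 2n+1).
:step : Exp → Exp → Exp → Exp → Form
:step n x d y = x :+ d :≡ y :⊎ x :+ d :≡ y :+ :suc (2 :* n)

:arc : Exp → Exp → Form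
:arc n d = (con 1 :≤ d :× d :< n) :⊎ d :≡ :suc n

-- Offsets, arcs and directed triangles in the tournament.

module _ (n : ℕ) where

  private
    N = suc (2 * n)
    V = Fin N

  opaque

    -- Opaque, so that later arguments see an offset only through the linear facts `off<N` and
    -- `off-spec` and never unfold the remainder.
    off : V → V → ℕ
    off = circDiff n

    off<N : ∀ b x → off b x < N
    off<N b x = m%n<n (toℕ x + (N ∸ toℕ b)) N

    off-spec : ∀ b x → toℕ b + off b x ≡ toℕ x ⊎ toℕ b + off b x ≡ toℕ x + N
    off-spec b x with toℕ b ≤? toℕ x
    ... | yes b≤x = inj₁ (begin
      toℕ b + (toℕ x + (N ∸ toℕ b)) % N            ≡⟨ cong (λ m → toℕ b + m % N) rearrange ⟩
      toℕ b + ((toℕ x ∸ toℕ b) + N) % N            ≡⟨ cong (toℕ b +_) ([m+n]%n≡m%n (toℕ x ∸ toℕ b) N) ⟩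
      toℕ b + (toℕ x ∸ toℕ b) % N                  ≡⟨ cong (toℕ b +_) (m<n⇒m%n≡m (≤-<-trans (m∸n≤m (toℕ x) (toℕ b))
            (Finₚ.toℕ<n x))) ⟩
      toℕ b + (toℕ x ∸ toℕ b)                      ≡⟨ m+[n∸m]≡n b≤x ⟩
      toℕ x                                        ∎)
      where
      open ≡-Reasoning
      rearrange : toℕ x + (N ∸ toℕ b) ≡ (toℕ x ∸ toℕ b) + N
      rearrange = arith 5 (λ b x N p q → b :+ p :≡ N ⇒ b :+ q :≡ x ⇒ ∴ x :+ p :≡ q :+ N)
        (toℕ b) (toℕ x) N (N ∸ toℕ b) (toℕ x ∸ toℕ b) (m+[n∸m]≡n (<⇒≤ (Finₚ.toℕ<n b))) (m+[n∸m]≡n b≤x)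
    ... | no b≰x = inj₂ (begin
      toℕ b + (toℕ x + (N ∸ toℕ b)) % N            ≡⟨ cong (toℕ b +_) (m<n⇒m%n≡m small) ⟩
      toℕ b + (toℕ x + (N ∸ toℕ b))                ≡⟨ rearrange ⟩
      toℕ x + N                                    ∎)
      where
      open ≡-Reasoning
      complement : toℕ b + (N ∸ toℕ b) ≡ N
      complement = m+[n∸m]≡n (<⇒≤ (Finₚ.toℕ<n b))
      small : toℕ x + (N ∸ toℕ b) < N
      small = arith 4 (λ b x N p → b :+ p :≡ N ⇒ x :< b ⇒ ∴ x :+ p :< N) (toℕ b) (toℕ x) N (N ∸ toℕ b) complement
            (≰⇒> b≰x)
      rearrange : toℕ b + (toℕ x + (N ∸ toℕ b)) ≡ toℕ x + N
      rearrange = arith 4 (λ b x N p → b :+ p :≡ N ⇒ ∴ b :+ (x :+ p) :≡ x :+ N) (toℕ b) (toℕ x) N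
            (N ∸ toℕ b) complement

  infix 4 _⟶_
  _⟶_ : V → V → Set
  x ⟶ y = (1 ≤ off x y × off x y < n) ⊎ off x y ≡ suc n

  opaque
    unfolding off

    arc-elim : ∀ x y → Arc C⟨ n ⟩ x y → x ⟶ y
    arc-elim x y (inj₁ (p , q)) = inj₁ (p , below n p q)
      where
      below : ∀ n {d} → 1 ≤ d → d ≤ n ∸ 1 → d < n
      below zero    p q = ⊥-elim (1+n≰n (≤-trans p q))
      below (suc n) p q = s≤s q
    arc-elim x y (inj₂ e) = inj₂ e

    arc-intro : ∀ x y → x ⟶ y → Arc C⟨ n ⟩ x y
    arc-intro x y (inj₁ (p , q)) = inj₁ (p , ∸-monoˡ-≤ 1 q)
    arc-intro x y (inj₂ e)       = inj₂ e

  -- The summands are below 2n + 1, so the sum wraps around at most once. Every cyclic argument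
  -- below reduces to such two-way linear alternatives.
  off-add : ∀ b x y → off b x + off x y ≡ off b y ⊎ off b x + off x y ≡ off b y + N
  off-add b x y = arith 7
    (λ n B X Y u w v → u :< :suc (2 :* n) ⇒ v :< :suc (2 :* n) ⇒ w :< :suc (2 :* n) ⇒
      :step n B u X ⇒ :step n X w Y ⇒ :step n B v Y ⇒ ∴ :step n u w v)
    n (toℕ b) (toℕ x) (toℕ y) (off b x) (off x y) (off b y)
    (off<N b x) (off<N b y) (off<N x y) (off-spec b x) (off-spec x y) (off-spec b y)

  off-injective : ∀ b x y → off b x ≡ off b y → x ≡ y
  off-injective b x y e = Finₚ.toℕ-injective (arith 6
    (λ n B X Y u v → X :< :suc (2 :* n) ⇒ Y :< :suc (2 :* n) ⇒ :step n B u X ⇒ :step n B v Y ⇒ u :≡ v ⇒ ∴ X :≡ Y)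
    n (toℕ b) (toℕ x) (toℕ y) (off b x) (off b y) (Finₚ.toℕ<n x) (Finₚ.toℕ<n y) (off-spec b x) (off-spec b y) e)

  off-self : ∀ b → off b b ≡ 0
  off-self b = arith 3 (λ n B u → u :< :suc (2 :* n) ⇒ :step n B u B ⇒
        ∴ u :≡ con 0) n (toℕ b) (off b b) (off<N b b) (off-spec b b)

  opaque

    vertex-at : ∀ b u → u < N → Σ V λ x → off b x ≡ u
    vertex-at b u u<N = x , arith 6
      (λ n B t X u v → t :≡ B :+ u ⇒ (X :≡ t :⊎ X :+ :suc (2 :* n) :≡ t) ⇒ X :< :suc (2 :* n) ⇒
        u :< :suc (2 :* n) ⇒ v :< :suc (2 :* n) ⇒ :step n B v X ⇒ ∴ v :≡ u)
      n (toℕ b) (toℕ b + u) (toℕ x) u (off b x) refl place (Finₚ.toℕ<n x) u<N (off<N b x) (off-spec b x)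
      where
      found : Σ V λ x → toℕ x ≡ toℕ b + u ⊎ toℕ x + N ≡ toℕ b + u
      found with toℕ b + u <? N
      ... | yes lt = fromℕ< lt , inj₁ (Finₚ.toℕ-fromℕ< lt)
      ... | no ge = fromℕ< lt , inj₂ (trans (cong (_+ N) (Finₚ.toℕ-fromℕ< lt)) (m∸n+n≡m (≮⇒≥ ge)))
        where
        lt : toℕ b + u ∸ N < N
        lt = arith 4 (λ N B u d → d :+ N :≡ B :+ u ⇒ B :< N ⇒ u :< N ⇒ ∴ d :< N) N (toℕ b) u (toℕ b + u ∸ N)
               (m∸n+n≡m (≮⇒≥ ge)) (Finₚ.toℕ<n b) u<N
      x : V
      x = proj₁ found
      place : toℕ x ≡ toℕ b + u ⊎ toℕ x + N ≡ toℕ b + u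
      place = proj₂ found

  bad⇒arcs : ∀ b x y z → Bad n (off b x) (off b y) (off b z) →
             x ⟶ y × y ⟶ z × z ⟶ x
  bad⇒arcs b x y z bad =
      (arith 5 (λ n u v w d → :Bad n u v w ⇒ w :< :suc (2 :* n) ⇒ :step n u d v ⇒ d :< :suc (2 :* n) ⇒ ∴ :arc n d)
        n u v w (off x y) bad (off<N b z) (off-add b x y) (off<N x y))
    , (arith 5 (λ n u v w d → :Bad n u v w ⇒ w :< :suc (2 :* n) ⇒ :step n v d w ⇒ d :< :suc (2 :* n) ⇒ ∴ :arc n d)
        n u v w (off y z) bad (off<N b z) (off-add b y z) (off<N y z))
    , (arith 5 (λ n u v w d → :Bad n u v w ⇒ w :< :suc (2 :* n) ⇒ :step n w d u ⇒ d :< :suc (2 :* n) ⇒ ∴ :arc n d)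
        n u v w (off z x) bad (off<N b z) (off-add b z x) (off<N z x))
    where
    u = off b x
    v = off b y
    w = off b z

  private
    arc-bound : ∀ x y → x ⟶ y → off x y < 2 + n
    arc-bound x y a = arith 2 (λ n d → :arc n d ⇒ ∴ d :< con 2 :+ n) n (off x y) a

    gap : ∀ b x y → off b x < off b y → x ⟶ y → off b y < off b x + n ⊎ off b y ≡ suc (off b x + n)
    gap b x y u<v a = arith 4
      (λ n u v d → d :< :suc (2 :* n) ⇒ v :< :suc (2 :* n) ⇒ u :< v ⇒ :step n u d v ⇒ :arc n d ⇒
            ∴ (v :< u :+ n :⊎ v :≡ :suc (u :+ n)))
      n (off b x) (off b y) (off x y) (off<N x y) (off<N b y) u<v (off-add b x y) a

    wrap : ∀ b x y → off b y < off b x → x ⟶ y → suc (off b y + n) < off b x ⊎ off b x ≡ off b y + n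
    wrap b x y v<u a = arith 4
      (λ n u v d → d :< :suc (2 :* n) ⇒ u :< :suc (2 :* n) ⇒ v :< u ⇒ :step n u d v ⇒ :arc n d ⇒
            ∴ (:suc (v :+ n) :< u :⊎ u :≡ v :+ n))
      n (off b x) (off b y) (off x y) (off<N x y) (off<N b x) v<u (off-add b x y) a

    ordered : ∀ b x y z → off b x < off b y → off b y < off b z →
              x ⟶ y → y ⟶ z → z ⟶ x → Bad n (off b x) (off b y) (off b z)
    ordered b x y z u<v v<w p q r with gap b x y u<v p | gap b y z v<w q | wrap b z x (<-trans u<v v<w) r
    ... | inj₁ g | inj₁ h | inj₁ i = u<v , v<w , inj₁ (g , h , i)
    ... | inj₂ g | _      | _      = u<v , v<w , inj₂ (inj₁ g)
    ... | _      | inj₂ h | _      = u<v , v<w , inj₂ (inj₂ (inj₁ h))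
    ... | _      | _      | inj₂ i = u<v , v<w , inj₂ (inj₂ (inj₂ i))

    -- Winding twice around the cycle would take three arcs of total length 4n+2.
    reversed : 2 ≤ n → ∀ b x y z → off b x < off b z → off b z < off b y →
               x ⟶ y → y ⟶ z → z ⟶ x → ⊥
    reversed 2≤n b x y z u<w w<v p q r = arith 7
      (λ n u v w d e f → con 2 :≤ n ⇒ u :< w ⇒ w :< v ⇒ :step n u d v ⇒ :step n v e w ⇒ :step n w f u ⇒
        d :< con 2 :+ n ⇒ e :< con 2 :+ n ⇒ f :< con 2 :+ n ⇒ v :< :suc (2 :* n) ⇒ ∴ :⊥)
      n (off b x) (off b y) (off b z) (off x y) (off y z) (off z x) 2≤n u<w w<v
      (off-add b x y) (off-add b y z) (off-add b z x) (arc-bound x y p) (arc-bound y z q) (arc-bound z x r)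
            (off<N b y)

  arc-irreflexive : ∀ x → ¬ x ⟶ x
  arc-irreflexive x a = arith 2 (λ n d → d :≡ con 0 ⇒ :arc n d ⇒ ∴ :⊥) n (off x x) (off-self x) a

  arc-distinct : ∀ b x y → x ⟶ y → off b x ≢ off b y
  arc-distinct b x y a e with off-injective b x y e
  ... | refl = arc-irreflexive x a

  -- Three of the six possible orders are rotations of the direction of travel. In the other three
  -- the triangle would wind around the cycle twice, which `reversed` excludes.
  arcs⇒bad : 2 ≤ n → ∀ b x y z → x ⟶ y → y ⟶ z → z ⟶ x →
             Bad n (off b x) (off b y) (off b z) ⊎ Bad n (off b y) (off b z) (off b x) ⊎ Bad n (off b z) (off b x)
                   (off b y)
  arcs⇒bad 2≤n b x y z p q r
    with <-cmp (off b x) (off b y) | <-cmp (off b y) (off b z) | <-cmp (off b z) (off b x)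
  ... | tri≈ _ e _ | _          | _          = ⊥-elim (arc-distinct b x y p e)
  ... | _          | tri≈ _ e _ | _          = ⊥-elim (arc-distinct b y z q e)
  ... | _          | _          | tri≈ _ e _ = ⊥-elim (arc-distinct b z x r e)
  ... | tri< a _ _ | tri< c _ _ | _          = inj₁ (ordered b x y z a c p q r)
  ... | tri> _ _ a | tri< c _ _ | tri< d _ _ = inj₂ (inj₁ (ordered b y z x c d q r p))
  ... | tri< a _ _ | tri> _ _ c | tri< d _ _ = inj₂ (inj₂ (ordered b z x y d a r p q))
  ... | tri< a _ _ | tri> _ _ c | tri> _ _ d = ⊥-elim (reversed 2≤n b x y z d c p q r)
  ... | tri> _ _ a | tri< c _ _ | tri> _ _ d = ⊥-elim (reversed 2≤n b y z x a d q r p)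
  ... | tri> _ _ a | tri> _ _ c | tri< d _ _ = ⊥-elim (reversed 2≤n b z x y c a r p q)
  ... | tri> _ _ a | tri> _ _ c | tri> _ _ d = ⊥-elim (<-asym (<-trans c a) d)

-- Triangle-free classes and recolouring outside a filled interval.

module Tournament (n k : ℕ) (4≤n : 4 ≤ n) where

  V : Set
  V = Fin (suc (2 * n))

  Col : Set
  Col = Colouring C⟨ n ⟩ k

  open Walks C⟨ n ⟩ k public

  2≤n : 2 ≤ n
  2≤n = ≤-trans (s≤s (s≤s z≤n)) 4≤n

  pos : V → V → ℕ
  pos = off n

  pos< : ∀ b x → pos b x < suc (2 * n)
  pos< = off<N n

  at : V → ∀ u → u < suc (2 * n) → V
  at b u u<N = proj₁ (vertex-at n b u u<N)

  pos-at : ∀ b u (u<N : u < suc (2 * n)) → pos b (at b u u<N) ≡ u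
  pos-at b u u<N = proj₂ (vertex-at n b u u<N)

  same-pos : ∀ b {x y} → pos b x ≡ pos b y → x ≡ y
  same-pos b {x} {y} = off-injective n b x y

  n<N : n < suc (2 * n)
  n<N = arith 1 (λ n → ∴ n :< :suc (2 :* n)) n

  2n<N : 2 * n < suc (2 * n)
  2n<N = ≤-refl

  -- The working form of acyclicity: no directed triangle. The two notions are linked by
  -- `valid⇒dicolouring` and `dicolouring⇒valid`.
  OK : (V → Set) → Set
  OK S = ∀ x y z → S x → S y → S z → _⟶_ n x y → _⟶_ n y z → _⟶_ n z x → ⊥

  ok-⊆ : ∀ {S R : V → Set} → (∀ x → S x → R x) → OK R → OK S
  ok-⊆ h ok x y z p q r = ok x y z (h x p) (h y q) (h z r)

  ok-from : ∀ b {S : V → Set} → (∀ x y z → S x → S y → S z → Bad n (pos b x) (pos b y) (pos b z) → ⊥) → OK S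
  ok-from b h x y z sx sy sz p q r with arcs⇒bad n 2≤n b x y z p q r
  ... | inj₁ bad        = h x y z sx sy sz bad
  ... | inj₂ (inj₁ bad) = h y z x sy sz sx bad
  ... | inj₂ (inj₂ bad) = h z x y sz sx sy bad

  no-bad : ∀ {S : V → Set} → OK S → ∀ b x y z → S x → S y → S z → Bad n (pos b x) (pos b y) (pos b z) → ⊥
  no-bad ok b x y z sx sy sz bad with bad⇒arcs n b x y z bad
  ... | p , q , r = ok x y z sx sy sz p q r

  -- Every alternative of `Bad` forces the last position to be at least n beyond the first.
  ok-interval : ∀ b s {S : V → Set} → (∀ x → S x → s ≤ pos b x × pos b x < s + n) → OK S
  ok-interval b s h = ok-from b λ x y z sx sy sz bad → arith 5
    (λ n s u v w → s :≤ u :× u :< s :+ n ⇒ s :≤ w :× w :< s :+ n ⇒ :Bad n u v w ⇒ ∴ :⊥)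
    n s (pos b x) (pos b y) (pos b z) (h x sx) (h z sz) bad

  Class : Col → Fin k → V → Set
  Class γ c x = γ x ≡ c

  class? : ∀ γ c x → Dec (Class γ c x)
  class? γ c x = γ x ≟ᶠ c

  Valid : Col → Set
  Valid γ = ∀ c → OK (Class γ c)

  antisymmetric : ∀ x y → _⟶_ n x y → _⟶_ n y x → ⊥
  antisymmetric x y p q = arith 5
    (λ n d e f z → z :≡ con 0 ⇒ con 2 :≤ n ⇒ :step n d e z ⇒ :arc n d ⇒ :arc n e ⇒ ∴ :⊥)
    n (pos x y) (pos y x) 0 (pos x x) (off-self n x) 2≤n (off-add n x y x) p q

  -- Within a triangle-free set the arcs are transitive, so a closed walk can be
  -- shortened until it has two vertices.
  no-closed-walk : ∀ {S : V → Set} → OK S → ∀ l (c : Fin (suc (suc l)) → V) → (∀ i → S (c i)) →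
                   (∀ i → _⟶_ n (c i) (c (next i))) → ⊥
  no-closed-walk ok zero c s a = antisymmetric _ _ (a fzero) (a (fsuc fzero))
  no-closed-walk {S} ok (suc l) c s a = no-closed-walk ok l c′ s′ a′
    where
    c′ : Fin (suc (suc l)) → V
    c′ fzero    = c fzero
    c′ (fsuc i) = c (fsuc (fsuc i))
    s′ : ∀ i → S (c′ i)
    s′ fzero    = s fzero
    s′ (fsuc i) = s (fsuc (fsuc i))
    chord : ∀ x y z → S x → S y → S z → _⟶_ n x y → _⟶_ n y z → _⟶_ n x z
    chord x y z sx sy sz p q with comparable
      where
      comparable : _⟶_ n x z ⊎ x ≡ z ⊎ _⟶_ n z x
      comparable with pos x z ≟ pos x x
      ... | yes e = inj₂ (inj₁ (same-pos x (sym e)))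
      ... | no ne = [ inj₁ , (λ t → inj₂ (inj₂ t)) ]′ (arith 4
        (λ n d e z → z :≡ con 0 ⇒ d :≢ z ⇒ d :< :suc (2 :* n) ⇒ e :< :suc (2 :* n) ⇒ :step n d e z ⇒
              ∴ :arc n d :⊎ :arc n e)
        n (pos x z) (pos z x) (pos x x) (off-self n x) ne (pos< x z) (pos< z x) (off-add n x z x))
    ... | inj₁ t           = t
    ... | inj₂ (inj₁ refl) = ⊥-elim (antisymmetric x y p q)
    ... | inj₂ (inj₂ t)    = ⊥-elim (ok x y z sx sy sz p q t)
    a′ : ∀ i → _⟶_ n (c′ i) (c′ (next i))
    a′ fzero = chord _ _ _ (s _) (s _) (s _) (a fzero) (a (fsuc fzero))
    a′ (fsuc i) with next i | a (fsuc (fsuc i))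
    ... | fzero  | p = p
    ... | fsuc j | p = p

  valid⇒dicolouring : ∀ {γ} → Valid γ → IsDicolouring C⟨ n ⟩ k γ
  valid⇒dicolouring v i (l , c , _ , s , a) = no-closed-walk (v i) l c s (λ j → arc-elim n _ _ (a j))

  dicolouring⇒valid : ∀ {γ} → IsDicolouring C⟨ n ⟩ k γ → Valid γ
  dicolouring⇒valid {γ} d i x y z sx sy sz p q r = d i (1 , c , inj , s , a)
    where
    c : Fin 3 → V
    c fzero               = x
    c (fsuc fzero)        = y
    c (fsuc (fsuc fzero)) = z
    s : ∀ j → γ (c j) ≡ i
    s fzero               = sx
    s (fsuc fzero)        = sy
    s (fsuc (fsuc fzero)) = sz
    a : ∀ j → Arc C⟨ n ⟩ (c j) (c (next j))
    a fzero               = arc-intro n x y p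
    a (fsuc fzero)        = arc-intro n y z q
    a (fsuc (fsuc fzero)) = arc-intro n z x r
    loopless : ∀ {u v} → _⟶_ n u v → u ≢ v
    loopless {u} t refl = arc-irreflexive n u t
    inj : ∀ {u v} → c u ≡ c v → u ≡ v
    inj {fzero}             {fzero}             e = refl
    inj {fzero}             {fsuc fzero}        e = ⊥-elim (loopless p e)
    inj {fzero}             {fsuc (fsuc fzero)} e = ⊥-elim (loopless r (sym e))
    inj {fsuc fzero}        {fzero}             e = ⊥-elim (loopless p (sym e))
    inj {fsuc fzero}        {fsuc fzero}        e = refl
    inj {fsuc fzero}        {fsuc (fsuc fzero)} e = ⊥-elim (loopless q e)
    inj {fsuc (fsuc fzero)} {fzero}             e = ⊥-elim (loopless r e)
    inj {fsuc (fsuc fzero)} {fsuc fzero}        e = ⊥-elim (loopless q (sym e))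
    inj {fsuc (fsuc fzero)} {fsuc (fsuc fzero)} e = refl

  Union : Col → Col → Fin k → V → Set
  Union γ δ c x = γ x ≡ c ⊎ δ x ≡ c

  -- A class of any mixture of γ and δ lies in the union of their two classes of that colour, so
  -- this condition yields `Mixable`.
  Unions-OK : Col → Col → Set
  Unions-OK γ δ = ∀ c → OK (Union γ δ c)

  mixed-valid : ∀ {γ δ} → Unions-OK γ δ → ∀ ζ → (∀ x → ζ x ≡ γ x ⊎ ζ x ≡ δ x) → Valid ζ
  mixed-valid ok ζ h c = ok-⊆ (λ x e → [ (λ q → inj₁ (trans (sym q) e)) , (λ q →
        inj₂ (trans (sym q) e)) ]′ (h x)) (ok c)

  walk-directly : ∀ {d} γ δ → Unions-OK γ δ → # (differ? γ δ) ≤ d → Reach d γ δ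
  walk-directly γ δ ok le = reach-weaken le (direct γ δ (λ ζ h → valid⇒dicolouring (mixed-valid ok ζ h)))

  recolour-one : ∀ γ v c → Valid γ → Valid (γ [ v ↦ c ]) → Reach 1 γ (γ [ v ↦ c ])
  recolour-one γ v c ok ok′ = recolour γ v c (valid⇒dicolouring ok) (valid⇒dicolouring ok′)

  update-class : ∀ (γ : Col) v c {d x} → (γ [ v ↦ c ]) x ≡ d → (x ≡ v × c ≡ d) ⊎ (x ≢ v × γ x ≡ d)
  update-class γ v c {d} {x} e with update-case γ v c x
  ... | inj₁ (x≡v , q) = inj₁ (x≡v , trans (sym q) e)
  ... | inj₂ (x≢v , q) = inj₂ (x≢v , trans (sym q) e)

  update-valid : ∀ γ v c → Valid γ → OK (λ x → γ x ≡ c ⊎ x ≡ v) → Valid (γ [ v ↦ c ])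
  update-valid γ v c ok ok′ d with c ≟ᶠ d
  ... | yes refl = ok-⊆ (λ x e → [ (λ q → inj₂ (proj₁ q)) , (λ q → inj₁ (proj₂ q)) ]′ (update-class γ v c e)) ok′
  ... | no c≢d   = ok-⊆ (λ x e → [ (λ q → ⊥-elim (c≢d (proj₂ q))) , proj₂ ]′ (update-class γ v c e)) (ok d)

  Filled : Col → V → Fin k → Set
  Filled γ a p = (∀ x → pos a x < n → γ x ≡ p) × (∀ x → γ x ≡ p → pos a x < n)

  module _ (4≤k : 4 ≤ k) where

    fresh₃ : ∀ a b c → ∃ λ d → d ≢ a × d ≢ b × d ≢ c
    fresh₃ a b c with fresh (a ∷ b ∷ c ∷ []) 4≤k
    ... | d , p ∷ q ∷ r ∷ [] = d , p , q , r

    -- Off the filled interval a class can only fail to be triangle-free when it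
    -- contains both end vertices, so one end is parked on a fresh colour.
    recolour-outside : ∀ γ δ a p → Valid γ → Valid δ → Filled γ a p → Filled δ a p → Reach (n + 2) γ δ
    recolour-outside γ δ a p okγ okδ (γ-in , γ-only) (δ-in , δ-only) =
      reach-weaken (arith 1 (λ n → ∴ (con 1 :+ n) :+ con 1 :≤ n :+ con 2) n)
        (reach-trans (reach-trans
          (recolour-one γ e₁ c okγ (mixed-valid unions ζ₁ (λ _ → inj₁ refl)))
          (walk-directly ζ₁ ζ₂ unions count))
          (reach-sym (recolour-one δ e₁ c okδ (mixed-valid unions ζ₂ (λ _ → inj₂ refl)))))
      where
      e₁ = at a n n<N
      e₂ = at a (2 * n) 2n<N
      -- As e₂ does not have colour c in γ or δ, class c fits into positions n, ..., 2n - 1 even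
      -- with e₁ added; all colours other than p and c then live on n + 1, ..., 2n.
      choice = fresh₃ p (γ e₂) (δ e₂)
      c = proj₁ choice
      ζ₁ = γ [ e₁ ↦ c ]
      ζ₂ = δ [ e₁ ↦ c ]
      outside : ∀ {ε x i} → Filled ε a p → i ≢ p → ε x ≡ i → n ≤ pos a x
      outside {x = x} (f , _) i≢p e with pos a x <? n
      ... | yes lt = ⊥-elim (i≢p (trans (sym e) (f x lt)))
      ... | no ge  = ≮⇒≥ ge
      tail : ∀ {ε x} → Filled ε a p → c ≢ ε e₂ → ε x ≡ c → n ≤ pos a x × pos a x < n + n
      tail {ε} {x} f c≢ e = outside f (proj₁ (proj₂ choice)) e ,
        arith 3 (λ n u e → u :< :suc (2 :* n) ⇒ e :≡ 2 :* n ⇒ u :≢ e ⇒ ∴ u :< n :+ n) n (pos a x) (pos a e₂)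
          (pos< a x) (pos-at a (2 * n) 2n<N) (λ q → c≢ (trans (sym e) (cong ε (same-pos a q))))
      unions : Unions-OK ζ₁ ζ₂
      unions i with c ≟ᶠ i | i ≟ᶠ p
      ... | yes refl | _ = ok-interval a n λ x → [ one γ (γ-in , γ-only) (proj₁ (proj₂ (proj₂ choice))) , one δ
            (δ-in , δ-only) (proj₂ (proj₂ (proj₂ choice))) ]′
        where
        one : ∀ ε {x} → Filled ε a p → c ≢ ε e₂ → (ε [ e₁ ↦ c ]) x ≡ c → n ≤ pos a x × pos a x < n + n
        one ε f c≢ e with update-class ε e₁ c e
        ... | inj₂ (_ , q) = tail {ε} f c≢ q
        ... | inj₁ (refl , _) = arith 2 (λ n u → con 4 :≤ n ⇒ u :≡ n ⇒
              ∴ (n :≤ u :× u :< n :+ n)) n (pos a e₁) 4≤n (pos-at a n n<N)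
      ... | no c≢i | yes refl = ok-interval a 0 λ x e → z≤n , [ one γ γ-only , one δ δ-only ]′ e
        where
        one : ∀ ε {x} → (∀ x → ε x ≡ p → pos a x < n) → (ε [ e₁ ↦ c ]) x ≡ p → pos a x < n
        one ε only e with update-class ε e₁ c e
        ... | inj₁ (_ , q) = ⊥-elim (c≢i q)
        ... | inj₂ (_ , q) = only _ q
      ... | no c≢i | no i≢p = ok-interval a (suc n) λ x → [ one γ (γ-in , γ-only) , one δ (δ-in , δ-only) ]′
        where
        one : ∀ ε {x} → Filled ε a p → (ε [ e₁ ↦ c ]) x ≡ i → suc n ≤ pos a x × pos a x < suc n + n
        one ε {x} f e with update-class ε e₁ c e
        ... | inj₁ (_ , q) = ⊥-elim (c≢i q)
        ... | inj₂ (x≢ , q) = arith 3 (λ n u e → u :< :suc (2 :* n) ⇒ e :≡ n ⇒ u :≢ e ⇒ n :≤ u ⇒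
              ∴ (:suc n :≤ u :× u :< :suc n :+ n))
          n (pos a x) (pos a e₁) (pos< a x) (pos-at a n n<N) (λ q → x≢ (same-pos a q)) (outside {ε} f i≢p q)
      count : # (differ? ζ₁ ζ₂) ≤ n
      count = ≤-trans (#-mono (differ? ζ₁ ζ₂) (interval? (pos a) (λ _ _ → same-pos a) (suc n) n) beyond)
                      (#-interval (pos a) (λ _ _ → same-pos a) (suc n) n)
        where
        beyond : ∀ x → ζ₁ x ≢ ζ₂ x → suc n ≤ pos a x × pos a x < suc n + n
        beyond x d with update-case γ e₁ c x | update-case δ e₁ c x | pos a x <? n
        ... | inj₁ (_ , q)  | inj₁ (_ , r)  | _ = ⊥-elim (d (trans q (sym r)))
        ... | inj₁ (e , _)  | inj₂ (ne , _) | _ = ⊥-elim (ne e)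
        ... | inj₂ (ne , _) | inj₁ (e , _)  | _ = ⊥-elim (ne e)
        ... | inj₂ (_ , q)  | inj₂ (_ , r)  | yes lt = ⊥-elim (d (trans q (trans (trans (γ-in x lt) (sym
              (δ-in x lt))) (sym r))))
        ... | inj₂ (ne , _) | inj₂ _        | no ge = arith 3 (λ n u e → u :< :suc (2 :* n) ⇒ e :≡ n ⇒ u :≢ e ⇒
              n :≤ u ⇒ ∴ (:suc n :≤ u :× u :< :suc n :+ n))
          n (pos a x) (pos a e₁) (pos< a x) (pos-at a n n<N) (λ q → ne (same-pos a q)) (≮⇒≥ ge)

-- Freeing vertices from a colour with the help of two others.

module Clearing-colours (n k : ℕ) (4≤n : 4 ≤ n) (4≤k : 4 ≤ k) where

  open Tournament n k 4≤n public

  Cleared : Col → Col → Fin k → (V → Set) → Set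
  Cleared α β p P = (∀ x → β x ≡ p → α x ≡ p × ¬ P x) × (∀ x → α x ≡ p → ¬ P x → β x ≡ p)

  -- Every vertex of P has to be recoloured anyway; h counts only the additional steps.
  CanClear : (α : Col) (p : Fin k) {P : V → Set} → (∀ x → Dec (P x)) → ℕ → Set
  CanClear α p {P} P? h = ∃ λ β → Valid β × Reach (# P? + h) α β × Cleared α β p P

  in-set? : ∀ (α : Col) c {L : V → Set} → (∀ x → Dec (L x)) → ∀ x → Dec (α x ≡ c × L x)
  in-set? α c L? x = (α x ≟ᶠ c) ×-dec L? x

  -- First r is replaced by q on L; then the vertices of P receive q on L and r elsewhere.
  clear-via : ∀ α p q r {P L : V → Set} (P? : ∀ x → Dec (P x)) (L? : ∀ x → Dec (L x)) →
    Valid α → q ≢ p → r ≢ p → r ≢ q →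
    OK (λ x → α x ≡ q ⊎ (α x ≡ r ⊎ P x) × L x) → OK (λ x → (α x ≡ r ⊎ P x) × ¬ L x) →
    CanClear α p P? (# (in-set? α r L?))
  clear-via α p q r {P} {L} P? L? okα q≢p r≢p r≢q okW okU =
    β , mixed-valid unions₂ β (λ _ → inj₂ refl)
      , reach-weaken (≤-reflexive (+-comm (# (in-set? α r L?)) (# P?)))
          (reach-trans (walk-directly α γ unions₁ (#-mono (differ? α γ) (in-set? α r L?) differ₁))
                       (walk-directly γ β unions₂ (#-mono (differ? γ β) P? differ₂)))
      , only-p , still-p
    where
    γ β : Col
    γ x with in-set? α r L? x
    ... | yes _ = q
    ... | no _  = α x
    β x = choose (P? x) (L? x)
      where
      choose : Dec (P x) → Dec (L x) → Fin k
      choose (yes _) (yes _) = q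
      choose (yes _) (no _)  = r
      choose (no _)  _       = γ x
    γ-case : ∀ x → ((α x ≡ r × L x) × γ x ≡ q) ⊎ (¬ (α x ≡ r × L x) × γ x ≡ α x)
    γ-case x with in-set? α r L? x
    ... | yes s = inj₁ (s , refl)
    ... | no ¬s = inj₂ (¬s , refl)
    β-case : ∀ x → (P x × L x × β x ≡ q) ⊎ (P x × ¬ L x × β x ≡ r) ⊎ (¬ P x × β x ≡ γ x)
    β-case x with P? x
    ... | no ¬s = inj₂ (inj₂ (¬s , refl))
    ... | yes s with L? x
    ... | yes l = inj₁ (s , l , refl)
    ... | no ¬l = inj₂ (inj₁ (s , ¬l , refl))
    γ-q : ∀ x → γ x ≡ q → α x ≡ q ⊎ (α x ≡ r ⊎ P x) × L x
    γ-q x e with γ-case x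
    ... | inj₁ ((s , l) , _) = inj₂ (inj₁ s , l)
    ... | inj₂ (_ , e′)      = inj₁ (trans (sym e′) e)
    γ-other : ∀ {c} x → c ≢ q → γ x ≡ c → α x ≡ c × ¬ (α x ≡ r × L x)
    γ-other x c≢q e with γ-case x
    ... | inj₁ (_ , e′)  = ⊥-elim (c≢q (trans (sym e) e′))
    ... | inj₂ (¬s , e′) = trans (sym e′) e , ¬s
    unions₁ : Unions-OK α γ
    unions₁ c with c ≟ᶠ q
    ... | yes refl = ok-⊆ (λ x → [ inj₁ , γ-q x ]′) okW
    ... | no c≢q   = ok-⊆ (λ x → [ (λ e → e) , (λ e → proj₁ (γ-other x c≢q e)) ]′) (okα c)
    unions₂ : Unions-OK γ β
    unions₂ c with c ≟ᶠ q | c ≟ᶠ r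
    ... | yes refl | _ = ok-⊆ (λ x → [ γ-q x , to-q x ]′) okW
      where
      to-q : ∀ x → β x ≡ q → α x ≡ q ⊎ (α x ≡ r ⊎ P x) × L x
      to-q x e with β-case x
      ... | inj₁ (s , l , _)         = inj₂ (inj₂ s , l)
      ... | inj₂ (inj₁ (_ , _ , e′)) = ⊥-elim (r≢q (trans (sym e′) e))
      ... | inj₂ (inj₂ (_ , e′))     = γ-q x (trans (sym e′) e)
    ... | no c≢q | yes refl = ok-⊆ (λ x → [ from-γ x , to-r x ]′) okU
      where
      from-γ : ∀ x → γ x ≡ r → (α x ≡ r ⊎ P x) × ¬ L x
      from-γ x e with γ-other x c≢q e
      ... | s , ¬s = inj₁ s , λ l → ¬s (s , l)
      to-r : ∀ x → β x ≡ r → (α x ≡ r ⊎ P x) × ¬ L x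
      to-r x e with β-case x
      ... | inj₁ (_ , _ , e′)         = ⊥-elim (c≢q (trans (sym e) e′))
      ... | inj₂ (inj₁ (s , ¬l , _))  = inj₂ s , ¬l
      ... | inj₂ (inj₂ (_ , e′))      = from-γ x (trans (sym e′) e)
    ... | no c≢q | no c≢r = ok-⊆ (λ x → [ (λ e → proj₁ (γ-other x c≢q e)) , other x ]′) (okα c)
      where
      other : ∀ x → β x ≡ c → α x ≡ c
      other x e with β-case x
      ... | inj₁ (_ , _ , e′)        = ⊥-elim (c≢q (trans (sym e) e′))
      ... | inj₂ (inj₁ (_ , _ , e′)) = ⊥-elim (c≢r (trans (sym e) e′))
      ... | inj₂ (inj₂ (_ , e′))     = proj₁ (γ-other x c≢q (trans (sym e′) e))
    differ₁ : ∀ x → α x ≢ γ x → α x ≡ r × L x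
    differ₁ x d with γ-case x
    ... | inj₁ (s , _)  = s
    ... | inj₂ (_ , e′) = ⊥-elim (d (sym e′))
    differ₂ : ∀ x → γ x ≢ β x → P x
    differ₂ x d with β-case x
    ... | inj₁ (s , _)              = s
    ... | inj₂ (inj₁ (s , _))       = s
    ... | inj₂ (inj₂ (_ , e′))      = ⊥-elim (d (sym e′))
    only-p : ∀ x → β x ≡ p → α x ≡ p × ¬ P x
    only-p x e with β-case x
    ... | inj₁ (_ , _ , e′)        = ⊥-elim (q≢p (trans (sym e′) e))
    ... | inj₂ (inj₁ (_ , _ , e′)) = ⊥-elim (r≢p (trans (sym e′) e))
    ... | inj₂ (inj₂ (¬s , e′))    = proj₁ (γ-other x (λ q≡ → q≢p (sym q≡)) (trans (sym e′) e)) , ¬s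
    still-p : ∀ x → α x ≡ p → ¬ P x → β x ≡ p
    still-p x e ¬s with β-case x | γ-case x
    ... | inj₁ (s , _)         | _                  = ⊥-elim (¬s s)
    ... | inj₂ (inj₁ (s , _))  | _                  = ⊥-elim (¬s s)
    ... | inj₂ (inj₂ (_ , e′)) | inj₁ ((s , _) , _) = ⊥-elim (r≢p (trans (sym s) e))
    ... | inj₂ (inj₂ (_ , e′)) | inj₂ (_ , e″)      = trans e′ (trans e″ e)

  -- Triangle-free sets that avoid the vertices e₁ and e₂ at positions n and 2n.
  module Ends (b : V) (S : V → Set) (S? : ∀ x → Dec (S x)) (okS : OK S)
              (S≢n : ∀ x → S x → pos b x ≢ n) (S≢2n : ∀ x → S x → pos b x ≢ 2 * n) where

    -- The pairs of S that form a directed triangle with e₁, respectively e₂.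
    Pair₁ Pair₂ : V → V → Set
    Pair₁ x y = S x × S y × pos b x < n × n < pos b y × (pos b y ≡ pos b x + n ⊎ suc (pos b x + n) < pos b y)
    Pair₂ x y = S x × S y × pos b x < n × n < pos b y × (pos b y ≡ suc (pos b x + n) ⊎ pos b y < pos b x + n)

    pair₁? : ∀ x y → Dec (Pair₁ x y)
    pair₁? x y = S? x ×-dec S? y ×-dec (pos b x <? n) ×-dec (n <? pos b y) ×-dec
      ((pos b y ≟ pos b x + n) ⊎-dec (suc (pos b x + n) <? pos b y))

    pair₂? : ∀ x y → Dec (Pair₂ x y)
    pair₂? x y = S? x ×-dec S? y ×-dec (pos b x <? n) ×-dec (n <? pos b y) ×-dec
      ((pos b y ≟ suc (pos b x + n)) ⊎-dec (pos b y <? pos b x + n))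

    -- A triangle of e₁ with two vertices above n would need one at 2n, and with two vertices below
    -- n it needs one at 0, which the second hypothesis excludes. What remains is `Pair₁`.
    accept₁ : (∀ x y → ¬ Pair₁ x y) → (∀ x y → S x → S y → pos b x ≡ 0 → 0 < pos b y → pos b y < n → ⊥) →
              ∀ e → pos b e ≡ n → OK (λ x → S x ⊎ x ≡ e)
    accept₁ ¬pair ¬low e pe = ok-from b bad
      where
      S⁺ = λ x → S x ⊎ x ≡ e
      bad : ∀ x y z → S⁺ x → S⁺ y → S⁺ z → Bad n (pos b x) (pos b y) (pos b z) → ⊥
      bad x y z (inj₁ p) (inj₁ q) (inj₁ r) t = no-bad okS b x y z p q r t
      bad x y z (inj₂ refl) (inj₂ refl) _ t = arith 3 (λ n u w → :Bad n u u w ⇒ ∴ :⊥) n (pos b x) (pos b z) t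
      bad x y z _ (inj₂ refl) (inj₂ refl) t = arith 3 (λ n u w → :Bad n w u u ⇒ ∴ :⊥) n (pos b y) (pos b x) t
      bad x y z (inj₂ refl) _ (inj₂ refl) t = arith 3 (λ n u w → :Bad n u w u ⇒ ∴ :⊥) n (pos b x) (pos b y) t
      bad x y z (inj₂ refl) (inj₁ q) (inj₁ r) t = arith 4
        (λ n u v w → u :≡ n ⇒ w :≢ 2 :* n ⇒ w :< :suc (2 :* n) ⇒ :Bad n u v w ⇒ ∴ :⊥)
        n (pos b x) (pos b y) (pos b z) pe (S≢2n z r) (pos< b z) t
      bad x y z (inj₁ p) (inj₂ refl) (inj₁ r) t with arith 4
        (λ n u v w → v :≡ n ⇒ w :< :suc (2 :* n) ⇒ :Bad n u v w ⇒ ∴ (u :< n :× n :< w :× (w :≡ u :+ n :⊎ :suc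
              (u :+ n) :< w)))
        n (pos b x) (pos b y) (pos b z) pe (pos< b z) t
      ... | i , j , l = ¬pair x z (p , r , i , j , l)
      bad x y z (inj₁ p) (inj₁ q) (inj₂ refl) t with arith 4
        (λ n u v w → w :≡ n ⇒ :Bad n u v w ⇒ ∴ (u :≡ con 0 :× con 0 :< v :× v :< n))
        n (pos b x) (pos b y) (pos b z) pe t
      ... | i , j , l = ¬low x y p q i j l

    -- Being at the last position, e₂ comes last in the triangle. The other two vertices either
    -- straddle n and form `Pair₂`, or both lie below n with the later one at n - 1, the case of the
    -- second hypothesis.
    accept₂ : (∀ x y → ¬ Pair₂ x y) → (∀ x y → S x → S y → suc (pos b y) ≡ n → pos b x < pos b y → ⊥) →
              ∀ e → pos b e ≡ 2 * n → OK (λ x → S x ⊎ x ≡ e)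
    accept₂ ¬pair ¬low e pe = ok-from b bad
      where
      S⁺ = λ x → S x ⊎ x ≡ e
      bad : ∀ x y z → S⁺ x → S⁺ y → S⁺ z → Bad n (pos b x) (pos b y) (pos b z) → ⊥
      bad x y z (inj₁ p) (inj₁ q) (inj₁ r) t = no-bad okS b x y z p q r t
      bad x y z (inj₂ refl) _ _ t = arith 4
        (λ n u v w → u :≡ 2 :* n ⇒ v :< :suc (2 :* n) ⇒ u :< v ⇒ ∴ :⊥)
        n (pos b x) (pos b y) (pos b z) pe (pos< b y) (proj₁ t)
      bad x y z _ (inj₂ refl) _ t = arith 4
        (λ n u v w → v :≡ 2 :* n ⇒ w :< :suc (2 :* n) ⇒ v :< w ⇒ ∴ :⊥)
        n (pos b x) (pos b y) (pos b z) pe (pos< b z) (proj₁ (proj₂ t))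
      bad x y z (inj₁ p) (inj₁ q) (inj₂ refl) t with arith 4
        (λ n u v w → w :≡ 2 :* n ⇒ u :≢ n ⇒ :Bad n u v w ⇒
          ∴ ((:suc v :≡ n :× u :< v) :⊎ (u :< n :× n :< v :× (v :≡ :suc (u :+ n) :⊎ v :< u :+ n))))
        n (pos b x) (pos b y) (pos b z) pe (S≢n x p) t
      ... | inj₁ (i , j)     = ¬low x y p q i j
      ... | inj₂ (i , j , l) = ¬pair x y (p , q , i , j , l)

    -- Two shapes of a maximal triangle-free set {c, c+1, c+n+1}.
    record One-low : Set where
      field
        {u w w′} : V
        Su : S u
        Sw : S w
        Sw′ : S w′
        u-low : pos b u < n
        w-pos : pos b w ≡ pos b u + n
        w′-pos : pos b w′ ≡ suc (pos b w)
        only-low : ∀ x → S x → pos b x < n → x ≡ u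

    record Two-low : Set where
      field
        {u′ u w} : V
        Su′ : S u′
        Su : S u
        Sw : S w
        u-low : pos b u < n
        u-pos : pos b u ≡ suc (pos b u′)
        w-pos : pos b w ≡ pos b u + n
        only-low : ∀ x → S x → pos b x < n → x ≡ u′ ⊎ x ≡ u
        only-high : ∀ x → S x → n < pos b x → x ≡ w

    private
      -- No vertex of S lies strictly between u and w, since it would complete a triangle with them.
      -- Hence x ≤ u and w ≤ y, and `Pair₂` leaves only y = x + n + 1: S contains u, w, w + 1 or u -
      -- 1, u, w. Any further low vertex would again complete a triangle.
      antipodal-pair : ∀ {u w} → S u → S w → pos b u < n → n < pos b w → pos b w ≡ pos b u + n →
                       ∀ {x y} → Pair₂ x y → One-low ⊎ Two-low
      antipodal-pair {u} {w} su sw u<n n<w e {x} {y} (sx , sy , x<n , n<y , d) with arith 5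
        (λ n u w x y → w :≡ u :+ n ⇒ (y :≡ :suc (x :+ n) :⊎ y :< x :+ n) ⇒ x :≤ u ⇒ w :≤ y ⇒
          ∴ ((u :≡ :suc x :× y :≡ w) :⊎ (x :≡ u :× y :≡ :suc w)))
        n (pos b u) (pos b w) (pos b x) (pos b y) e d (low≤ x sx x<n) (high≥ y sy n<y)
        where
        low≤ : ∀ z → S z → pos b z < n → pos b z ≤ pos b u
        low≤ z sz z<n with pos b u <? pos b z
        ... | no ¬lt = ≮⇒≥ ¬lt
        ... | yes lt = ⊥-elim (no-bad okS b u z w su sz sw (lt , <-trans z<n n<w , inj₂ (inj₂ (inj₂ e))))
        high≥ : ∀ z → S z → n < pos b z → pos b w ≤ pos b z
        high≥ z sz n<z with pos b z <? pos b w
        ... | no ¬lt = ≮⇒≥ ¬lt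
        ... | yes lt = ⊥-elim (no-bad okS b u z w su sz sw (<-trans u<n n<z , lt , inj₂ (inj₂ (inj₂ e))))
      ... | inj₁ (p , q) = inj₂ record
        { Su′ = sx ; Su = su ; Sw = sw ; u-low = u<n ; u-pos = p ; w-pos = e
        ; only-low = λ z sz z<n → [ (λ t → inj₁ (same-pos b t)) , (λ t → inj₂ (same-pos b t)) ]′ (low z sz z<n)
        ; only-high = λ z sz n<z → same-pos b (high z sz n<z) }
        where
        low : ∀ z → S z → pos b z < n → pos b z ≡ pos b x ⊎ pos b z ≡ pos b u
        low z sz z<n with <-cmp (pos b z) (pos b x) | <-cmp (pos b z) (pos b u)
        ... | tri≈ _ t _ | _          = inj₁ t
        ... | _          | tri≈ _ t _ = inj₂ t
        ... | tri< t _ _ | _          = ⊥-elim (no-bad okS b z x w sz sx sw (t , <-trans x<n n<w , inj₂ (inj₂ (inj₁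
              (trans e (cong (_+ n) p))))))
        ... | tri> _ _ t | tri< s _ _ = ⊥-elim (arith 3 (λ z x u → x :< z ⇒ z :< u ⇒ u :≡ :suc x ⇒
              ∴ :⊥) (pos b z) (pos b x) (pos b u) t s p)
        ... | tri> _ _ _ | tri> _ _ s = ⊥-elim (no-bad okS b u z w su sz sw (s , <-trans z<n n<w , inj₂ (inj₂
              (inj₂ e))))
        high : ∀ z → S z → n < pos b z → pos b z ≡ pos b w
        high z sz n<z with <-cmp (pos b z) (pos b w)
        ... | tri≈ _ t _ = t
        ... | tri< t _ _ = ⊥-elim (no-bad okS b u z w su sz sw (<-trans u<n n<z , t , inj₂ (inj₂ (inj₂ e))))
        ... | tri> _ _ t = ⊥-elim (no-bad okS b x w z sx sw sz (<-trans x<n n<w , t , inj₂ (inj₁ (trans e (cong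
              (_+ n) p)))))
      ... | inj₂ (p , q) = inj₁ record
        { Su = su ; Sw = sw ; Sw′ = sy ; u-low = u<n ; w-pos = e ; w′-pos = q
        ; only-low = λ z sz z<n → same-pos b (low z sz z<n) }
        where
        low : ∀ z → S z → pos b z < n → pos b z ≡ pos b u
        low z sz z<n with <-cmp (pos b z) (pos b u)
        ... | tri≈ _ t _ = t
        ... | tri< t _ _ = ⊥-elim (no-bad okS b z u y sz su sy (t , <-trans u<n n<y , inj₂ (inj₂ (inj₁ (trans q
              (cong suc e))))))
        ... | tri> _ _ t = ⊥-elim (no-bad okS b u z w su sz sw (t , <-trans z<n n<w , inj₂ (inj₂ (inj₂ e))))

    -- The distance within `Pair₁` is n or more than n + 1, within `Pair₂` it is n + 1 or less than
    -- n. Without a pair at distance n, two such pairs always span a triangle of S; with one,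
    -- `antipodal-pair` applies.
    both-blocked : ∀ {x y x′ y′} → Pair₁ x y → Pair₂ x′ y′ → One-low ⊎ Two-low
    both-blocked (sx , sy , x<n , n<y , inj₁ e) pair = antipodal-pair sx sy x<n n<y e pair
    both-blocked {x} {y} {x′} {y′} (sx , sy , x<n , n<y , inj₂ l) (sx′ , sy′ , x′<n , n<y′ , inj₁ e) =
      ⊥-elim (arith 5 (λ n x y x′ y′ → x′ :≤ x ⇒ y :≤ y′ ⇒ :suc (x :+ n) :< y ⇒ y′ :≡ :suc (x′ :+ n) ⇒ ∴ :⊥)
        n (pos b x) (pos b y) (pos b x′) (pos b y′)
        (≮⇒≥ λ t → no-bad okS b x x′ y′ sx sx′ sy′ (t , <-trans x′<n n<y′ , inj₂ (inj₂ (inj₁ e))))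
        (≮⇒≥ λ t → no-bad okS b x′ y′ y sx′ sy′ sy (<-trans x′<n n<y′ , t , inj₂ (inj₁ e))) l e)
    both-blocked {x} {y} {x′} {y′} (sx , sy , x<n , n<y , inj₂ l) pair@(sx′ , sy′ , x′<n , n<y′ , inj₂ e)
      with pos b y ≟ pos b x′ + n
    ... | yes q = antipodal-pair sx′ sy x′<n n<y q pair
    ... | no ne = ⊥-elim (arith 5
        (λ n x y x′ y′ → (x′ :≤ x :⊎ (x′ :+ n :≤ y :× y :≢ :suc (x′ :+ n))) ⇒ (y :≤ y′ :⊎ y :≤ :suc (x′ :+ n)) ⇒
          y :≢ x′ :+ n ⇒ :suc (x :+ n) :< y ⇒ y′ :< x′ :+ n ⇒ ∴ :⊥)
        n (pos b x) (pos b y) (pos b x′) (pos b y′) first second ne l e)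
      where
      first : pos b x′ ≤ pos b x ⊎ (pos b x′ + n ≤ pos b y × pos b y ≢ suc (pos b x′ + n))
      first with pos b x <? pos b x′
      ... | no ¬t = inj₁ (≮⇒≥ ¬t)
      ... | yes t = inj₂
        ( ≮⇒≥ (λ s → no-bad okS b x x′ y sx sx′ sy (t , <-trans x′<n n<y , inj₁
            (arith 4 (λ n x x′ y → x′ :< n ⇒ ∴ x′ :< x :+ n) n (pos b x) (pos b x′) (pos b y) x′<n , s , l)))
        , λ s → no-bad okS b x x′ y sx sx′ sy (t , <-trans x′<n n<y , inj₂ (inj₂ (inj₁ s))))
      second : pos b y ≤ pos b y′ ⊎ pos b y ≤ suc (pos b x′ + n)
      second with pos b y′ <? pos b y | suc (pos b x′ + n) <? pos b y
      ... | no ¬t | _    = inj₁ (≮⇒≥ ¬t)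
      ... | _     | no ¬s = inj₂ (≮⇒≥ ¬s)
      ... | yes t | yes s = ⊥-elim (no-bad okS b x′ y′ y sx′ sy′ sy (<-trans x′<n n<y′ , t , inj₁
        (e , arith 3 (λ n y y′ → y :< :suc (2 :* n) ⇒ n :< y′ ⇒ ∴ y :< y′ :+ n) n (pos b y) (pos b y′)
              (pos< b y) n<y′ , s)))

    any-pair₁? : Dec (∃ λ x → ∃ λ y → Pair₁ x y)
    any-pair₁? = Finₚ.any? (λ x → Finₚ.any? (λ y → pair₁? x y))

    any-pair₂? : Dec (∃ λ x → ∃ λ y → Pair₂ x y)
    any-pair₂? = Finₚ.any? (λ x → Finₚ.any? (λ y → pair₂? x y))

    Accepts : ℕ → Set
    Accepts m = ∀ e → pos b e ≡ m → OK (λ x → S x ⊎ x ≡ e)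

    accepts-end : (∀ x → S x → pos b x ≢ 0) → (∀ x → S x → suc (pos b x) ≢ n) →
                  Accepts n ⊎ Accepts (2 * n) ⊎ One-low ⊎ Two-low
    accepts-end ≢0 ≢last with any-pair₁? | any-pair₂?
    ... | no none | _ = inj₁ (accept₁ (λ x y t → none (x , y , t)) (λ x y sx _ e _ _ → ≢0 x sx e))
    ... | _ | no none = inj₂ (inj₁ (accept₂ (λ x y t → none (x , y , t)) (λ x y _ sy e _ → ≢last y sy e)))
    ... | yes (_ , _ , t) | yes (_ , _ , t′) = inj₂ (inj₂ (both-blocked t t′))

  Within : Col → Fin k → V → Set
  Within α q b = ∀ x → α x ≡ q → pos b x < n

  low? : ∀ b x → Dec (pos b x < n)
  low? b x = pos b x <? n

  lows : Col → V → Fin k → ℕ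
  lows α b c = # (in-set? α c (low? b))

  -- The n + 1 positions n, ..., 2n outside the window of q can be used by r and P as soon as one of
  -- the two ends is left out, because n consecutive positions remain.
  clear-plain : ∀ α p q b {P : V → Set} (P? : ∀ x → Dec (P x)) → Valid α → q ≢ p → Within α q b →
    ∀ r → r ≢ p → r ≢ q →
    (∀ e₁ e₂ → pos b e₁ ≡ n → pos b e₂ ≡ 2 * n → α e₁ ≡ r ⊎ P e₁ → α e₂ ≡ r ⊎ P e₂ → ⊥) →
    CanClear α p P? (lows α b r)
  clear-plain α p q b {P} P? okα q≢p within r r≢p r≢q no-conflict =
    clear-via α p q r P? (low? b) okα q≢p r≢p r≢q
      (ok-interval b 0 λ x → [ (λ e → z≤n , within x e) , (λ e → z≤n , proj₂ e) ]′) okU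
    where
    e₁ = at b n n<N
    okU : OK (λ x → (α x ≡ r ⊎ P x) × ¬ (pos b x < n))
    okU with (α e₁ ≟ᶠ r) ⊎-dec P? e₁
    ... | yes t = ok-interval b n λ x (s , ¬l) → arith 2
      (λ n u → n :≤ u ⇒ u :≢ 2 :* n ⇒ u :< :suc (2 :* n) ⇒ ∴ (n :≤ u :× u :< n :+ n)) n (pos b x) (≮⇒≥ ¬l)
      (λ e → no-conflict e₁ x (pos-at b n n<N) e t s) (pos< b x)
    ... | no ¬t = ok-interval b (suc n) λ x (s , ¬l) → arith 2
      (λ n u → n :≤ u ⇒ u :≢ n ⇒ u :< :suc (2 :* n) ⇒ ∴ (:suc n :≤ u :× u :< :suc n :+ n)) n (pos b x) (≮⇒≥ ¬l)
      (λ e → ¬t (subst (λ y → α y ≡ r ⊎ P y) (same-pos b (trans e (sym (pos-at b n n<N)))) s)) (pos< b x)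

  -- When r and P use both ends, parking the end e on a third colour s that accepts it removes the
  -- conflict for one extra step.
  clear-after-move : ∀ α p q b {P : V → Set} (P? : ∀ x → Dec (P x)) → Valid α → q ≢ p → Within α q b →
    ∀ r → r ≢ p → r ≢ q → ∀ s → s ≢ p → s ≢ q → s ≢ r → ∀ e → pos b e ≡ n ⊎ pos b e ≡ 2 * n →
    α e ≡ r ⊎ P e → OK (λ x → α x ≡ s ⊎ x ≡ e) → CanClear α p P? (suc (lows α b r))
  clear-after-move α p q b {P} P? okα q≢p within r r≢p r≢q s s≢p s≢q s≢r e e-end e-used ok-s =
    result (clear-plain α₀ p q b P₀? okα₀ q≢p within₀ r r≢p r≢q no-conflict)
    where
    α₀ = α [ e ↦ s ]
    okα₀ = update-valid α e s okα ok-s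
    P₀? : ∀ x → Dec (P x × x ≢ e)
    P₀? x = P? x ×-dec ¬? (x ≟ᶠ e)
    old : ∀ {c x} → s ≢ c → α₀ x ≡ c → x ≢ e × α x ≡ c
    old s≢c h with update-class α e s h
    ... | inj₁ (_ , s≡c) = ⊥-elim (s≢c s≡c)
    ... | inj₂ t         = t
    within₀ : Within α₀ q b
    within₀ x h = within x (proj₂ (old s≢q h))
    not-e : ∀ {x} → α₀ x ≡ r ⊎ (P x × x ≢ e) → x ≢ e
    not-e (inj₁ h) = proj₁ (old s≢r h)
    not-e (inj₂ h) = proj₂ h
    no-conflict : ∀ e₁ e₂ → pos b e₁ ≡ n → pos b e₂ ≡ 2 * n → α₀ e₁ ≡ r ⊎ (P e₁ × e₁ ≢ e) →
          α₀ e₂ ≡ r ⊎ (P e₂ × e₂ ≢ e) → ⊥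
    no-conflict e₁ e₂ p₁ p₂ u₁ u₂ =
      [ (λ t → not-e u₁ (same-pos b (trans p₁ (sym t)))) , (λ t → not-e u₂ (same-pos b (trans p₂ (sym t)))) ]′ e-end
    result : CanClear α₀ p P₀? (lows α₀ b r) → CanClear α p P? (suc (lows α b r))
    result (β , okβ , reach , only , still) =
      β , okβ , reach-weaken bound (reach-trans (recolour-one α e s okα okα₀) reach) , only′ , still′
      where
      bound : 1 + (# P₀? + lows α₀ b r) ≤ # P? + suc (lows α b r)
      bound = arith 4 (λ a a′ c c′ → a :≤ a′ ⇒ c :≤ c′ ⇒ ∴ con 1 :+ (a :+ c) :≤ a′ :+ :suc c′) (# P₀?) (# P?)
            (lows α₀ b r) (lows α b r)
        (#-mono P₀? P? (λ x → proj₁))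
        (#-mono (in-set? α₀ r (low? b)) (in-set? α r (low? b)) (λ x (h , l) → proj₂ (old s≢r h) , l))
      only′ : ∀ x → β x ≡ p → α x ≡ p × ¬ P x
      only′ x h with only x h
      ... | h₀ , ¬P₀ with old s≢p h₀
      ... | x≢e , h′ = h′ , λ px → ¬P₀ (px , x≢e)
      still′ : ∀ x → α x ≡ p → ¬ P x → β x ≡ p
      still′ x h ¬p = still x (trans (update-other α e s x≢e) h) (λ t → ¬p (proj₁ t))
        where
        x≢e : x ≢ e
        x≢e refl = [ (λ er → r≢p (trans (sym er) h)) , ¬p ]′ e-used

  clear-front : ∀ α p q b {P : V → Set} (P? : ∀ x → Dec (P x)) → Valid α → q ≢ p → Within α q b →
    ∀ r → r ≢ p → r ≢ q → ¬ (α b ≡ q ⊎ α b ≡ r ⊎ P b) → CanClear α p P? (suc (lows α b r))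
  clear-front α p q b {P} P? okα q≢p within r r≢p r≢q free = result
    (clear-via α p q r P? L? okα q≢p r≢p r≢q
      (ok-interval b 1 λ x → [ (λ e → pos≥1 x (inj₁ e) , m<n⇒m<1+n (within x e))
                             , (λ (s , l) → pos≥1 x (inj₂ s) , l) ]′)
      (ok-interval b (suc n) λ x (_ , ¬l) → ≮⇒≥ ¬l , arith 2 (λ n u → u :< :suc (2 :* n) ⇒
            ∴ u :< :suc n :+ n) n (pos b x) (pos< b x)))
    where
    L? : ∀ x → Dec (pos b x < suc n)
    L? x = pos b x <? suc n
    pos≥1 : ∀ x → α x ≡ q ⊎ (α x ≡ r ⊎ P x) → 1 ≤ pos b x
    pos≥1 x h with pos b x ≟ 0
    ... | no ne = n≢0⇒n>0 ne
    ... | yes e with same-pos b (trans e (sym (off-self n b)))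
    ... | refl = ⊥-elim (free h)
    result : CanClear α p P? (# (in-set? α r L?)) → CanClear α p P? (suc (lows α b r))
    result (β , okβ , reach , cl) = β , okβ , reach-weaken (+-monoʳ-≤ (# P?) bound) reach , cl
      where
      bound : # (in-set? α r L?) ≤ suc (lows α b r)
      bound = ≤-trans (#-cover (λ x → pos b x ≟ n) (in-set? α r (low? b)) (in-set? α r L?) split)
        (+-monoˡ-≤ _ (#-unique (λ x → pos b x ≟ n) (λ x y s t → same-pos b (trans s (sym t)))))
        where
        split : ∀ x → α x ≡ r × pos b x < suc n → pos b x ≡ n ⊎ (α x ≡ r × pos b x < n)
        split x (h , l) with pos b x ≟ n
        ... | yes e = inj₁ e
        ... | no ne = inj₂ (h , ≤∧≢⇒< (≤-pred l) ne)

  -- The mirror image of `clear-front`: a free position n - 1 lets the window start at 2n, one step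
  -- before position 0.
  clear-back : ∀ α p q b {P : V → Set} (P? : ∀ x → Dec (P x)) → Valid α → q ≢ p → Within α q b →
    ∀ r → r ≢ p → r ≢ q → (∀ x → suc (pos b x) ≡ n → ¬ (α x ≡ q ⊎ α x ≡ r ⊎ P x)) → CanClear α p P? (suc (lows α b r))
  clear-back α p q b {P} P? okα q≢p within r r≢p r≢q free = result
    (clear-via α p q r P? L? okα q≢p r≢p r≢q
      (ok-from b λ x y z sx sy sz t → arith 4
        (λ n u v w → (:suc u :< n :⊎ u :≡ 2 :* n) ⇒ (:suc v :< n :⊎ v :≡ 2 :* n) ⇒ (:suc w :< n :⊎ w :≡ 2 :* n) ⇒
              :Bad n u v w ⇒ ∴ :⊥)
        n (pos b x) (pos b y) (pos b z) (shape x sx) (shape y sy) (shape z sz) t)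
      (ok-interval b n λ x (_ , ¬l) → ≮⇒≥ (λ l → ¬l (inj₁ l)) ,
        arith 2 (λ n u → u :< :suc (2 :* n) ⇒ u :≢ 2 :* n ⇒ ∴ u :< n :+ n) n (pos b x) (pos< b x) (λ l →
              ¬l (inj₂ l))))
    where
    L = λ x → pos b x < n ⊎ pos b x ≡ 2 * n
    L? : ∀ x → Dec (L x)
    L? x = (pos b x <? n) ⊎-dec (pos b x ≟ 2 * n)
    shape : ∀ x → α x ≡ q ⊎ ((α x ≡ r ⊎ P x) × L x) → suc (pos b x) < n ⊎ pos b x ≡ 2 * n
    shape x h with suc (pos b x) ≟ n | place h
      where
      place : α x ≡ q ⊎ ((α x ≡ r ⊎ P x) × L x) → L x
      place (inj₁ e)       = inj₁ (within x e)
      place (inj₂ (_ , l)) = l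
    ... | yes e | _      = ⊥-elim (free x e ([ inj₁ , (λ t → inj₂ (proj₁ t)) ]′ h))
    ... | no ne | inj₁ l = inj₁ (≤∧≢⇒< l ne)
    ... | no _  | inj₂ l = inj₂ l
    result : CanClear α p P? (# (in-set? α r L?)) → CanClear α p P? (suc (lows α b r))
    result (β , okβ , reach , cl) = β , okβ , reach-weaken (+-monoʳ-≤ (# P?) bound) reach , cl
      where
      bound : # (in-set? α r L?) ≤ suc (lows α b r)
      bound = ≤-trans (#-cover (λ x → pos b x ≟ 2 * n) (in-set? α r (low? b)) (in-set? α r L?)
          (λ { x (h , inj₁ l) → inj₂ (h , l) ; x (h , inj₂ e) → inj₁ e }))
        (+-monoˡ-≤ _ (#-unique (λ x → pos b x ≟ 2 * n) (λ x y s t → same-pos b (trans s (sym t)))))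

  -- The one situation in which two extra recolourings may be needed although the
  -- window contains only two vertices of the colours r₁ and r₂.
  record Exceptional (α : Col) (p q : Fin k) (b : V) (r₁ r₂ : Fin k) : Set where
    field
      no-r₁  : lows α b r₁ ≡ 0
      first  : α b ≡ q ⊎ α b ≡ p
      last   : ∃ λ x → suc (pos b x) ≡ n × (α x ≡ q ⊎ α x ≡ p)
      pair   : ∃ λ u → ∃ λ w → α u ≡ r₂ × α w ≡ r₂ × pos b w ≡ suc (pos b u) × pos b w < n

  -- Two candidates r₁ and r₂ are kept so that the extra cost is controlled by the average of their
  -- numbers of vertices in the window, rounded up.
  record Clearing (α : Col) (p q : Fin k) (b : V) {P : V → Set} (P? : ∀ x → Dec (P x)) : Set where
    field
      {r₁ r₂} : Fin k
      {cost} : ℕ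
      r₁≢p : r₁ ≢ p
      r₁≢q : r₁ ≢ q
      r₂≢p : r₂ ≢ p
      r₂≢q : r₂ ≢ q
      r₁≢r₂ : r₁ ≢ r₂
      clear : CanClear α p P? cost
      bound : 2 * cost ≤ suc (lows α b r₁ + lows α b r₂) ⊎ (cost ≡ 2 × Exceptional α p q b r₁ r₂)

  module _ (α : Col) (p q : Fin k) (b : V) {P : V → Set} (P? : ∀ x → Dec (P x)) (okα : Valid α) (q≢p : q ≢ p)
           (within : Within α q b) (P⊆p : ∀ x → P x → α x ≡ p)
           (not-both : ∀ e₁ e₂ → pos b e₁ ≡ n → pos b e₂ ≡ 2 * n → P e₁ → P e₂ → ⊥) where

    private
      module Sorted (r₁ r₂ : Fin k) (r₁≢p : r₁ ≢ p) (r₁≢q : r₁ ≢ q) (r₂≢p : r₂ ≢ p) (r₂≢q : r₂ ≢ q) (r₁≢r₂ : r₁ ≢ r₂)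
                    (x₁≤x₂ : lows α b r₁ ≤ lows α b r₂) where

        x₁ = lows α b r₁
        x₂ = lows α b r₂
        e₁ = at b n n<N
        e₂ = at b (2 * n) 2n<N
        pe₁ = pos-at b n n<N
        pe₂ = pos-at b (2 * n) 2n<N

        finish : ∀ {cost} → CanClear α p P? cost → 2 * cost ≤ suc (x₁ + x₂) ⊎
              (cost ≡ 2 × Exceptional α p q b r₁ r₂) → Clearing α p q b P?
        finish c d = record { r₁≢p = r₁≢p ; r₁≢q = r₁≢q ; r₂≢p = r₂≢p ; r₂≢q = r₂≢q ; r₁≢r₂ = r₁≢r₂ ; clear = c ; bound = d }

        used? : ∀ x → Dec (α x ≡ r₁ ⊎ P x)
        used? x = (α x ≟ᶠ r₁) ⊎-dec P? x

        is-e₁ : ∀ {e} → pos b e ≡ n → e ≡ e₁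
        is-e₁ t = same-pos b (trans t (sym pe₁))

        is-e₂ : ∀ {e} → pos b e ≡ 2 * n → e ≡ e₂
        is-e₂ t = same-pos b (trans t (sym pe₂))

        -- Since r₁ and P already occupy both ends, a conflict for r₂ would place both ends in P,
        -- contrary to `not-both`.
        with-r₂ : α e₁ ≡ r₁ ⊎ P e₁ → α e₂ ≡ r₁ ⊎ P e₂ → CanClear α p P? x₂
        with-r₂ u₁ u₂ = clear-plain α p q b P? okα q≢p within r₂ r₂≢p r₂≢q no-conflict
          where
          only-P : ∀ {e} → α e ≡ r₁ ⊎ P e → α e ≡ r₂ ⊎ P e → P e
          only-P _        (inj₂ t) = t
          only-P (inj₂ t) _        = t
          only-P (inj₁ s) (inj₁ t) = ⊥-elim (r₁≢r₂ (trans (sym s) t))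
          no-conflict : ∀ f₁ f₂ → pos b f₁ ≡ n → pos b f₂ ≡ 2 * n → α f₁ ≡ r₂ ⊎ P f₁ → α f₂ ≡ r₂ ⊎ P f₂ → ⊥
          no-conflict f₁ f₂ t₁ t₂ v₁ v₂ with is-e₁ t₁ | is-e₂ t₂
          ... | refl | refl = not-both _ _ pe₁ pe₂ (only-P u₁ v₁) (only-P u₂ v₂)

        n-1 = pred n
        last-vertex : ∃ λ x → suc (pos b x) ≡ n
        last-vertex = at b n-1 lt , trans (cong suc (pos-at b n-1 lt)) suc-n-1
          where
          suc-n-1 : suc n-1 ≡ n
          suc-n-1 = suc-pred n {{>-nonZero (≤-trans (s≤s z≤n) 4≤n)}}
          lt : n-1 < suc (2 * n)
          lt = arith 2 (λ n m → :suc m :≡ n ⇒ ∴ m :< :suc (2 :* n)) n n-1 suc-n-1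

        S = Class α r₂

        result : Clearing α p q b P?
        result with used? e₁ | used? e₂
        ... | no ¬u₁ | _ = finish (clear-plain α p q b P? okα q≢p within r₁ r₁≢p r₁≢q
                (λ f₁ f₂ t₁ t₂ v₁ v₂ → ¬u₁ (subst (λ e → α e ≡ r₁ ⊎ P e) (is-e₁ t₁) v₁)))
                (inj₁ (arith 2 (λ a c → a :≤ c ⇒ ∴ 2 :* a :≤ :suc (a :+ c)) x₁ x₂ x₁≤x₂))
        ... | _ | no ¬u₂ = finish (clear-plain α p q b P? okα q≢p within r₁ r₁≢p r₁≢q
                (λ f₁ f₂ t₁ t₂ v₁ v₂ → ¬u₂ (subst (λ e → α e ≡ r₁ ⊎ P e) (is-e₂ t₂) v₂)))
                (inj₁ (arith 2 (λ a c → a :≤ c ⇒ ∴ 2 :* a :≤ :suc (a :+ c)) x₁ x₂ x₁≤x₂))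
        ... | yes u₁ | yes u₂ with x₁ <? x₂
        ... | no ¬lt = finish (with-r₂ u₁ u₂) (inj₁ (arith 2 (λ a c → c :≤ a ⇒
              ∴ 2 :* c :≤ :suc (a :+ c)) x₁ x₂ (≮⇒≥ ¬lt)))
        ... | yes lt with (α b ≟ᶠ q) ⊎-dec (α b ≟ᶠ r₁) ⊎-dec P? b
                        | (α (proj₁ last-vertex) ≟ᶠ q) ⊎-dec (α (proj₁ last-vertex) ≟ᶠ r₁) ⊎-dec P?
                              (proj₁ last-vertex)
        ... | no free | _ = finish (clear-front α p q b P? okα q≢p within r₁ r₁≢p r₁≢q free)
                (inj₁ (arith 2 (λ a c → a :< c ⇒ ∴ 2 :* :suc a :≤ :suc (a :+ c)) x₁ x₂ lt))
        ... | _ | no free = finish (clear-back α p q b P? okα q≢p within r₁ r₁≢p r₁≢q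
                (λ x e → subst (λ y → ¬ (α y ≡ q ⊎ α y ≡ r₁ ⊎ P y)) (same-pos b (suc-injective (trans
                      (proj₂ last-vertex) (sym e)))) free))
                (inj₁ (arith 2 (λ a c → a :< c ⇒ ∴ 2 :* :suc a :≤ :suc (a :+ c)) x₁ x₂ lt))
        ... | yes at-first | yes at-last = conclude (accepts-end ≢0 ≢last)
          where
          not-r₂ : ∀ {x} → α x ≡ q ⊎ α x ≡ r₁ ⊎ P x → α x ≢ r₂
          not-r₂ (inj₁ e)        e′ = r₂≢q (trans (sym e′) e)
          not-r₂ (inj₂ (inj₁ e)) e′ = r₁≢r₂ (trans (sym e) e′)
          not-r₂ (inj₂ (inj₂ s)) e′ = r₂≢p (trans (sym e′) (P⊆p _ s))
          open Ends b S (class? α r₂) (okα r₂)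
            (λ x e t → not-r₂ (inj₂ u₁) (subst S (is-e₁ t) e)) (λ x e t → not-r₂ (inj₂ u₂) (subst S (is-e₂ t) e))
          ≢0 : ∀ x → S x → pos b x ≢ 0
          ≢0 x e t with same-pos b (trans t (sym (off-self n b)))
          ... | refl = not-r₂ at-first e
          ≢last : ∀ x → S x → suc (pos b x) ≢ n
          ≢last x e t with same-pos b (suc-injective (trans t (sym (proj₂ last-vertex))))
          ... | refl = not-r₂ at-last e
          move : ∀ e → pos b e ≡ n ⊎ pos b e ≡ 2 * n → α e ≡ r₁ ⊎ P e → OK (λ x → S x ⊎ x ≡ e) → Clearing α p q b P?
          move e end u ok = finish
            (clear-after-move α p q b P? okα q≢p within r₁ r₁≢p r₁≢q r₂ r₂≢p r₂≢q (λ t → r₁≢r₂ (sym t)) e end u ok)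
            (inj₁ (arith 2 (λ a c → a :< c ⇒ ∴ 2 :* :suc a :≤ :suc (a :+ c)) x₁ x₂ lt))
          few-lows : Two-low → x₂ ≤ 2
          few-lows two = ≤-trans (#-cover (λ x → x ≟ᶠ Two-low.u′ two) (λ x →
                x ≟ᶠ Two-low.u two) (in-set? α r₂ (low? b))
                          (λ x (s , l) → Two-low.only-low two x s l))
                  (+-mono-≤ (#-unique (λ x → x ≟ᶠ Two-low.u′ two) (λ _ _ s t → trans s (sym t)))
                            (#-unique (λ x → x ≟ᶠ Two-low.u two) (λ _ _ s t → trans s (sym t))))
          two-lows : Two-low → Clearing α p q b P?
          two-lows two with x₁ ≟ 0 | x₂ ≟ 2
          ... | yes x₁≡0 | yes x₂≡2 = finish (with-r₂ u₁ u₂) (inj₂ (x₂≡2 , record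
                { no-r₁ = x₁≡0 ; first = q-or-p b at-first (subst (_< n) (sym (off-self n b)) (≤-trans (s≤s z≤n) 4≤n))
                ; last = proj₁ last-vertex , proj₂ last-vertex , q-or-p _ at-last (≤-reflexive (proj₂ last-vertex))
                ; pair = Two-low.u′ two , Two-low.u two , Two-low.Su′ two , Two-low.Su two , Two-low.u-pos two , Two-low.u-low two }))
            where
            q-or-p : ∀ x → α x ≡ q ⊎ α x ≡ r₁ ⊎ P x → pos b x < n → α x ≡ q ⊎ α x ≡ p
            q-or-p x (inj₁ e)        l = inj₁ e
            q-or-p x (inj₂ (inj₂ s)) l = inj₂ (P⊆p x s)
            q-or-p x (inj₂ (inj₁ e)) l = ⊥-elim (1+n≰n (≤-trans (#-exists (in-set? α r₁ (low? b)) x (e , l))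
                  (≤-reflexive x₁≡0)))
          ... | no x₁≢0 | _ = finish (with-r₂ u₁ u₂) (inj₁ (arith 2
                (λ a c → a :< c ⇒ c :≤ con 2 ⇒ a :≢ con 0 ⇒ ∴ 2 :* c :≤ :suc (a :+ c)) x₁ x₂ lt (few-lows two) x₁≢0))
          ... | _ | no x₂≢2 = finish (with-r₂ u₁ u₂) (inj₁ (arith 2
                (λ a c → a :< c ⇒ c :≤ con 2 ⇒ c :≢ con 2 ⇒ ∴ 2 :* c :≤ :suc (a :+ c)) x₁ x₂ lt (few-lows two) x₂≢2))
          conclude : Accepts n ⊎ Accepts (2 * n) ⊎ One-low ⊎ Two-low → Clearing α p q b P?
          conclude (inj₁ acc)        = move e₁ (inj₁ pe₁) u₁ (acc e₁ pe₁)
          conclude (inj₂ (inj₁ acc)) = move e₂ (inj₂ pe₂) u₂ (acc e₂ pe₂)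
          conclude (inj₂ (inj₂ (inj₁ one))) = finish (with-r₂ u₁ u₂)
            (inj₁ (arith 2 (λ a c → a :< c ⇒ c :≤ con 1 ⇒ ∴ 2 :* c :≤ :suc (a :+ c)) x₁ x₂ lt few))
            where
            few : x₂ ≤ 1
            few = #-unique (in-set? α r₂ (low? b)) (λ x y (s , l) (s′ , l′) →
                  trans (One-low.only-low one x s l) (sym (One-low.only-low one y s′ l′)))
          conclude (inj₂ (inj₂ (inj₂ two))) = two-lows two

    clearing : Clearing α p q b P?
    clearing with fresh₃ 4≤k p q q
    ... | r , r≢p , r≢q , _ with fresh₃ 4≤k p q r
    ... | s , s≢p , s≢q , s≢r with ≤-total (lows α b r) (lows α b s)
    ... | inj₁ le = Sorted.result r s r≢p r≢q s≢p s≢q (λ e → s≢r (sym e)) le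
    ... | inj₂ le = Sorted.result s r s≢p s≢q r≢p r≢q s≢r le

  -- Antipodal pairs and the shape of a class.

  least : (f : V → ℕ) {P : V → Set} → (∀ x → Dec (P x)) → ∃ P → ∃ λ x → P x × (∀ y → P y → f x ≤ f y)
  least f {P} P? (x , px) = search (f x) x px ≤-refl
    where
    search : ∀ m x → P x → f x ≤ m → ∃ λ x → P x × (∀ y → P y → f x ≤ f y)
    search m x px le with Finₚ.any? (λ y → P? y ×-dec (f y <? f x))
    ... | no none = x , px , λ y py → ≮⇒≥ (λ lt → none (y , py , lt))
    search zero    x px le | yes (y , py , lt) = ⊥-elim (n≮0 (≤-trans lt le))
    search (suc m) x px le | yes (y , py , lt) = search m y py (≤-pred (≤-trans lt le))

  Antipodal : Col → Fin k → Set
  Antipodal α p = ∃ λ x → ∃ λ y → α x ≡ p × α y ≡ p × pos x y ≡ n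

  antipodal? : ∀ α p → Dec (Antipodal α p)
  antipodal? α p = Finₚ.any? (λ x → Finₚ.any? (λ y → (α x ≟ᶠ p) ×-dec (α y ≟ᶠ p) ×-dec (pos x y ≟ n)))

  -- Without antipodal pairs the class is linearly ordered by its arcs of length
  -- less than n, and its source starts the interval.
  antipodal-or-within : ∀ α p → Valid α → Antipodal α p ⊎ ∃ λ b → Within α p b
  antipodal-or-within α p okα with antipodal? α p
  ... | yes a = inj₁ a
  ... | no ¬a = inj₂ interval
    where
    not-n : ∀ x y → α x ≡ p → α y ≡ p → pos x y ≢ n
    not-n x y px py e = ¬a (x , y , px , py , e)
    from-source : ∀ x → α x ≡ p → ∃ λ b → Within α p b
    from-source x px with Finₚ.any? (λ y → (α y ≟ᶠ p) ×-dec (n <? pos x y))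
    ... | no none = x , λ z pz → ≤∧≢⇒< (≮⇒≥ (λ lt → none (z , pz , lt))) (not-n x z px pz)
    -- The source is the first vertex of the class that lies more than n beyond x; any vertex ahead
    -- of x is then less than n away from it.
    ... | yes some with least (pos x) (λ y → (α y ≟ᶠ p) ×-dec (n <? pos x y)) some
    ... | y , (py , n<y) , min = y , within
      where
      within : Within α p y
      within z pz with n <? pos x z
      ... | yes n<z = arith 4 (λ n w v d → n :< w ⇒ w :≤ v ⇒ v :< :suc (2 :* n) ⇒ d :< :suc (2 :* n) ⇒
            :step n w d v ⇒ ∴ d :< n)
        n (pos x y) (pos x z) (pos y z) n<y (min z (pz , n<z)) (pos< x z) (pos< y z) (off-add n x y z)
      ... | no ¬n<z = arith 5 (λ n w v d e → (v :≡ con 0 :⊎ v :+ n :≤ w) ⇒ w :≢ :suc n ⇒ n :< w ⇒ d :< :suc (2 :* n) ⇒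
          v :≤ n ⇒ v :≢ n ⇒ w :< :suc (2 :* n) ⇒ e :< :suc (2 :* n) ⇒
          :step n w d v ⇒ d :≢ n ⇒ :step n v e w ⇒ e :≢ n ⇒ ∴ d :< n)
        n (pos x y) (pos x z) (pos y z) (pos z y) order w≢ n<y (pos< y z) (≮⇒≥ ¬n<z) (not-n x z px pz) (pos< x y)
              (pos< z y)
        (off-add n x y z) (not-n y z py pz) (off-add n x z y) (not-n z y pz py)
        where
        w≢ : pos x y ≢ suc n
        w≢ e = not-n y x py px (arith 4 (λ n w d z → w :≡ :suc n ⇒ z :≡ con 0 ⇒ d :< :suc (2 :* n) ⇒ :step n w d z ⇒
              ∴ d :≡ n)
          n (pos x y) (pos y x) (pos x x) e (off-self n x) (pos< y x) (off-add n x y x))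
        order : pos x z ≡ 0 ⊎ pos x z + n ≤ pos x y
        order with pos x z ≟ 0 | pos x y <? pos x z + n
        ... | yes e | _     = inj₁ e
        ... | _     | no ge = inj₂ (≮⇒≥ ge)
        ... | no ne | yes lt = ⊥-elim (no-bad (okα p) x x z y px pz py (arith 4
          (λ n o v w → o :≡ con 0 ⇒ v :≢ con 0 ⇒ v :≤ n ⇒ v :≢ n ⇒ n :< w ⇒ w :≢ :suc n ⇒ w :< v :+ n ⇒
            ∴ :Bad n o v w)
          n (pos x x) (pos x z) (pos x y) (off-self n x) ne (≮⇒≥ ¬n<z) (not-n x z px pz) n<y w≢ lt))
    interval : ∃ λ b → Within α p b
    interval with Finₚ.any? (λ x → α x ≟ᶠ p)
    ... | no none      = fzero , λ x px → ⊥-elim (none (x , px))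
    ... | yes (x , px) = from-source x px

  #-within : ∀ α p b → Within α p b → # (class? α p) ≤ n
  #-within α p b w = ≤-trans
    (#-mono (class? α p) (interval? (pos b) (λ _ _ → same-pos b) 0 n) (λ x e → z≤n , w x e))
    (#-interval (pos b) (λ _ _ → same-pos b) 0 n)

  record Pair (α : Col) (p : Fin k) : Set where
    field
      {b x y} : V
      px : α x ≡ p
      py : α y ≡ p
      x-pos : pos b x ≡ n
      y-pos : pos b y ≡ 2 * n

    last : ∃ λ z → suc (pos b z) ≡ n
    last = at b m lt , trans (cong suc (pos-at b m lt)) suc-m
      where
      m = pred n
      suc-m : suc m ≡ n
      suc-m = suc-pred n {{>-nonZero (≤-trans (s≤s z≤n) 4≤n)}}
      lt : m < suc (2 * n)
      lt = arith 2 (λ n m → :suc m :≡ n ⇒ ∴ m :< :suc (2 :* n)) n m suc-m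

  place-pair : ∀ {α p} → Antipodal α p → Pair α p
  place-pair (x , y , px , py , e) = record
    { px = px ; py = py ; x-pos = x-pos
    ; y-pos = arith 4 (λ n u d v → u :≡ n ⇒ d :≡ n ⇒ v :< :suc (2 :* n) ⇒ :step n u d v ⇒ ∴ v :≡ 2 :* n)
        n (pos b x) (pos x y) (pos b y) x-pos e (pos< b y) (off-add n b x y) }
    where
    n+1<N : suc n < suc (2 * n)
    n+1<N = arith 1 (λ n → con 4 :≤ n ⇒ ∴ :suc n :< :suc (2 :* n)) n 4≤n
    -- From x it takes n + 1 steps to b and n more to return, which puts x at position n and its
    -- partner at 2n, the two ends.
    b = at x (suc n) n+1<N
    x-pos : pos b x ≡ n
    x-pos = arith 4 (λ n u d z → u :≡ :suc n ⇒ z :≡ con 0 ⇒ d :< :suc (2 :* n) ⇒ :step n u d z ⇒ ∴ d :≡ n)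
      n (pos x b) (pos b x) (pos x x) (pos-at x (suc n) n+1<N) (off-self n x) (pos< b x) (off-add n x b x)

  -- The class of p is not of the form {c, c+1, c+n+1}.
  record Loose (α : Col) (p : Fin k) : Set where
    field
      the-pair : Pair α p
    open Pair the-pair public
    field
      not-first : ∀ z → α z ≡ p → pos b z ≢ 0
      not-last  : ∀ z → α z ≡ p → suc (pos b z) ≢ n

  module Shape (α : Col) (okα : Valid α) (p : Fin k) where

    no-high : (P : Pair α p) → let open Pair P in ∀ z → α z ≡ p → n < pos b z → pos b z < 2 * n → ⊥
    no-high P z pz l h = no-bad (okα p) b x z y px pz py (arith 4
        (λ n u v w → u :≡ n ⇒ w :≡ 2 :* n ⇒ n :< v ⇒ v :< 2 :* n ⇒ ∴ :Bad n u v w)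
        n (pos b x) (pos b z) (pos b y) x-pos y-pos l h)
      where
      open Pair P

    private
      exactly-three : ∀ {a b c} → α a ≡ p → α b ≡ p → α c ≡ p → a ≢ b → a ≢ c → b ≢ c →
                      (∀ z → α z ≡ p → z ≡ a ⊎ z ≡ b ⊎ z ≡ c) → # (class? α p) ≡ 3
      exactly-three {a} {b} {c} pa pb pc a≢b a≢c b≢c all = ≤-antisym
        (≤-trans (#-cover is-a? bc? (class? α p) all)
          (+-mono-≤ (unique a) (≤-trans (#-cover is-b? is-c? bc? (λ _ t → t)) (+-mono-≤ (unique b) (unique c)))))
        (≤-trans (+-mono-≤ (exists a) (≤-trans (+-mono-≤ (exists b) (exists c)) (#-disjoint is-b? is-c? bc? (λ _ →
              inj₁) (λ _ → inj₂)
            (λ z s t → b≢c (trans (sym s) t)))))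
          (#-disjoint is-a? bc? (class? α p) (λ { z refl → pa }) (λ { z (inj₁ refl) → pb ; z (inj₂ refl) → pc })
            (λ { z s (inj₁ t) → a≢b (trans (sym s) t) ; z s (inj₂ t) → a≢c (trans (sym s) t) })))
        where
        is-a? = λ z → z ≟ᶠ a
        is-b? = λ z → z ≟ᶠ b
        is-c? = λ z → z ≟ᶠ c
        bc? : ∀ z → Dec (z ≡ b ⊎ z ≡ c)
        bc? z = (z ≟ᶠ b) ⊎-dec (z ≟ᶠ c)
        unique : ∀ v → # (λ z → z ≟ᶠ v) ≤ 1
        unique v = #-unique (λ z → z ≟ᶠ v) (λ _ _ s t → trans s (sym t))
        exists : ∀ v → 1 ≤ # (λ z → z ≟ᶠ v)
        exists v = #-exists (λ z → z ≟ᶠ v) v refl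

    -- A vertex of the class at position 0 or n - 1 forms a triangle with one of the ends and any
    -- further low vertex, and `no-high` excludes the high ones. So the class is that vertex and the
    -- two ends.
    loose-or-three : Pair α p → Loose α p ⊎ # (class? α p) ≡ 3
    loose-or-three P = decide
      where
      open Pair P
      apart : ∀ {u v} → pos b u ≢ pos b v → u ≢ v
      apart ne refl = ne refl
      decide : Loose α p ⊎ # (class? α p) ≡ 3
      decide with α b ≟ᶠ p | α (proj₁ last) ≟ᶠ p
      ... | yes pb | _ = inj₂ (exactly-three pb px py
          (apart (arith 3 (λ n o u → con 4 :≤ n ⇒ o :≡ con 0 ⇒ u :≡ n ⇒
                ∴ o :≢ u) n (pos b b) (pos b x) 4≤n (off-self n b) x-pos))
          (apart (arith 3 (λ n o u → con 4 :≤ n ⇒ o :≡ con 0 ⇒ u :≡ 2 :* n ⇒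
                ∴ o :≢ u) n (pos b b) (pos b y) 4≤n (off-self n b) y-pos))
          (apart (arith 3 (λ n o u → con 4 :≤ n ⇒ o :≡ n ⇒ u :≡ 2 :* n ⇒
                ∴ o :≢ u) n (pos b x) (pos b y) 4≤n x-pos y-pos))
          all)
        where
        all : ∀ z → α z ≡ p → z ≡ b ⊎ z ≡ x ⊎ z ≡ y
        all z pz with pos b z ≟ pos b b | pos b z ≟ pos b x | pos b z ≟ pos b y
        ... | yes e | _     | _     = inj₁ (same-pos b e)
        ... | _     | yes e | _     = inj₂ (inj₁ (same-pos b e))
        ... | _     | _     | yes e = inj₂ (inj₂ (same-pos b e))
        ... | no i  | no j  | no l with pos b z <? n
        ... | no ge = ⊥-elim (no-high P z pz
          (arith 3 (λ n u v → v :≡ n ⇒ u :≢ v ⇒ n :≤ u ⇒ ∴ n :< u) n (pos b z) (pos b x) x-pos j (≮⇒≥ ge))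
          (arith 3 (λ n u v → v :≡ 2 :* n ⇒ u :≢ v ⇒ u :< :suc (2 :* n) ⇒
                ∴ u :< 2 :* n) n (pos b z) (pos b y) y-pos l (pos< b z)))
        ... | yes lt = ⊥-elim (no-bad (okα p) b b z x pb pz px
          ( arith 2 (λ o u → o :≡ con 0 ⇒ u :≢ o ⇒ ∴ o :< u) (pos b b) (pos b z) (off-self n b) i
          , subst (pos b z <_) (sym x-pos) lt
          , inj₂ (inj₂ (inj₂ (trans x-pos (sym (cong (_+ n) (off-self n b))))))))
      ... | no _ | yes pl = inj₂ (exactly-three pl px py
          (apart (arith 3 (λ n o u → :suc o :≡ n ⇒ u :≡ n ⇒ ∴ o :≢ u) n (pos b (proj₁ last)) (pos b x)
                (proj₂ last) x-pos))
          (apart (arith 3 (λ n o u → :suc o :≡ n ⇒ u :≡ 2 :* n ⇒ ∴ o :≢ u) n (pos b (proj₁ last)) (pos b y)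
                (proj₂ last) y-pos))
          (apart (arith 3 (λ n o u → con 4 :≤ n ⇒ o :≡ n ⇒ u :≡ 2 :* n ⇒
                ∴ o :≢ u) n (pos b x) (pos b y) 4≤n x-pos y-pos))
          all)
        where
        all : ∀ z → α z ≡ p → z ≡ proj₁ last ⊎ z ≡ x ⊎ z ≡ y
        all z pz with pos b z ≟ pos b (proj₁ last) | pos b z ≟ pos b x | pos b z ≟ pos b y
        ... | yes e | _     | _     = inj₁ (same-pos b e)
        ... | _     | yes e | _     = inj₂ (inj₁ (same-pos b e))
        ... | _     | _     | yes e = inj₂ (inj₂ (same-pos b e))
        ... | no i  | no j  | no l with pos b z <? n
        ... | no ge = ⊥-elim (no-high P z pz
          (arith 3 (λ n u v → v :≡ n ⇒ u :≢ v ⇒ n :≤ u ⇒ ∴ n :< u) n (pos b z) (pos b x) x-pos j (≮⇒≥ ge))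
          (arith 3 (λ n u v → v :≡ 2 :* n ⇒ u :≢ v ⇒ u :< :suc (2 :* n) ⇒
                ∴ u :< 2 :* n) n (pos b z) (pos b y) y-pos l (pos< b z)))
        ... | yes lt = ⊥-elim (no-bad (okα p) b z (proj₁ last) y pz pl py
          ( arith 3 (λ n u v → :suc v :≡ n ⇒ u :≢ v ⇒ u :< n ⇒ ∴ u :< v) n (pos b z) (pos b (proj₁ last))
                (proj₂ last) i lt
          , arith 3 (λ n v w → :suc v :≡ n ⇒ w :≡ 2 :* n ⇒ ∴ v :< w) n (pos b (proj₁ last)) (pos b y)
                (proj₂ last) y-pos
          , inj₂ (inj₂ (inj₁ (arith 3 (λ n v w → :suc v :≡ n ⇒ w :≡ 2 :* n ⇒
                ∴ w :≡ :suc (v :+ n)) n (pos b (proj₁ last)) (pos b y) (proj₂ last) y-pos)))))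
      ... | no ¬pb | no ¬pl = inj₁ record
        { the-pair = P
        ; not-first = λ z pz e → ¬pb (trans (cong α (sym (same-pos b (trans e (sym (off-self n b)))))) pz)
        ; not-last = λ z pz e → ¬pl (trans (cong α (sym (same-pos b (suc-injective (trans e (sym
              (proj₂ last))))))) pz) }

    loose-shape : (L : Loose α p) → let open Loose L in
                  ∀ z → α z ≡ p → pos b z ≡ n ⊎ pos b z ≡ 2 * n ⊎ (0 < pos b z × suc (pos b z) < n)
    loose-shape L z pz with pos b z ≟ n | pos b z ≟ 2 * n | pos b z <? n
      where open Loose L
    ... | yes e | _     | _      = inj₁ e
    ... | _     | yes e | _      = inj₂ (inj₁ e)
    ... | no i  | no j  | no ge  = ⊥-elim (no-high (Loose.the-pair L) z pz (≤∧≢⇒< (≮⇒≥ ge) (λ t →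
          i (sym t))) (≤∧≢⇒< (≤-pred (pos< _ z)) j))
    ... | no _  | no _  | yes lt = inj₂ (inj₂ (n≢0⇒n>0 (Loose.not-first L z pz) , ≤∧≢⇒< lt (Loose.not-last L z pz)))

    -- A class inside an interval is clear. A loose class consists of two ends and vertices among
    -- the n - 2 positions 1, ..., n - 2.
    class-size : # (class? α p) ≤ n
    class-size with antipodal-or-within α p okα
    ... | inj₂ (b , w) = #-within α p b w
    ... | inj₁ a with loose-or-three (place-pair a)
    ... | inj₂ three = ≤-trans (≤-reflexive three) (≤-trans (n≤1+n 3) 4≤n)
    ... | inj₁ L = begin
        # (class? α p)                                 ≤⟨ #-cover (λ z →
              pos b z ≟ n) rest? (class? α p) (loose-shape L) ⟩
        # (λ z → pos b z ≟ n) + # rest?                ≤⟨ +-mono-≤ (unique n) (#-cover (λ z →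
              pos b z ≟ 2 * n) inner? rest? (λ _ t → t)) ⟩
        1 + (# (λ z → pos b z ≟ 2 * n) + # inner?)     ≤⟨ +-monoʳ-≤ 1 (+-mono-≤ (unique (2 * n)) inner≤) ⟩
        1 + (1 + (n ∸ 2))                              ≡⟨ m+[n∸m]≡n 2≤n ⟩
        n                                              ∎
      where
      open ≤-Reasoning
      open Loose L
      inner? : ∀ z → Dec (0 < pos b z × suc (pos b z) < n)
      inner? z = (0 <? pos b z) ×-dec (suc (pos b z) <? n)
      rest? : ∀ z → Dec (pos b z ≡ 2 * n ⊎ (0 < pos b z × suc (pos b z) < n))
      rest? z = (pos b z ≟ 2 * n) ⊎-dec inner? z
      unique : ∀ m → # (λ z → pos b z ≟ m) ≤ 1
      unique m = #-unique (λ z → pos b z ≟ m) (λ _ _ s t → same-pos b (trans s (sym t)))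
      inner≤ : # inner? ≤ n ∸ 2
      inner≤ = ≤-trans (#-mono inner? (interval? (pos b) (λ _ _ → same-pos b) 1 (n ∸ 2)) (λ z (l , h) → l ,
          arith 3 (λ n m u → con 2 :+ m :≡ n ⇒ :suc u :< n ⇒ ∴ u :< con 1 :+ m) n (n ∸ 2) (pos b z)
                (m+[n∸m]≡n 2≤n) h))
        (#-interval (pos b) (λ _ _ → same-pos b) 1 (n ∸ 2))

  -- Bringing a class into an interval by one recolouring.

  some-loose : ∀ α → Valid α → 3 * k ≢ suc (2 * n) → (∀ c → Antipodal α c) → ∃ λ p → Loose α p
  some-loose α okα 3k≢N anti with Finₚ.any? (λ c → ¬? (# (class? α c) ≟ 3))
  ... | yes (c , ne) = c , [ (λ L → L) , (λ e → ⊥-elim (ne e)) ]′ (Shape.loose-or-three α okα c (place-pair (anti c)))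
  ... | no none = ⊥-elim (3k≢N (begin
      3 * k                                          ≡⟨ *-comm 3 k ⟩
      k * 3                                          ≡⟨ cong (_* 3) (length-tabulate {A = Fin k} (λ x → x)) ⟨
      length (allFin k) * 3                          ≡⟨ ∑-const (allFin k) 3 ⟨
      ∑ (allFin k) (λ _ → 3)                         ≡⟨ ∑-cong (allFin k) three ⟨
      ∑ (allFin k) (λ c → # (class? α c))            ≡⟨ ∑-classes α ⟩
      suc (2 * n)                                    ∎))
    where
    open ≡-Reasoning
    three : ∀ c → # (class? α c) ≡ 3
    three c with # (class? α c) ≟ 3
    ... | yes e = e
    ... | no ne = ⊥-elim (none (c , ne))

  -- The fields `q-used` and `q*-low` guarantee that q and q* occupy the window, which later pays
  -- for the recolouring of w₀. The fields `w₀≢n` and `w₀≢2n` keep w₀ off the ends, so that it can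
  -- be freed from q* along with other vertices.
  record Move (α : Col) : Set where
    field
      {w₀ b} : V
      {q q*} : Fin k
      q≢q*    : q ≢ q*
      w₀-q    : α w₀ ≡ q
      valid′  : Valid (α [ w₀ ↦ q* ])
      within  : Within (α [ w₀ ↦ q* ]) q b
      q-used  : ∃ λ x → x ≢ w₀ × α x ≡ q
      q*-low  : ∃ λ y → α y ≡ q* × pos b y < n
      w₀≢n    : pos b w₀ ≢ n
      w₀≢2n   : pos b w₀ ≢ 2 * n

  module Moves (α : Col) (okα : Valid α) (anti : ∀ c → Antipodal α c) (p : Fin k) (L : Loose α p) where

    open Loose L
    open Shape α okα p

    record Straddle (s : Fin k) : Set where
      field
        {l h} : V
        sl : α l ≡ s
        sh : α h ≡ s
        l<n : pos b l < n
        n<h : n < pos b h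
        h<2n : pos b h < 2 * n
        gap : pos b h ≡ pos b l + n ⊎ pos b h ≡ suc (pos b l + n)

    clash : ∀ {c d u v} → α u ≡ c → α v ≡ d → pos b u ≡ pos b v → c ≡ d
    clash cu dv e = trans (sym cu) (trans (cong α (same-pos b e)) dv)

    not-x : ∀ {s z} → s ≢ p → α z ≡ s → pos b z ≢ n
    not-x s≢p sz e = s≢p (clash sz px (trans e (sym x-pos)))

    not-y : ∀ {s z} → s ≢ p → α z ≡ s → pos b z ≢ 2 * n
    not-y s≢p sz e = s≢p (clash sz py (trans e (sym y-pos)))

    -- An antipodal pair other than the two ends has one vertex below n, and both ends belong to p.
    straddle : ∀ s → s ≢ p → Straddle s
    straddle s s≢p with anti s
    ... | x′ , y′ , sx′ , sy′ , e with pos b x′ <? n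
    ... | yes lt = record { sl = sx′ ; sh = sy′ ; l<n = lt ; n<h = proj₁ facts ; h<2n = proj₁
          (proj₂ facts) ; gap = inj₁ (proj₂ (proj₂ facts)) }
      where
      facts : n < pos b y′ × pos b y′ < 2 * n × pos b y′ ≡ pos b x′ + n
      facts = arith 4 (λ n u d v → u :< n ⇒ d :≡ n ⇒ v :< :suc (2 :* n) ⇒ v :≢ n ⇒ v :≢ 2 :* n ⇒ :step n u d v ⇒
          ∴ (n :< v :× v :< 2 :* n :× v :≡ u :+ n))
        n (pos b x′) (pos x′ y′) (pos b y′) lt e (pos< b y′) (not-x s≢p sy′) (not-y s≢p sy′) (off-add n b x′ y′)
    ... | no ge = record { sl = sy′ ; sh = sx′ ; l<n = proj₁ facts ; n<h = proj₁ (proj₂ facts) ; h<2n = proj₁ (proj₂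
          (proj₂ facts)) ; gap = inj₂ (proj₂ (proj₂ (proj₂ facts))) }
      where
      facts : pos b y′ < n × n < pos b x′ × pos b x′ < 2 * n × pos b x′ ≡ suc (pos b y′ + n)
      facts = arith 4 (λ n u d v → n :≤ u ⇒ u :≢ n ⇒ u :≢ 2 :* n ⇒ u :< :suc (2 :* n) ⇒ d :≡ n ⇒
            v :< :suc (2 :* n) ⇒ :step n u d v ⇒
          ∴ (v :< n :× n :< u :× u :< 2 :* n :× u :≡ :suc (v :+ n)))
        n (pos b x′) (pos x′ y′) (pos b y′) (≮⇒≥ ge) (not-x s≢p sx′) (not-y s≢p sx′) (pos< b x′) e (pos< b y′)
              (off-add n b x′ y′)

    -- Without x the class of p occupies only 2n and 1, ..., n - 2, which lie in the interval
    -- starting at y.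
    move-x : ∀ s → s ≢ p → OK (λ z → α z ≡ s ⊎ z ≡ x) → (∃ λ z → α z ≡ s × suc (pos b z) < n) → Move α
    move-x s s≢p ok (z , sz , z<) = record
      { w₀ = x ; b = y ; q≢q* = λ e → s≢p (sym e) ; w₀-q = px
      ; valid′ = update-valid α x s okα ok
      ; within = λ v e → [ (λ t → ⊥-elim (s≢p (proj₂ t))) , (λ t → inside v (proj₁ t) (proj₂ t)) ]′
            (update-class α x s e)
      ; q-used = y , (λ { refl → y≢x refl }) , py
      ; q*-low = z , sz , low (pos b z) (pos y z) z< (pos< y z) (off-add n b y z)
      ; w₀≢n = proj₁ far ; w₀≢2n = proj₂ far }
      where
      y≢x : pos b y ≢ pos b x
      y≢x = arith 3 (λ n u v → con 4 :≤ n ⇒ u :≡ n ⇒ v :≡ 2 :* n ⇒ ∴ v :≢ u) n (pos b x) (pos b y) 4≤n x-pos y-pos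
      low : ∀ v d → suc v < n → d < suc (2 * n) → pos b y + d ≡ v ⊎ pos b y + d ≡ v + suc (2 * n) → d < n
      low v d = arith 4 (λ n y v d → y :≡ 2 :* n ⇒ :suc v :< n ⇒ d :< :suc (2 :* n) ⇒ :step n y d v ⇒
            ∴ d :< n) n (pos b y) v d y-pos
      inside : ∀ v → v ≢ x → α v ≡ p → pos y v < n
      inside v v≢x pv with loose-shape L v pv
      ... | inj₁ e              = ⊥-elim (v≢x (same-pos b (trans e (sym x-pos))))
      ... | inj₂ (inj₂ (_ , l)) = low (pos b v) (pos y v) l (pos< y v) (off-add n b y v)
      ... | inj₂ (inj₁ e) with same-pos b (trans e (sym y-pos))
      ... | refl = subst (_< n) (sym (off-self n y)) (≤-trans (s≤s z≤n) 4≤n)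
      far : pos y x ≢ n × pos y x ≢ 2 * n
      far = arith 4 (λ n v u d → con 4 :≤ n ⇒ v :≡ 2 :* n ⇒ u :≡ n ⇒ d :< :suc (2 :* n) ⇒ :step n v d u ⇒
            ∴ (d :≢ n :× d :≢ 2 :* n))
        n (pos b y) (pos b x) (pos y x) 4≤n y-pos x-pos (pos< y x) (off-add n b y x)

    -- Without y the class of p lies in positions 1, ..., n.
    move-y : ∀ s → s ≢ p → OK (λ z → α z ≡ s ⊎ z ≡ y) → (∃ λ z → α z ≡ s × 0 < pos b z × pos b z < n) → Move α
    move-y s s≢p ok (z , sz , 0<z , z<) = record
      { w₀ = y ; b = b₁ ; q≢q* = λ e → s≢p (sym e) ; w₀-q = py
      ; valid′ = update-valid α y s okα ok
      ; within = λ v e → [ (λ t → ⊥-elim (s≢p (proj₂ t))) , (λ t → inside v (proj₁ t) (proj₂ t)) ]′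
            (update-class α y s e)
      ; q-used = x , (λ { refl → y≢x refl }) , px
      ; q*-low = z , sz , low (pos b z) (pos b₁ z) 0<z (<⇒≤ z<) (pos< b₁ z) (off-add n b b₁ z)
      ; w₀≢n = proj₁ far ; w₀≢2n = proj₂ far }
      where
      1<N : 1 < suc (2 * n)
      1<N = arith 1 (λ n → con 4 :≤ n ⇒ ∴ con 1 :< :suc (2 :* n)) n 4≤n
      b₁ = at b 1 1<N
      y≢x : pos b y ≢ pos b x
      y≢x = arith 3 (λ n u v → con 4 :≤ n ⇒ u :≡ n ⇒ v :≡ 2 :* n ⇒ ∴ v :≢ u) n (pos b x) (pos b y) 4≤n x-pos y-pos
      low : ∀ v d → 0 < v → v ≤ n → d < suc (2 * n) → pos b b₁ + d ≡ v ⊎ pos b b₁ + d ≡ v + suc (2 * n) → d < n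
      low v d = arith 4 (λ n y v d → y :≡ con 1 ⇒ con 0 :< v ⇒ v :≤ n ⇒ d :< :suc (2 :* n) ⇒ :step n y d v ⇒
            ∴ d :< n) n (pos b b₁) v d (pos-at b 1 1<N)
      inside : ∀ v → v ≢ y → α v ≡ p → pos b₁ v < n
      inside v v≢y pv with loose-shape L v pv
      ... | inj₂ (inj₁ e) = ⊥-elim (v≢y (same-pos b (trans e (sym y-pos))))
      ... | inj₂ (inj₂ (i , l)) = low (pos b v) (pos b₁ v) i (<⇒≤ (<-trans (n<1+n _) l)) (pos< b₁ v)
            (off-add n b b₁ v)
      ... | inj₁ e = low (pos b v) (pos b₁ v) (subst (0 <_) (sym e) (≤-trans (s≤s z≤n) 4≤n)) (≤-reflexive e)
            (pos< b₁ v) (off-add n b b₁ v)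
      far : pos b₁ y ≢ n × pos b₁ y ≢ 2 * n
      far = arith 4 (λ n o v d → con 4 :≤ n ⇒ o :≡ con 1 ⇒ v :≡ 2 :* n ⇒ d :< :suc (2 :* n) ⇒ :step n o d v ⇒
            ∴ (d :≢ n :× d :≢ 2 :* n))
        n (pos b b₁) (pos b y) (pos b₁ y) 4≤n (pos-at b 1 1<N) y-pos (pos< b₁ y) (off-add n b b₁ y)

    module Other (s : Fin k) (s≢p : s ≢ p) where

      open Ends b (Class α s) (class? α s) (okα s) (λ z → not-x s≢p) (λ z → not-y s≢p) public

      -- Here p gains a vertex instead of losing one: u lies among 1, ..., n - 2, where it can join
      -- the loose class p. The rest of class s lies above n and before 2n, an interval seen from x.
      move-apex : One-low → Move α
      move-apex T = record
        { w₀ = u ; b = x ; q≢q* = s≢p ; w₀-q = Su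
        ; valid′ = update-valid α u p okα (ok-from b bad)
        ; within = λ v e → [ (λ t → ⊥-elim (s≢p (sym (proj₂ t)))) , (λ t →
              inside v (proj₁ t) (proj₂ t)) ]′ (update-class α u p e)
        ; q-used = w , (λ { refl → arith 2 (λ n v → con 4 :≤ n ⇒ v :≡ v :+ n ⇒ ∴ :⊥) n (pos b u) 4≤n w-pos }) , Sw
        ; q*-low = x , px , subst (_< n) (sym (off-self n x)) (≤-trans (s≤s z≤n) 4≤n)
        ; w₀≢n = proj₁ far ; w₀≢2n = proj₂ far }
        where
        open One-low T
        u-inner : 0 < pos b u × suc (pos b u) < n
        u-inner = arith 4 (λ n u w w′ → w :≡ u :+ n ⇒ w′ :≡ :suc w ⇒ w :≢ n ⇒ w′ :≢ 2 :* n ⇒ w′ :< :suc (2 :* n) ⇒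
              ∴ (con 0 :< u :× :suc u :< n))
          n (pos b u) (pos b w) (pos b w′) w-pos w′-pos (not-x s≢p Sw) (not-y s≢p Sw′) (pos< b w′)
        shape : ∀ z → α z ≡ p ⊎ z ≡ u → pos b z ≡ n ⊎ pos b z ≡ 2 * n ⊎ (0 < pos b z × suc (pos b z) < n)
        shape z (inj₁ pz)   = loose-shape L z pz
        shape z (inj₂ refl) = inj₂ (inj₂ u-inner)
        bad : ∀ z₁ z₂ z₃ → (α z₁ ≡ p ⊎ z₁ ≡ u) → (α z₂ ≡ p ⊎ z₂ ≡ u) → (α z₃ ≡ p ⊎ z₃ ≡ u) →
              Bad n (pos b z₁) (pos b z₂) (pos b z₃) → ⊥
        bad z₁ z₂ z₃ t₁ t₂ t₃ = arith 4
          (λ n u v w → (u :≡ n :⊎ u :≡ 2 :* n :⊎ (con 0 :< u :× :suc u :< n)) ⇒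
                (v :≡ n :⊎ v :≡ 2 :* n :⊎ (con 0 :< v :× :suc v :< n)) ⇒
            (w :≡ n :⊎ w :≡ 2 :* n :⊎ (con 0 :< w :× :suc w :< n)) ⇒ :Bad n u v w ⇒ ∴ :⊥)
          n (pos b z₁) (pos b z₂) (pos b z₃) (shape z₁ t₁) (shape z₂ t₂) (shape z₃ t₃)
        inside : ∀ v → v ≢ u → α v ≡ s → pos x v < n
        inside v v≢u sv with pos b v <? n
        ... | yes lt = ⊥-elim (v≢u (only-low v sv lt))
        ... | no ge = arith 4 (λ n o v d → o :≡ n ⇒ n :≤ v ⇒ v :≢ 2 :* n ⇒ v :< :suc (2 :* n) ⇒ d :< :suc (2 :* n) ⇒
              :step n o d v ⇒ ∴ d :< n)
          n (pos b x) (pos b v) (pos x v) x-pos (≮⇒≥ ge) (not-y s≢p sv) (pos< b v) (pos< x v) (off-add n b x v)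
        far : pos x u ≢ n × pos x u ≢ 2 * n
        far = arith 4 (λ n o u d → o :≡ n ⇒ (con 0 :< u :× :suc u :< n) ⇒ d :< :suc (2 :* n) ⇒ :step n o d u ⇒
              ∴ (d :≢ n :× d :≢ 2 :* n))
          n (pos b x) (pos b u) (pos x u) x-pos u-inner (pos< x u) (off-add n b x u)

      module _ (z : V) (sz : α z ≡ s) (z>n+1 : suc n < pos b z) (z<2n-1 : suc (pos b z) < 2 * n) where

        low-for-x : ∃ λ v → α v ≡ s × suc (pos b v) < n
        low-for-x = l , sl , ≤∧≢⇒< l<n not-last′
          where
          open Straddle (straddle s s≢p)
          not-last′ : suc (pos b l) ≢ n
          not-last′ e = no-bad (okα s) b l z h sl sz sh (arith 4
            (λ n l z h → :suc l :≡ n ⇒ :suc n :< z ⇒ :suc z :< 2 :* n ⇒ (h :≡ l :+ n :⊎ h :≡ :suc (l :+ n)) ⇒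
                  h :< 2 :* n ⇒
              ∴ :Bad n l z h)
            n (pos b l) (pos b z) (pos b h) e z>n+1 z<2n-1 gap h<2n)

        low-for-y : ∃ λ v → α v ≡ s × 0 < pos b v × pos b v < n
        low-for-y = l , sl , n≢0⇒n>0 not-first′ , l<n
          where
          open Straddle (straddle s s≢p)
          not-first′ : pos b l ≢ 0
          not-first′ e = no-bad (okα s) b l h z sl sh sz (arith 4
            (λ n l z h → l :≡ con 0 ⇒ :suc n :< z ⇒ (h :≡ l :+ n :⊎ h :≡ :suc (l :+ n)) ⇒ n :< h ⇒
              ∴ :Bad n l h z)
            n (pos b l) (pos b z) (pos b h) e z>n+1 gap n<h)

        -- Together with a vertex of s at 0, z excludes every `Pair₂`, so y can join s; with one at
        -- n - 1 and none at 0 it excludes every `Pair₁`, so x can join. If s avoids both positions,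
        -- `accepts-end` decides.
        move-or-two-low : Move α ⊎ Two-low
        move-or-two-low with Finₚ.any? (λ v → class? α s v ×-dec (pos b v ≟ 0)) | Finₚ.any? (λ v →
              class? α s v ×-dec (suc (pos b v) ≟ n))
        ... | no ¬first | no ¬last = decide (accepts-end (λ v sv e → ¬first (v , sv , e)) (λ v sv e →
              ¬last (v , sv , e)))
          where
          decide : Accepts n ⊎ Accepts (2 * n) ⊎ One-low ⊎ Two-low → Move α ⊎ Two-low
          decide (inj₁ acc)               = inj₁ (move-x s s≢p (acc x x-pos) low-for-x)
          decide (inj₂ (inj₁ acc))        = inj₁ (move-y s s≢p (acc y y-pos) low-for-y)
          decide (inj₂ (inj₂ (inj₁ one))) = inj₁ (move-apex one)
          decide (inj₂ (inj₂ (inj₂ two))) = inj₂ two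
        ... | yes (f , sf , f0) | _ = inj₁ (move-y s s≢p (accept₂ no-pair no-last y y-pos) low-for-y)
          where
          no-pair : ∀ u v → ¬ Pair₂ u v
          no-pair u v (su , sv , u<n , n<v , d) with pos b v ≟ suc n
          ... | yes e = no-bad (okα s) b f v z sf sv sz (arith 4
            (λ n f v z → f :≡ con 0 ⇒ v :≡ :suc n ⇒ :suc n :< z ⇒ ∴ :Bad n f v z)
            n (pos b f) (pos b v) (pos b z) f0 e z>n+1)
          ... | no ne = no-bad (okα s) b f u v sf su sv (arith 4
            (λ n f u v → f :≡ con 0 ⇒ u :< n ⇒ n :< v ⇒ v :≢ :suc n ⇒ (v :≡ :suc (u :+ n) :⊎ v :< u :+ n) ⇒
              ∴ :Bad n f u v)
            n (pos b f) (pos b u) (pos b v) f0 u<n n<v ne d)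
          no-last : ∀ u v → α u ≡ s → α v ≡ s → suc (pos b v) ≡ n → pos b u < pos b v → ⊥
          no-last u v su sv e lt = no-bad (okα s) b f v z sf sv sz (arith 4
            (λ n f v z → con 4 :≤ n ⇒ f :≡ con 0 ⇒ :suc v :≡ n ⇒ :suc n :< z ⇒ :suc z :< 2 :* n ⇒
              ∴ :Bad n f v z)
            n (pos b f) (pos b v) (pos b z) 4≤n f0 e z>n+1 z<2n-1)
        ... | no ¬first | yes (g , sg , g-last) = inj₁ (move-x s s≢p (accept₁ no-pair (λ u v su _ e _ _ →
              ¬first (u , su , e)) x x-pos) low-for-x)
          where
          no-pair : ∀ u v → ¬ Pair₁ u v
          no-pair u v (su , sv , u<n , n<v , d) with suc (pos b v) ≟ 2 * n | pos b u <? pos b g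
          ... | yes e | _ = no-bad (okα s) b g z v sg sz sv (arith 4
            (λ n g z v → :suc g :≡ n ⇒ :suc v :≡ 2 :* n ⇒ :suc n :< z ⇒ :suc z :< 2 :* n ⇒ ∴ :Bad n g z v)
            n (pos b g) (pos b z) (pos b v) g-last e z>n+1 z<2n-1)
          ... | no ne | no ge = arith 4
            (λ n g u v → :suc g :≡ n ⇒ :suc v :≢ 2 :* n ⇒ v :≢ 2 :* n ⇒ v :< :suc (2 :* n) ⇒ g :≤ u ⇒
                  (v :≡ u :+ n :⊎ :suc (u :+ n) :< v) ⇒ ∴ :⊥)
            n (pos b g) (pos b u) (pos b v) g-last ne (not-y s≢p sv) (pos< b v) (≮⇒≥ ge) d
          ... | no ne | yes lt = no-bad (okα s) b u g v su sg sv (arith 4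
            (λ n u g v → :suc g :≡ n ⇒ n :< v ⇒ :suc v :≢ 2 :* n ⇒ v :≢ 2 :* n ⇒ v :< :suc (2 :* n) ⇒ u :< g ⇒
                  (v :≡ u :+ n :⊎ :suc (u :+ n) :< v) ⇒
              ∴ :Bad n u g v)
            n (pos b u) (pos b g) (pos b v) g-last n<v ne (not-y s≢p sv) (pos< b v) lt d)

    high≢p : ∀ z → n < pos b z → pos b z < 2 * n → α z ≢ p
    high≢p z l h pz = no-high the-pair z pz l h

    private
      n+2<N : suc (suc n) < suc (2 * n)
      n+2<N = arith 1 (λ n → con 4 :≤ n ⇒ ∴ :suc (:suc n) :< :suc (2 :* n)) n 4≤n
      -- Position n + 2 lies strictly between n + 1 and 2n - 1 because n ≥ 4. If its class has the
      -- shape `Two-low`, it can only be {1, 2, n + 2}.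
      z₂ = at b (suc (suc n)) n+2<N
      z₂-pos = pos-at b (suc (suc n)) n+2<N
      s₂ = α z₂
      s₂≢p : s₂ ≢ p
      s₂≢p = high≢p z₂ (arith 2 (λ n z → z :≡ :suc (:suc n) ⇒ ∴ n :< z) n (pos b z₂) z₂-pos)
                       (arith 2 (λ n z → con 4 :≤ n ⇒ z :≡ :suc (:suc n) ⇒ ∴ z :< 2 :* n) n (pos b z₂) 4≤n z₂-pos)

      module _ (two : Other.Two-low s₂ s₂≢p) where

        open Other.Two-low s₂ s₂≢p two

        w≡z₂ : w ≡ z₂
        w≡z₂ = sym (only-high z₂ refl (arith 2 (λ n z → z :≡ :suc (:suc n) ⇒ ∴ n :< z) n (pos b z₂) z₂-pos))

        only-z₂ : ∀ v → α v ≡ s₂ → n < pos b v → pos b v ≡ suc (suc n)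
        only-z₂ v sv lt = trans (cong (pos b) (trans (only-high v sv lt) w≡z₂)) z₂-pos

        u≡2 : pos b u ≡ 2
        u≡2 = arith 3 (λ n u w → w :≡ u :+ n ⇒ w :≡ :suc (:suc n) ⇒ ∴ u :≡ con 2) n (pos b u) (pos b w) w-pos (trans
              (cong (pos b) w≡z₂) z₂-pos)

        -- For n ≥ 5 the next vertex z₃ has another colour, and its class cannot be
        -- {2, 3, n+3}, because 2 has the colour of z₂.
        larger : 4 < n → Move α
        larger 4<n = decide (Other.move-or-two-low (α z₃) s₃≢p z₃ refl
            (arith 2 (λ n z → z :≡ con 3 :+ n ⇒ ∴ :suc n :< z) n (pos b z₃) z₃-pos)
            (arith 2 (λ n z → con 4 :< n ⇒ z :≡ con 3 :+ n ⇒ ∴ :suc z :< 2 :* n) n (pos b z₃) 4<n z₃-pos))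
          where
          n+3<N : 3 + n < suc (2 * n)
          n+3<N = arith 1 (λ n → con 4 :≤ n ⇒ ∴ con 3 :+ n :< :suc (2 :* n)) n 4≤n
          z₃ = at b (3 + n) n+3<N
          z₃-pos = pos-at b (3 + n) n+3<N
          n<z₃ = arith 2 (λ n z → z :≡ con 3 :+ n ⇒ ∴ n :< z) n (pos b z₃) z₃-pos
          s₃≢p : α z₃ ≢ p
          s₃≢p = high≢p z₃ n<z₃ (arith 2 (λ n z → con 4 :< n ⇒ z :≡ con 3 :+ n ⇒
                ∴ z :< 2 :* n) n (pos b z₃) 4<n z₃-pos)
          decide : Move α ⊎ Other.Two-low (α z₃) s₃≢p → Move α
          decide (inj₁ m)    = m
          decide (inj₂ two′) = ⊥-elim (arith 2 (λ n z → z :≡ con 3 :+ n ⇒ z :≡ :suc (:suc n) ⇒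
                ∴ :⊥) n (pos b z₃) z₃-pos
                (only-z₂ z₃ (clash Two.Su′ Su (trans u′≡2 (sym u≡2))) n<z₃))
            where
            module Two = Other.Two-low (α z₃) s₃≢p two′
            u′≡2 : pos b Two.u′ ≡ 2
            u′≡2 = arith 4 (λ n u′ u w → u :≡ :suc u′ ⇒ w :≡ u :+ n ⇒ w :≡ con 3 :+ n ⇒
                  ∴ u′ :≡ con 2) n (pos b Two.u′) (pos b Two.u) (pos b Two.w)
              Two.u-pos Two.w-pos (trans (cong (pos b) (sym (Two.only-high z₃ refl n<z₃))) z₃-pos)

        -- For n = 4 the class of the vertex 5 has to be {0, 5}.
        smallest : n ≡ 4 → Move α
        smallest n≡4 = move-x s₅ s₅≢p (ok-from b bad) (l₀ , sl₀ , l₀<)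
          where
          5<N : 5 < suc (2 * n)
          5<N = arith 1 (λ n → n :≡ con 4 ⇒ ∴ con 5 :< :suc (2 :* n)) n n≡4
          7<N : 7 < suc (2 * n)
          7<N = arith 1 (λ n → n :≡ con 4 ⇒ ∴ con 7 :< :suc (2 :* n)) n n≡4
          z₅ = at b 5 5<N
          z₇ = at b 7 7<N
          z₅-pos = pos-at b 5 5<N
          z₇-pos = pos-at b 7 7<N
          s₅ = α z₅
          s₇ = α z₇
          n<z₅ = arith 2 (λ n z → n :≡ con 4 ⇒ z :≡ con 5 ⇒ ∴ n :< z) n (pos b z₅) n≡4 z₅-pos
          n<z₇ = arith 2 (λ n z → n :≡ con 4 ⇒ z :≡ con 7 ⇒ ∴ n :< z) n (pos b z₇) n≡4 z₇-pos
          s₅≢p : s₅ ≢ p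
          s₅≢p = high≢p z₅ n<z₅ (arith 2 (λ n z → n :≡ con 4 ⇒ z :≡ con 5 ⇒ ∴ z :< 2 :* n) n (pos b z₅) n≡4 z₅-pos)
          s₇≢p : s₇ ≢ p
          s₇≢p = high≢p z₇ n<z₇ (arith 2 (λ n z → n :≡ con 4 ⇒ z :≡ con 7 ⇒ ∴ z :< 2 :* n) n (pos b z₇) n≡4 z₇-pos)
          s₅≢s₂ : s₅ ≢ s₂
          s₅≢s₂ e = arith 2 (λ n z → n :≡ con 4 ⇒ z :≡ con 5 ⇒ z :≡ :suc (:suc n) ⇒
                ∴ :⊥) n (pos b z₅) n≡4 z₅-pos (only-z₂ z₅ e n<z₅)
          s₇≢s₂ : s₇ ≢ s₂
          s₇≢s₂ e = arith 2 (λ n z → n :≡ con 4 ⇒ z :≡ con 7 ⇒ z :≡ :suc (:suc n) ⇒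
                ∴ :⊥) n (pos b z₇) n≡4 z₇-pos (only-z₂ z₇ e n<z₇)
          u′≡1 : pos b u′ ≡ 1
          u′≡1 = suc-injective (trans (sym u-pos) u≡2)
          avoid : ∀ {s v} → s ≢ p → s ≢ s₂ → α v ≡ s → pos b v ≡ 0 ⊎ pos b v ≡ 3 ⊎ pos b v ≡ 5 ⊎ pos b v ≡ 7
          avoid {v = v} s≢p s≢s₂ sv = arith 2
            (λ n v → n :≡ con 4 ⇒ v :< :suc (2 :* n) ⇒ v :≢ n ⇒ v :≢ 2 :* n ⇒ v :≢ con 1 ⇒ v :≢ con 2 ⇒
                  v :≢ :suc (:suc n) ⇒
              ∴ (v :≡ con 0 :⊎ v :≡ con 3 :⊎ v :≡ con 5 :⊎ v :≡ con 7))
            n (pos b v) n≡4 (pos< b v) (not-x s≢p sv) (not-y s≢p sv)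
            (λ e → s≢s₂ (clash sv Su′ (trans e (sym u′≡1)))) (λ e → s≢s₂ (clash sv Su (trans e (sym u≡2))))
            (λ e → s≢s₂ (clash sv refl (trans e (sym z₂-pos))))
          s₇≢s₅ : s₇ ≢ s₅
          s₇≢s₅ e = no-bad (okα s₅) b l z₅ z₇ sl refl e (arith 4
            (λ n l u v → n :≡ con 4 ⇒ l :< n ⇒ u :≡ con 5 ⇒ v :≡ con 7 ⇒
              (l :≡ con 0 :⊎ l :≡ con 3 :⊎ l :≡ con 5 :⊎ l :≡ con 7) ⇒ ∴ :Bad n l u v)
            n (pos b l) (pos b z₅) (pos b z₇) n≡4 l<n z₅-pos z₇-pos (avoid s₅≢p s₅≢s₂ sl))
            where open Straddle (straddle s₅ s₅≢p)
          -- The low vertex of the antipodal pair of s₇ is 0 or 3. With 0 its partner would be 5,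
          -- which has another colour, so 3 belongs to s₇.
          not-3 : ∀ v → α v ≡ s₅ → pos b v ≢ 3
          not-3 v sv e = arith 3 (λ n l h → n :≡ con 4 ⇒ (l :≡ con 0 :⊎ l :≡ con 3 :⊎ l :≡ con 5 :⊎ l :≡ con 7) ⇒
                l :< n ⇒ l :≢ con 3 ⇒
                (h :≡ l :+ n :⊎ h :≡ :suc (l :+ n)) ⇒ n :< h ⇒ h :≢ con 5 ⇒ ∴ :⊥)
              n (pos b l) (pos b h) n≡4 (avoid s₇≢p s₇≢s₂ sl) l<n (λ t →
                    s₇≢s₅ (clash sl sv (trans t (sym e)))) gap n<h
              (λ t → s₇≢s₅ (clash sh refl (trans t (sym z₅-pos))))
            where open Straddle (straddle s₇ s₇≢p)
          zero-or-five : ∀ v → α v ≡ s₅ → pos b v ≡ 0 ⊎ pos b v ≡ 5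
          zero-or-five v sv with avoid s₅≢p s₅≢s₂ sv
          ... | inj₁ e               = inj₁ e
          ... | inj₂ (inj₁ e)        = ⊥-elim (not-3 v sv e)
          ... | inj₂ (inj₂ (inj₁ e)) = inj₂ e
          ... | inj₂ (inj₂ (inj₂ e)) = ⊥-elim (s₇≢s₅ (clash refl sv (trans z₇-pos (sym e))))
          shape : ∀ v → α v ≡ s₅ ⊎ v ≡ x → pos b v ≡ 0 ⊎ pos b v ≡ 4 ⊎ pos b v ≡ 5
          shape v (inj₂ refl) = inj₂ (inj₁ (trans x-pos n≡4))
          shape v (inj₁ sv)   = [ inj₁ , (λ e → inj₂ (inj₂ e)) ]′ (zero-or-five v sv)
          bad : ∀ z₁ z₂ z₃ → (α z₁ ≡ s₅ ⊎ z₁ ≡ x) → (α z₂ ≡ s₅ ⊎ z₂ ≡ x) → (α z₃ ≡ s₅ ⊎ z₃ ≡ x) →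
                Bad n (pos b z₁) (pos b z₂) (pos b z₃) → ⊥
          bad z₁ z₂ z₃ t₁ t₂ t₃ = arith 4
            (λ n u v w → n :≡ con 4 ⇒ (u :≡ con 0 :⊎ u :≡ con 4 :⊎ u :≡ con 5) ⇒
                  (v :≡ con 0 :⊎ v :≡ con 4 :⊎ v :≡ con 5) ⇒
              (w :≡ con 0 :⊎ w :≡ con 4 :⊎ w :≡ con 5) ⇒ :Bad n u v w ⇒ ∴ :⊥)
            n (pos b z₁) (pos b z₂) (pos b z₃) n≡4 (shape z₁ t₁) (shape z₂ t₂) (shape z₃ t₃)
          open Straddle (straddle s₅ s₅≢p) renaming (l to l₀; sl to sl₀; l<n to l₀<n)
          l₀< : suc (pos b l₀) < n
          l₀< = arith 2 (λ n l → n :≡ con 4 ⇒ (l :≡ con 0 :⊎ l :≡ con 5) ⇒ l :< n ⇒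
                ∴ :suc l :< n) n (pos b l₀) n≡4 (zero-or-five l₀ sl₀) l₀<n

    opaque

      move : Move α
      move with Other.move-or-two-low s₂ s₂≢p z₂ refl
          (arith 2 (λ n z → z :≡ :suc (:suc n) ⇒ ∴ :suc n :< z) n (pos b z₂) z₂-pos)
          (arith 2 (λ n z → con 4 :≤ n ⇒ z :≡ :suc (:suc n) ⇒ ∴ :suc z :< 2 :* n) n (pos b z₂) 4≤n z₂-pos)
      ... | inj₁ m = m
      ... | inj₂ two with 4 <? n
      ... | yes 4<n = larger two 4<n
      ... | no 4≮n  = smallest two (≤-antisym (≮⇒≥ 4≮n) 4≤n)

  -- The cost of clearing p outside an interval.

  outside? : ∀ (α : Col) p a x → Dec (α x ≡ p × n ≤ pos a x)
  outside? α p a x = (α x ≟ᶠ p) ×-dec (n ≤? pos a x)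

  -- An end of the complement of the interval starting at a is not coloured p.
  Open-end : Col → Fin k → V → Set
  Open-end α p a = ∃ λ v → α v ≢ p × (pos a v ≡ n ⊎ pos a v ≡ 2 * n)

  -- Two vertices at distance n outside that interval are the ends of its complement.
  not-both-ends : ∀ α p a → Open-end α p a → ∀ b e₁ e₂ → pos b e₁ ≡ n → pos b e₂ ≡ 2 * n →
                  α e₁ ≡ p × n ≤ pos a e₁ → α e₂ ≡ p × n ≤ pos a e₂ → ⊥
  not-both-ends α p a (v , v≢p , end) b e₁ e₂ t₁ t₂ (p₁ , l₁) (p₂ , l₂) =
    [ (λ t → v≢p (trans (cong α (same-pos a (trans t (sym (proj₁ ends))))) p₁))
    , (λ t → v≢p (trans (cong α (same-pos a (trans t (sym (proj₂ ends))))) p₂)) ]′ end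
    where
    distance : pos e₁ e₂ ≡ n
    distance = arith 4 (λ n u v d → u :≡ n ⇒ v :≡ 2 :* n ⇒ d :< :suc (2 :* n) ⇒ :step n u d v ⇒ ∴ d :≡ n)
      n (pos b e₁) (pos b e₂) (pos e₁ e₂) t₁ t₂ (pos< e₁ e₂) (off-add n b e₁ e₂)
    ends : pos a e₁ ≡ n × pos a e₂ ≡ 2 * n
    ends = arith 4 (λ n u v d → d :≡ n ⇒ n :≤ u ⇒ n :≤ v ⇒ u :< :suc (2 :* n) ⇒ v :< :suc (2 :* n) ⇒ :step n u d v ⇒
          ∴ (u :≡ n :× v :≡ 2 :* n))
      n (pos a e₁) (pos a e₂) (pos e₁ e₂) distance l₁ l₂ (pos< a e₁) (pos< a e₂) (off-add n a e₁ e₂)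

  #-low : ∀ b → # (low? b) ≤ n
  #-low b = ≤-trans (#-mono (low? b) (interval? (pos b) (λ _ _ → same-pos b) 0 n) (λ x l → z≤n , l))
                    (#-interval (pos b) (λ _ _ → same-pos b) 0 n)

  two-lows≤ : ∀ α b {c d} → c ≢ d → lows α b c + lows α b d ≤ # (λ x → ((α x ≟ᶠ c) ⊎-dec (α x ≟ᶠ d)) ×-dec low? b x)
  two-lows≤ α b {c} {d} c≢d = #-disjoint (in-set? α c (low? b)) (in-set? α d (low? b))
    (λ x → ((α x ≟ᶠ c) ⊎-dec (α x ≟ᶠ d)) ×-dec low? b x)
    (λ x (s , l) → inj₁ s , l) (λ x (s , l) → inj₂ s , l) (λ x (s , _) (t , _) → c≢d (trans (sym s) t))

  -- The window has n positions, so each vertex of p or q in it lowers the bound on the vertices of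
  -- r₁ and r₂.
  four-lows≤n : ∀ α b {c d e f} → c ≢ d → e ≢ f → c ≢ e → c ≢ f → d ≢ e → d ≢ f →
                (lows α b c + lows α b d) + (lows α b e + lows α b f) ≤ n
  four-lows≤n α b {c} {d} {e} {f} c≢d e≢f c≢e c≢f d≢e d≢f = ≤-trans (+-mono-≤ (two-lows≤ α b c≢d) (two-lows≤ α b e≢f))
    (≤-trans (#-disjoint (λ x → ((α x ≟ᶠ c) ⊎-dec (α x ≟ᶠ d)) ×-dec low? b x) (λ x →
          ((α x ≟ᶠ e) ⊎-dec (α x ≟ᶠ f)) ×-dec low? b x) (low? b)
        (λ x → proj₂) (λ x → proj₂) (λ x (s , _) (t , _) → apart s t))
      (#-low b))
    where
    apart : ∀ {x} → α x ≡ c ⊎ α x ≡ d → α x ≡ e ⊎ α x ≡ f → ⊥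
    apart (inj₁ s) (inj₁ t) = c≢e (trans (sym s) t)
    apart (inj₁ s) (inj₂ t) = c≢f (trans (sym s) t)
    apart (inj₂ s) (inj₁ t) = d≢e (trans (sym s) t)
    apart (inj₂ s) (inj₂ t) = d≢f (trans (sym s) t)

  module AfterMove (α : Col) (okα : Valid α) (anti : ∀ c → Antipodal α c) (M : Move α) where

    open Move M
    α′ = α [ w₀ ↦ q* ]

    keep-colour : ∀ {c x} → c ≢ q → α x ≡ c → x ≢ w₀ × α′ x ≡ c
    keep-colour c≢q e = x≢w₀ , trans (update-other α w₀ q* x≢w₀) e
      where
      x≢w₀ = λ { refl → c≢q (trans (sym e) w₀-q) }

    old-colour : ∀ {c x} → x ≢ w₀ → α′ x ≡ c → α x ≡ c
    old-colour x≢w₀ e = trans (sym (update-other α w₀ q* x≢w₀)) e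

    q-low : 1 ≤ lows α′ b q
    q-low with q-used
    ... | x , x≢w₀ , xq = #-exists (in-set? α′ q (low? b)) x (xq′ , within x xq′)
      where
      xq′ = trans (update-other α w₀ q* x≢w₀) xq

    q*-low′ : ∃ λ y → α′ y ≡ q* × pos b y < n
    q*-low′ with q*-low
    ... | y , yq* , l = y , proj₂ (keep-colour (λ e → q≢q* (sym e)) yq*) , l

    q*-lows : 1 ≤ lows α′ b q*
    q*-lows = #-exists (in-set? α′ q* (low? b)) (proj₁ q*-low′) (proj₂ q*-low′)

    -- For n = 4 the exceptional cost h = 2 would break 2 (2 + h) ≤ n + 3, but it cannot occur.
    -- Positions 1 and 2 have colour r₂, and 0 and 3 have q or q*, so any further colour needs its
    -- antipodal pair at 4 and 8; hence r₁ is the only one. This leaves q* for 5 and 7, and the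
    -- vertex of q* at 0 or 3 completes a triangle with them.
    module Smallest (n≡4 : n ≡ 4) {r₁ r₂ : Fin k} (r₁≢q : r₁ ≢ q) (r₁≢q* : r₁ ≢ q*) (r₂≢q : r₂ ≢ q) (r₂≢q* : r₂ ≢ q*)
                    (r₁≢r₂ : r₁ ≢ r₂) (exc : Exceptional α′ q* q b r₁ r₂) where

      open Exceptional exc

      clash : ∀ {c d u v} → α′ u ≡ c → α′ v ≡ d → pos b u ≡ pos b v → c ≡ d
      clash cu dv e = trans (sym cu) (trans (cong α′ (same-pos b e)) dv)

      not-first : ∀ {c x} → c ≢ q → c ≢ q* → α′ x ≡ c → pos b x ≢ 0
      not-first c≢q c≢q* e t =
        [ (λ s → c≢q (clash e s (trans t (sym (off-self n b))))) , (λ s →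
              c≢q* (clash e s (trans t (sym (off-self n b))))) ]′ first

      not-last : ∀ {c x} → c ≢ q → c ≢ q* → α′ x ≡ c → suc (pos b x) ≢ n
      not-last c≢q c≢q* e t with last
      ... | z , zp , s = [ (λ s → c≢q (clash e s (suc-injective (trans t (sym zp))))) , (λ s →
            c≢q* (clash e s (suc-injective (trans t (sym zp))))) ]′ s

      u = proj₁ pair
      w = proj₁ (proj₂ pair)
      ur₂ = proj₁ (proj₂ (proj₂ pair))
      wr₂ = proj₁ (proj₂ (proj₂ (proj₂ pair)))
      w-next = proj₁ (proj₂ (proj₂ (proj₂ (proj₂ pair))))
      w<n = proj₂ (proj₂ (proj₂ (proj₂ (proj₂ pair))))

      u≡1 : pos b u ≡ 1
      u≡1 = arith 3 (λ n u w → n :≡ con 4 ⇒ w :≡ :suc u ⇒ w :< n ⇒ u :≢ con 0 ⇒ :suc w :≢ n ⇒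
            ∴ u :≡ con 1) n (pos b u) (pos b w) n≡4 w-next w<n
        (not-first r₂≢q r₂≢q* ur₂) (not-last r₂≢q r₂≢q* wr₂)

      w≡2 : pos b w ≡ 2
      w≡2 = trans w-next (cong suc u≡1)

      inner-r₂ : ∀ {c x} → c ≢ q → c ≢ q* → α′ x ≡ c → pos b x < n → c ≡ r₂
      inner-r₂ {x = x} c≢q c≢q* e l = [ (λ t → clash e ur₂ (trans t (sym u≡1))) , (λ t →
            clash e wr₂ (trans t (sym w≡2))) ]′
        (arith 2 (λ n x → n :≡ con 4 ⇒ x :< n ⇒ x :≢ con 0 ⇒ :suc x :≢ n ⇒
              ∴ (x :≡ con 1 :⊎ x :≡ con 2)) n (pos b x) n≡4 l
          (not-first c≢q c≢q* e) (not-last c≢q c≢q* e))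

      high-pair : ∀ c → c ≢ q → c ≢ q* → c ≢ r₂ → ∃ λ x → ∃ λ y → α′ x ≡ c × α′ y ≡ c × pos b x ≡ n × pos b y ≡ 2 * n
      high-pair c c≢q c≢q* c≢r₂ with anti c
      ... | x , y , xc , yc , e = x , y , xc′ , yc′ , arith 4
          (λ n u d v → d :≡ n ⇒ n :≤ u ⇒ n :≤ v ⇒ u :< :suc (2 :* n) ⇒ v :< :suc (2 :* n) ⇒ :step n u d v ⇒
                ∴ (u :≡ n :× v :≡ 2 :* n))
          n (pos b x) (pos x y) (pos b y) e (high xc′) (high yc′) (pos< b x) (pos< b y) (off-add n b x y)
        where
        xc′ = proj₂ (keep-colour c≢q xc)
        yc′ = proj₂ (keep-colour c≢q yc)
        high : ∀ {z} → α′ z ≡ c → n ≤ pos b z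
        high zc = ≮⇒≥ λ l → c≢r₂ (inner-r₂ c≢q c≢q* zc l)

      coloured-q* : ∀ z → pos b z ≡ 5 ⊎ pos b z ≡ 7 → α′ z ≡ q*
      coloured-q* z place with α′ z ≟ᶠ q*
      ... | yes e = e
      ... | no c≢q* with high-pair r₁ r₁≢q r₁≢q* r₁≢r₂ | α′ z ≟ᶠ r₁
      ... | x , y , xr₁ , yr₁ , x-pos , y-pos | yes e = ⊥-elim (no-bad (valid′ r₁) b x z y xr₁ e yr₁ (arith 4
          (λ n u v w → n :≡ con 4 ⇒ u :≡ n ⇒ w :≡ 2 :* n ⇒ (v :≡ con 5 :⊎ v :≡ con 7) ⇒ ∴ :Bad n u v w)
          n (pos b x) (pos b z) (pos b y) n≡4 x-pos y-pos place))
      ... | x , y , xr₁ , yr₁ , x-pos , y-pos | no c≢r₁ with high-pair (α′ z) c≢q c≢q* c≢r₂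
        where
        c≢q : α′ z ≢ q
        c≢q e = arith 2 (λ n v → n :≡ con 4 ⇒ (v :≡ con 5 :⊎ v :≡ con 7) ⇒ v :< n ⇒
              ∴ :⊥) n (pos b z) n≡4 place (within z e)
        c≢r₂ : α′ z ≢ r₂
        c≢r₂ e = no-bad (valid′ r₂) b u w z ur₂ wr₂ e (arith 4
          (λ n u w v → n :≡ con 4 ⇒ u :≡ con 1 ⇒ w :≡ con 2 ⇒ (v :≡ con 5 :⊎ v :≡ con 7) ⇒ ∴ :Bad n u w v)
          n (pos b u) (pos b w) (pos b z) n≡4 u≡1 w≡2 place)
      ... | x′ , _ , x′c , _ , x′-pos , _ = ⊥-elim (c≢r₁ (clash x′c xr₁ (trans x′-pos (sym x-pos))))

      impossible : ⊥
      impossible = no-bad (valid′ q*) b y z₅ z₇ yq* (coloured-q* z₅ (inj₁ p₅)) (coloured-q* z₇ (inj₂ p₇)) (arith 4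
          (λ n y u v → n :≡ con 4 ⇒ (y :≡ con 0 :⊎ :suc y :≡ n) ⇒ u :≡ con 5 ⇒ v :≡ con 7 ⇒
            ∴ :Bad n y u v)
          n (pos b y) (pos b z₅) (pos b z₇) n≡4 y-place p₅ p₇)
        where
        5<N : 5 < suc (2 * n)
        5<N = arith 1 (λ n → n :≡ con 4 ⇒ ∴ con 5 :< :suc (2 :* n)) n n≡4
        7<N : 7 < suc (2 * n)
        7<N = arith 1 (λ n → n :≡ con 4 ⇒ ∴ con 7 :< :suc (2 :* n)) n n≡4
        z₅ = at b 5 5<N
        z₇ = at b 7 7<N
        p₅ = pos-at b 5 5<N
        p₇ = pos-at b 7 7<N
        y = proj₁ q*-low′
        yq* = proj₁ (proj₂ q*-low′)
        y-place : pos b y ≡ 0 ⊎ suc (pos b y) ≡ n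
        y-place = arith 2 (λ n y → n :≡ con 4 ⇒ y :< n ⇒ y :≢ con 1 ⇒ y :≢ con 2 ⇒
              ∴ (y :≡ con 0 :⊎ :suc y :≡ n)) n (pos b y) n≡4
          (proj₂ (proj₂ q*-low′))
          (λ t → r₂≢q* (clash ur₂ yq* (trans u≡1 (sym t)))) (λ t → r₂≢q* (clash wr₂ yq* (trans w≡2 (sym t))))

    -- The move adds one step, but q keeps a vertex in the window. Thus r₁ and r₂ have at most n - 1
    -- vertices there, 2h ≤ n, and 2 (1 + h) ≤ n + 2; the exceptional h = 2 fits because n ≥ 4.
    clear-other : ∀ p → p ≢ q → p ≢ q* → ∀ a → Open-end α p a → ∃ λ h →
          CanClear α p (outside? α p a) h × 2 * h ≤ 2 + n
    clear-other p p≢q p≢q* a end with clearing α′ p q b (outside? α p a) valid′ (λ e → p≢q (sym e)) within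
        (λ x (e , _) → proj₂ (keep-colour p≢q e)) (not-both-ends α p a end b)
    ... | record { r₁ = r₁ ; r₂ = r₂ ; cost = h ; r₁≢p = r₁≢p ; r₁≢q = r₁≢q ; r₂≢p = r₂≢p ; r₂≢q = r₂≢q ; r₁≢r₂ = r₁≢r₂
                 ; clear = β , okβ , reach , only , still ; bound = bnd } =
      suc h , (β , okβ , reach-weaken (≤-reflexive (sym (+-suc _ h))) (reach-trans
            (recolour-one α w₀ q* okα valid′) reach) , only′ , still′) ,
        arith 6 (λ n h x₁ x₂ xq xp → con 4 :≤ n ⇒ con 1 :≤ xq ⇒ (xq :+ xp) :+ (x₁ :+ x₂) :≤ n ⇒
            (2 :* h :≤ :suc (x₁ :+ x₂) :⊎ h :≡ con 2) ⇒ ∴ 2 :* :suc h :≤ con 2 :+ n)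
          n h (lows α′ b r₁) (lows α′ b r₂) (lows α′ b q) (lows α′ b p) 4≤n q-low
          (four-lows≤n α′ b (λ e → p≢q (sym e)) r₁≢r₂ (λ e → r₁≢q (sym e)) (λ e → r₂≢q (sym e)) (λ e →
                r₁≢p (sym e)) (λ e → r₂≢p (sym e)))
          ([ inj₁ , (λ t → inj₂ (proj₁ t)) ]′ bnd)
      where
      only′ : ∀ x → β x ≡ p → α x ≡ p × ¬ (α x ≡ p × n ≤ pos a x)
      only′ x e with only x e
      ... | e′ , ¬P with update-class α w₀ q* e′
      ... | inj₁ (_ , t) = ⊥-elim (p≢q* (sym t))
      ... | inj₂ (_ , t) = t , ¬P
      still′ : ∀ x → α x ≡ p → ¬ (α x ≡ p × n ≤ pos a x) → β x ≡ p
      still′ x e ¬P = still x (proj₂ (keep-colour p≢q e)) ¬P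

    -- After the move w₀ has the colour q*, hence has to be recoloured as well.
    Removed : V → V → Set
    Removed a x = (α x ≡ q* × n ≤ pos a x) ⊎ x ≡ w₀

    removed? : ∀ a x → Dec (Removed a x)
    removed? a x = outside? α q* a x ⊎-dec (x ≟ᶠ w₀)

    -- Moving w₀ into q* and out again adds two steps. As q and q* both occupy the window, 2h ≤ n -
    -- 1 and 2 (2 + h) ≤ n + 3; the exceptional h = 2 fits for n ≥ 5, and `Smallest` settles n = 4.
    clear-target : ∀ a → Open-end α q* a → ∃ λ h → CanClear α q* (outside? α q* a) h × 2 * h ≤ 3 + n
    clear-target a end with clearing α′ q* q b (removed? a) valid′ q≢q* within P⊆ not-both
      where
      P⊆ : ∀ x → Removed a x → α′ x ≡ q*
      P⊆ x (inj₁ (e , _)) = proj₂ (keep-colour (λ t → q≢q* (sym t)) e)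
      P⊆ x (inj₂ refl)    = update-at α w₀ q*
      not-both : ∀ e₁ e₂ → pos b e₁ ≡ n → pos b e₂ ≡ 2 * n →
                 Removed a e₁ → Removed a e₂ → ⊥
      not-both e₁ e₂ t₁ t₂ (inj₂ refl) _           = w₀≢n t₁
      not-both e₁ e₂ t₁ t₂ _           (inj₂ refl) = w₀≢2n t₂
      not-both e₁ e₂ t₁ t₂ (inj₁ s₁)   (inj₁ s₂)   = not-both-ends α q* a end b e₁ e₂ t₁ t₂ s₁ s₂
    ... | record { r₁ = r₁ ; r₂ = r₂ ; cost = h ; r₁≢p = r₁≢p ; r₁≢q = r₁≢q ; r₂≢p = r₂≢p ; r₂≢q = r₂≢q ; r₁≢r₂ = r₁≢r₂
                 ; clear = β , okβ , reach , only , still ; bound = bnd } =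
      2 + h , (β , okβ , reach-weaken count (reach-trans (recolour-one α w₀ q* okα valid′) reach) , only′ , still′) ,
        arith 6 (λ n h x₁ x₂ xq xp → con 4 :≤ n ⇒ con 1 :≤ xq ⇒ con 1 :≤ xp ⇒ (xq :+ xp) :+ (x₁ :+ x₂) :≤ n ⇒
            (2 :* h :≤ :suc (x₁ :+ x₂) :⊎ (h :≡ con 2 :× n :≢ con 4)) ⇒ ∴ 2 :* (con 2 :+ h) :≤ con 3 :+ n)
          n h (lows α′ b r₁) (lows α′ b r₂) (lows α′ b q) (lows α′ b q*) 4≤n q-low q*-lows
          (four-lows≤n α′ b q≢q* r₁≢r₂ (λ e → r₁≢q (sym e)) (λ e → r₂≢q (sym e)) (λ e → r₁≢p (sym e)) (λ e →
                r₂≢p (sym e)))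
          ([ inj₁ , (λ t → inj₂ (proj₁ t , λ n≡4 → Smallest.impossible n≡4 r₁≢q r₁≢p r₂≢q r₂≢p r₁≢r₂
                (proj₂ t))) ]′ bnd)
      where
      count : 1 + (# (removed? a) + h) ≤ # (outside? α q* a) + (2 + h)
      count = arith 4 (λ a c e h → a :≤ c :+ e ⇒ e :≤ con 1 ⇒ ∴ con 1 :+ (a :+ h) :≤ c :+ (con 2 :+ h))
        (# (removed? a)) (# (outside? α q* a)) (# (λ x → x ≟ᶠ w₀)) h
        (#-cover (outside? α q* a) (λ x → x ≟ᶠ w₀) (removed? a) (λ _ t → t)) (#-unique (λ x → x ≟ᶠ w₀) (λ _ _ s t →
              trans s (sym t)))
      only′ : ∀ x → β x ≡ q* → α x ≡ q* × ¬ (α x ≡ q* × n ≤ pos a x)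
      only′ x e with only x e
      ... | e′ , ¬P = old-colour (λ t → ¬P (inj₂ t)) e′ , λ t → ¬P (inj₁ t)
      still′ : ∀ x → α x ≡ q* → ¬ (α x ≡ q* × n ≤ pos a x) → β x ≡ q*
      still′ x e ¬P with keep-colour (λ t → q≢q* (sym t)) e
      ... | x≢w₀ , e′ = still x e′ [ ¬P , x≢w₀ ]′

  -- The two bounds separate p = q* from the other targets, so that the dearer one need be accepted
  -- for only one of the two colourings.
  record Plan (α : Col) : Set where
    field
      q q* : Fin k
      cheap   : ∀ p → p ≢ q → ∀ a → Open-end α p a → ∃ λ h → CanClear α p (outside? α p a) h × 2 * h ≤ 3 + n
      cheaper : ∀ p → p ≢ q → p ≢ q* → ∀ a → Open-end α p a → ∃ λ h → CanClear α p (outside? α p a) h × 2 * h ≤ 2 + n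

  relax : ∀ {A : ℕ → Set} → (∃ λ h → A h × 2 * h ≤ 2 + n) → ∃ λ h → A h × 2 * h ≤ 3 + n
  relax (h , c , le) = h , c , m≤n⇒m≤1+n le

  plan-within : ∀ α → Valid α → ∀ q b → Within α q b → Plan α
  plan-within α okα q b within = record
    -- No vertex has been moved here, so q itself fills the place of q*.
    { q = q ; q* = q ; cheap = λ p p≢q a end → relax (main p p≢q a end) ; cheaper = λ p p≢q _ → main p p≢q }
    where
    main : ∀ p → p ≢ q → ∀ a → Open-end α p a → ∃ λ h → CanClear α p (outside? α p a) h × 2 * h ≤ 2 + n
    main p p≢q a end = cost , clear ,
        arith 6 (λ n h x₁ x₂ xq xp → con 4 :≤ n ⇒ (xq :+ xp) :+ (x₁ :+ x₂) :≤ n ⇒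
            (2 :* h :≤ :suc (x₁ :+ x₂) :⊎ h :≡ con 2) ⇒ ∴ 2 :* h :≤ con 2 :+ n)
          n cost (lows α b r₁) (lows α b r₂) (lows α b q) (lows α b p) 4≤n
          (four-lows≤n α b (λ e → p≢q (sym e)) r₁≢r₂ (λ e → r₁≢q (sym e)) (λ e → r₂≢q (sym e)) (λ e →
                r₁≢p (sym e)) (λ e → r₂≢p (sym e)))
          ([ inj₁ , (λ t → inj₂ (proj₁ t)) ]′ bound)
      where
      open Clearing (clearing α p q b (outside? α p a) okα (λ e → p≢q (sym e)) within (λ x →
            proj₁) (not-both-ends α p a end b))

  plan-move : ∀ α → Valid α → (∀ c → Antipodal α c) → Move α → Plan α
  plan-move α okα anti M = record { q = Move.q M ; q* = Move.q* M ; cheap = cheap ; cheaper = AfterMove.clear-other α okα anti M }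
    where
    Target : Fin k → Set
    Target p = ∀ a → Open-end α p a → ∃ λ h → CanClear α p (outside? α p a) h × 2 * h ≤ 3 + n
    decide : ∀ p → p ≢ Move.q M → Dec (p ≡ Move.q* M) → Target p
    decide p p≢q (yes e)       = subst Target (sym e) (AfterMove.clear-target α okα anti M)
    decide p p≢q (no p≢q*) a end = relax (AfterMove.clear-other α okα anti M p p≢q p≢q* a end)
    cheap : ∀ p → p ≢ Move.q M → Target p
    cheap p p≢q = decide p p≢q (p ≟ᶠ Move.q* M)

  plan : 3 * k ≢ suc (2 * n) → ∀ α → Valid α → Plan α
  plan 3k≢N α okα = decide (Finₚ.any? (λ c → ¬? (antipodal? α c)))
    where
    decide : Dec (∃ λ c → ¬ Antipodal α c) → Plan α
    decide (yes (q , ¬a)) = [ (λ a → ⊥-elim (¬a a)) , (λ (b , within) →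
          plan-within α okα q b within) ]′ (antipodal-or-within α q okα)
    decide (no none) = plan-move α okα anti (Moves.move α okα anti (proj₁ loose) (proj₂ loose))
      where
      anti : ∀ c → Antipodal α c
      anti c = [ (λ a → a) , (λ ¬a → ⊥-elim (none (c , ¬a))) ]′ (toSum (antipodal? α c))
      loose : ∃ λ p → Loose α p
      loose = some-loose α okα 3k≢N anti

  -- Filling an interval and assembling the walk.

  fill : ∀ α p a h → CanClear α p (outside? α p a) h →
         ∃ λ γ → Valid γ × Filled γ a p × (∃ λ d → Reach d α γ × d + # (in-set? α p (low? a)) ≤ #
               (outside? α p a) + h + n)
  fill α p a h (β , okβ , reach , only , still) =
    γ , mixed-valid unions γ (λ _ → inj₂ refl) , (fills , only-in) ,
    -- Vertices of p already in the interval keep their colour, so filling it takes at most n minus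
    -- their number of steps. This saving is what later offsets the vertices of p outside.
    # (outside? α p a) + h + # new? , reach-trans reach (walk-directly β γ unions (#-mono
          (differ? β γ) new? differs)) ,
    arith 4 (λ o f i m → f :+ i :≤ m ⇒ ∴ (o :+ f) :+ i :≤ o :+ m) (# (outside? α p a) + h) (# new?) (# (in-set? α p
          (low? a))) n
      (≤-trans (#-disjoint new? (in-set? α p (low? a)) (low? a) (λ x → proj₂) (λ x → proj₂) (λ x (ne , l) (e , _) →
            ne (β-in x e l))) (#-low a))
    where
    γ : Col
    γ x with low? a x
    ... | yes _ = p
    ... | no _  = β x
    γ-case : ∀ x → (pos a x < n × γ x ≡ p) ⊎ (¬ pos a x < n × γ x ≡ β x)
    γ-case x with low? a x
    ... | yes l = inj₁ (l , refl)
    ... | no ¬l = inj₂ (¬l , refl)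
    new? : ∀ x → Dec (β x ≢ p × pos a x < n)
    new? x = ¬? (β x ≟ᶠ p) ×-dec low? a x
    β-in : ∀ x → α x ≡ p → pos a x < n → β x ≡ p
    β-in x e l = still x e (λ (_ , ge) → <⇒≱ l ge)
    β-only : ∀ x → β x ≡ p → pos a x < n
    β-only x e with only x e
    ... | e′ , ¬P = ≰⇒> (λ ge → ¬P (e′ , ge))
    fills : ∀ x → pos a x < n → γ x ≡ p
    fills x l with γ-case x
    ... | inj₁ (_ , e)  = e
    ... | inj₂ (¬l , _) = ⊥-elim (¬l l)
    only-in : ∀ x → γ x ≡ p → pos a x < n
    only-in x e with γ-case x
    ... | inj₁ (l , _)  = l
    ... | inj₂ (_ , e′) = β-only x (trans (sym e′) e)
    differs : ∀ x → β x ≢ γ x → β x ≢ p × pos a x < n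
    differs x d with γ-case x
    ... | inj₁ (l , e) = (λ t → d (trans t (sym e))) , l
    ... | inj₂ (_ , e) = ⊥-elim (d (sym e))
    unions : Unions-OK β γ
    unions c with c ≟ᶠ p
    ... | yes refl = ok-interval a 0 λ x → [ (λ e → z≤n , β-only x e) , (λ e → z≤n , only-in x e) ]′
    ... | no c≢p = ok-⊆ (λ x → [ (λ e → e) , old x ]′) (okβ c)
      where
      old : ∀ x → γ x ≡ c → β x ≡ c
      old x e with γ-case x
      ... | inj₁ (_ , e′) = ⊥-elim (c≢p (trans (sym e) e′))
      ... | inj₂ (_ , e′) = trans (sym e′) e

  -- The two bounds from `fill` and the balance give d + d′ ≤ 2n + h + h′. From 2 (h + h′) ≤ 2n + 5
  -- rounding yields h + h′ ≤ n + 2, and the n + 2 steps of `recolour-outside` bring the total to 4n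
  -- + 4.
  through-interval : ∀ α β p a h h′ → CanClear α p (outside? α p a) h → CanClear β p (outside? β p a) h′ →
    2 * h ≤ 2 + n → 2 * h′ ≤ 3 + n →
    # (outside? α p a) + # (outside? β p a) ≤ # (in-set? α p (low? a)) + # (in-set? β p (low? a)) →
    Reach (4 * n + 4) α β
  through-interval α β p a h h′ cα cβ le le′ balance with fill α p a h cα | fill β p a h′ cβ
  ... | γ , okγ , fγ , d , r , b | δ , okδ , fδ , d′ , r′ , b′ =
    reach-weaken (arith 9 (λ n h h′ d d′ o o′ i i′ → 2 :* h :≤ con 2 :+ n ⇒ 2 :* h′ :≤ con 3 :+ n ⇒
          o :+ o′ :≤ i :+ i′ ⇒
        d :+ i :≤ (o :+ h) :+ n ⇒ d′ :+ i′ :≤ (o′ :+ h′) :+ n ⇒ ∴ (d :+ (n :+ con 2)) :+ d′ :≤ 4 :* n :+ con 4)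
      n h h′ d d′ (# (outside? α p a)) (# (outside? β p a)) (# (in-set? α p (low? a))) (# (in-set? β p
            (low? a))) le le′ balance b b′)
    (reach-trans (reach-trans r (recolour-outside 4≤k γ δ a p okγ okδ fγ fδ)) (reach-sym r′))

  -- Triangle-free sets have at most n vertices, so two of them miss a vertex.
  missed : ∀ α β → Valid α → Valid β → ∀ p → ∃ λ v → α v ≢ p × β v ≢ p
  missed α β okα okβ p = decide (Finₚ.any? (λ v → ¬? (α v ≟ᶠ p) ×-dec ¬? (β v ≟ᶠ p)))
    where
    decide : Dec (∃ λ v → α v ≢ p × β v ≢ p) → ∃ λ v → α v ≢ p × β v ≢ p
    decide (yes found) = found
    decide (no none) = ⊥-elim (1+n≰n (≤-trans (#-exhaust (class? α p) (class? β p) covered)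
      (≤-trans (+-mono-≤ (Shape.class-size α okα p) (Shape.class-size β okβ p))
        (arith 1 (λ n → ∴ n :+ n :≤ 2 :* n) n))))
      where
      covered : ∀ v → α v ≡ p ⊎ β v ≡ p
      covered v with α v ≟ᶠ p | β v ≟ᶠ p
      ... | yes e | _     = inj₁ e
      ... | _     | yes e = inj₂ e
      ... | no ne | no ne′ = ⊥-elim (none (v , ne , ne′))

  -- The intervals starting at v + 1 and v + n + 1 partition the vertices other
  -- than v, so one of them contains at least half of the two classes of p.
  reach-via : ∀ α β (A : Plan α) (B : Plan β) p → p ≢ Plan.q A → p ≢ Plan.q* A → p ≢ Plan.q B → ∀ v → α v ≢ p →
        β v ≢ p → Reach (4 * n + 4) α β
  reach-via α β A B p p≢A p≢A* p≢B v v≢α v≢β = decide (≤-total (outα + outβ) (inα + inβ))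
    where
    1<N : 1 < suc (2 * n)
    1<N = arith 1 (λ n → con 4 :≤ n ⇒ ∴ con 1 :< :suc (2 :* n)) n 4≤n
    n+1<N : suc n < suc (2 * n)
    n+1<N = arith 1 (λ n → con 4 :≤ n ⇒ ∴ :suc n :< :suc (2 :* n)) n 4≤n
    a₁ = at v 1 1<N
    a₂ = at v (suc n) n+1<N
    -- Seen from either starting point v is an end of the complement of the interval; not having
    -- colour p, it is the required `Open-end`.
    end₁ : pos a₁ v ≡ 2 * n
    end₁ = arith 4 (λ n u z d → u :≡ con 1 ⇒ z :≡ con 0 ⇒ d :< :suc (2 :* n) ⇒ :step n u d z ⇒ ∴ d :≡ 2 :* n)
      n (pos v a₁) (pos v v) (pos a₁ v) (pos-at v 1 1<N) (off-self n v) (pos< a₁ v) (off-add n v a₁ v)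
    end₂ : pos a₂ v ≡ n
    end₂ = arith 4 (λ n u z d → u :≡ :suc n ⇒ z :≡ con 0 ⇒ d :< :suc (2 :* n) ⇒ :step n u d z ⇒ ∴ d :≡ n)
      n (pos v a₂) (pos v v) (pos a₂ v) (pos-at v (suc n) n+1<N) (off-self n v) (pos< a₂ v) (off-add n v a₂ v)
    inα  = # (in-set? α p (low? a₁))
    inβ  = # (in-set? β p (low? a₁))
    outα = # (outside? α p a₁)
    outβ = # (outside? β p a₁)
    other-half : ∀ x → x ≢ v → (n ≤ pos a₁ x → pos a₂ x < n) × (n ≤ pos a₂ x → pos a₁ x < n)
    other-half x x≢v = facts arithmetic
      where
      u≢0 : pos v x ≢ 0
      u≢0 e = x≢v (same-pos v (trans e (sym (off-self n v))))
      arithmetic : (pos a₁ x < n ⊎ pos a₂ x < n)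
      arithmetic = arith 6 (λ n u s t d e → u :≢ con 0 ⇒ u :< :suc (2 :* n) ⇒ s :≡ con 1 ⇒ t :≡ :suc n ⇒
            d :< :suc (2 :* n) ⇒ e :< :suc (2 :* n) ⇒
          :step n s d u ⇒ :step n t e u ⇒ ∴ (d :< n :⊎ e :< n))
        n (pos v x) (pos v a₁) (pos v a₂) (pos a₁ x) (pos a₂ x) u≢0 (pos< v x) (pos-at v 1 1<N) (pos-at v
              (suc n) n+1<N)
        (pos< a₁ x) (pos< a₂ x) (off-add n v a₁ x) (off-add n v a₂ x)
      facts : (pos a₁ x < n ⊎ pos a₂ x < n) → (n ≤ pos a₁ x → pos a₂ x < n) × (n ≤ pos a₂ x → pos a₁ x < n)
      facts t = (λ g → [ (λ l → ⊥-elim (<⇒≱ l g)) , (λ l → l) ]′ t) , (λ g → [ (λ l → l) , (λ l →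
            ⊥-elim (<⇒≱ l g)) ]′ t)
    swap₁ : ∀ ε → ε v ≢ p → # (outside? ε p a₁) ≤ # (in-set? ε p (low? a₂))
    swap₁ ε v≢ = #-mono (outside? ε p a₁) (in-set? ε p (low? a₂)) λ x (e , g) → e , proj₁ (other-half x (λ { refl →
          v≢ e })) g
    swap₂ : ∀ ε → ε v ≢ p → # (outside? ε p a₂) ≤ # (in-set? ε p (low? a₁))
    swap₂ ε v≢ = #-mono (outside? ε p a₂) (in-set? ε p (low? a₁)) λ x (e , g) → e , proj₂ (other-half x (λ { refl →
          v≢ e })) g
    via : ∀ a → pos a v ≡ n ⊎ pos a v ≡ 2 * n →
          # (outside? α p a) + # (outside? β p a) ≤ # (in-set? α p (low? a)) + # (in-set? β p (low? a)) →
                Reach (4 * n + 4) α β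
    via a end balance = join
      (Plan.cheaper A p p≢A p≢A* a (v , v≢α , end))
      (Plan.cheap B p p≢B a (v , v≢β , end))
      where
      join : (∃ λ h → CanClear α p (outside? α p a) h × 2 * h ≤ 2 + n) →
             (∃ λ h → CanClear β p (outside? β p a) h × 2 * h ≤ 3 + n) → Reach (4 * n + 4) α β
      join (h , c , le) (h′ , c′ , le′) = through-interval α β p a h h′ c c′ le le′ balance
    decide : outα + outβ ≤ inα + inβ ⊎ inα + inβ ≤ outα + outβ → Reach (4 * n + 4) α β
    decide (inj₁ le) = via a₁ (inj₂ end₁) le
    decide (inj₂ le) = via a₂ (inj₁ end₂)
      (≤-trans (+-mono-≤ (swap₂ α v≢α) (swap₂ β v≢β)) (≤-trans le (+-mono-≤ (swap₁ α v≢α) (swap₁ β v≢β))))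

  reachable : 3 * k ≢ suc (2 * n) → ∀ α β → Valid α → Valid β → Reach (4 * n + 4) α β
  -- A fourth colour to avoid, q* of B, would require k ≥ 5. This is why the clearing of β relies on
  -- `cheap` only.
  reachable 3k≢N α β okα okβ = pick (fresh₃ 4≤k (Plan.q A) (Plan.q* A) (Plan.q B))
    where
    A = plan 3k≢N α okα
    B = plan 3k≢N β okβ
    pick : (∃ λ p → p ≢ Plan.q A × p ≢ Plan.q* A × p ≢ Plan.q B) → Reach (4 * n + 4) α β
    pick (p , p≢A , p≢A* , p≢B) = finish (missed α β okα okβ p)
      where
      finish : (∃ λ v → α v ≢ p × β v ≢ p) → Reach (4 * n + 4) α β
      finish (v , v≢α , v≢β) = reach-via α β A B p p≢A p≢A* p≢B v v≢α v≢β

theorem6 : (n k : ℕ) → 4 ≤ n → 4 ≤ k → 3 * k ≢ suc (2 * n) →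
    DicolConnected C⟨ n ⟩ k × DicolDiamAtMost C⟨ n ⟩ k (4 * n + 2 + n / 2)
theorem6 n k 4≤n 4≤k 3k≢N = (λ α β dα dβ → forget (diameter α β dα dβ)) , diameter
  where
  open Clearing-colours n k 4≤n 4≤k
  forget : ∀ {A B : ℕ → Set} → (Σ ℕ λ t → A t × B t) → Σ ℕ B
  forget (t , _ , b) = t , b
  bound : 4 * n + 4 ≤ 4 * n + 2 + n / 2
  -- From n ≥ 4 follows n / 2 ≥ 2, exactly the gap between 4n + 2 and 4n + 4.
  bound = arith 2 (λ n h → con 2 :≤ h ⇒ ∴ 4 :* n :+ con 4 :≤ (4 :* n :+ con 2) :+ h) n (n / 2) (/-monoˡ-≤ 2 4≤n)
  diameter : DicolDiamAtMost C⟨ n ⟩ k (4 * n + 2 + n / 2)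
  diameter α β dα dβ = finish (reachable 3k≢N α β (dicolouring⇒valid dα) (dicolouring⇒valid dβ))
    where
    finish : Reach (4 * n + 4) α β → Σ ℕ λ t → t ≤ 4 * n + 2 + n / 2 × WalkOfLength C⟨ n ⟩ k t α β
    finish (t , t≤ , p) = t , ≤-trans t≤ bound , toWalk p
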